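{- Let $0\le m\le k-1$ and $e\ge 1$ be integers, let $H$ be an $m$-graph on $[k]$ with $l=|E(H)|$ edges, and put $n=e(k-m)+m$ and $f=e(l-1)+1$. Let $Y$ be the set of $H$-built-trees on $[n]$ with $e$ edges that are rooted at $[m]$. Let $A=[e]$, $B=[e]\times[l-1]$, $C=\{[m]\}$, let $\gamma:B\to A$ be the projection to the first coordinate, and for $i\in[e]$ let $X_i=\left[\binom{(k-m)(e-i+1)-1}{k-m-1}\right]$. Then there is a bijection between $Y$ and $$Z=F(A,B,C,\gamma)\times\prod_{i=1}^e\left(X_i\times \mathcal R_H\right).$$ In particular, $$|Y|=f^{e-1}\left(\frac{k!\,l}{\binom km\,|\mathrm{Aut}(H)|}\right)^e\prod_{i=1}^e\binom{(k-m)(e-i+1)-1}{k-m-1}=\frac{(e(k-m))!\,f^{e-1}}{e!}\left(\frac{m!\,l}{|\mathrm{Aut}(H)|}\right)^e.$$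
   Context: For a positive integer $r$, $[r]=\{1,\dots,r\}$, $[0]=\emptyset$, and $[a,b]=\{a,\dots,b\}$. An $r$-graph on a set $V$ is a set of $r$-element subsets (edges) of $V$. Cycle-free functions: given disjoint finite sets $A,B,C$ and a surjection $\gamma:B\to A$, a function $f:A\to B\cup C$ is cycle-free if for every $b\in B$ the sequence $b,(f\circ\gamma)(b),(f\circ\gamma)^2(b),\dots$ eventually reaches an element of $C$ (where the iteration stops); $F(A,B,C,\gamma)$ denotes the set of all cycle-free functions $A\to B\cup C$. $(k,m)$-trees: with vertex set $[n]$, a non-empty $k$-graph without isolated vertices is a $(k,m)$-tree if its edges can be ordered $E_1,\dots,E_e$ so that for every $i\in[2,e]$ there is $j\in[i-1]$ with $|E_i\cap E_j|=m$ and $(E_i\setminus E_j)\cap\bigcup_{h=1}^{i-1}E_h=\emptyset$. An $m$-subset is called a lap. For an $m$-graph $H$ on $[k]$ and a $k$-set $E$, an $H$-graph on $E$ is the image of $H$ under some bijection $[k]\to E$. An $H$-built-tree $(T,\{H_1,\dots,H_e\})$ consists of a $(k,m)$-tree $T$ with edges $E_1,\dots,E_e$ together with $H$-graphs $H_i$ on $E_i$ ($i\in[e]$) such that for all distinct $i,j\in[e]$, if $|E_i\cap E_j|=m$ then $E_i\cap E_j$ is an edge of both $H_i$ and $H_j$. It has $n=e(k-m)+m$ vertices. It is rooted at an $m$-set $L$ if $L\in\bigcup_{i\in[e]}E(H_i)$. $\mathcal R_H$ denotes the set of distinct $H$-graphs on $[k]$ containing $[m]$ as an edge (so $|\mathcal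 R_H|=k!\,l/(|\mathrm{Aut}(H)|\binom km)$), and $\mathrm{Aut}(H)$ is the automorphism group of $H$ (permutations of $[k]$ preserving $E(H)$). -}

module Defs where

open import Data.Bool.Base using (T)
open import Data.Fin.Base using (Fin; zero; suc; toℕ)
import Data.Fin.Base as Fin
open import Data.Fin.Permutation as Perm using (Permutation′; _⟨$⟩ʳ_)
open import Data.Fin.Properties using (any?; _≟_)
open import Data.Fin.Subset using (Subset; ∣_∣; _∩_; _─_; Empty; ⊤)
  renaming (_∈_ to _∈ˢ_)
open import Data.Fin.Subset.Properties using (⊆-antisym) renaming (_∈?_ to _∈ˢ?_)
open import Data.List.Base using (List; []; _∷_; length; lookup; map)
open import Data.List.Membership.Propositional using (_∈_)
open import Data.List.Membership.Propositional.Properties using (∈-lookup)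
open import Data.List.Properties using (map-cong; map-id)
open import Data.List.Relation.Binary.BagAndSetEquality
  using (_∼[_]_; [_]-Equality; set)
open import Data.List.Relation.Unary.All as All using (All)
open import Data.List.Relation.Unary.AllPairs using (_∷_)
open import Data.List.Relation.Unary.Any using (index)
open import Data.List.Relation.Unary.Any.Properties using (lookup-index)
open import Data.List.Relation.Unary.Unique.Propositional using (Unique)
open import Data.Nat.Base using (ℕ; zero; suc; _<_; _≤_; s≤s⁻¹; NonZero; >-nonZero; ≢-nonZero)
open import Data.Nat.Combinatorics using (_C_; nCn≡1; nCk≡nC[n∸k]; nCk+nC[k+1]≡[n+1]C[k+1])
import Data.Nat.Base as ℕ
import Data.Nat.Properties as ℕ
open import Data.Product.Base using (Σ; Σ-syntax; ∃-syntax; _×_; _,_; proj₁; proj₂)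
open import Data.Rational.Base as ℚ using (ℚ)
open import Data.Sum.Base using (_⊎_; inj₁; inj₂)
open import Data.Vec.Base using (tabulate)
open import Data.Vec.Properties using (lookup⇒[]=; []=⇒lookup; lookup∘tabulate)
open import Function.Base using (_∘_)
open import Function.Bundles using (Bijection; Equivalence)
open import Function.Definitions using (Injective)
open import Level using (0ℓ)
open import Relation.Binary.Bundles using (Setoid)
import Relation.Binary.Construct.On as On
open import Relation.Binary.PropositionalEquality
  using (_≡_; _≢_; refl; sym; trans; subst; cong; setoid; _→-setoid_)
open import Relation.Nullary using (does; _×-dec_; contradiction)
open import Relation.Nullary.Decidable using (dec-true; toWitness; isYes≗does)
open import Relation.Unary using (Pred)

open import Algebra.Definitions.RawSemiring ℕ.+-*-rawSemiring public
  using () renaming (product to ∏)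
open import Algebra.Definitions.RawSemiring ℚ.+-*-rawSemiring public
  using () renaming (_^_ to _^ℚ_)

private
  variable
    k m n r : ℕ

Subsetoid : (S : Setoid 0ℓ 0ℓ) → Pred (Setoid.Carrier S) 0ℓ → Setoid 0ℓ 0ℓ
Subsetoid S P = On.setoid {B = Σ (Setoid.Carrier S) P} S proj₁

Π-setoid : {I : Set} → (I → Setoid 0ℓ 0ℓ) → Setoid 0ℓ 0ℓ
Π-setoid {I} S = record
  { Carrier       = (i : I) → Setoid.Carrier (S i)
  ; _≈_           = λ f g → ∀ i → Setoid._≈_ (S i) (f i) (g i)
  ; isEquivalence = record
    { refl  = λ i → Setoid.refl (S i)
    ; sym   = λ p i → Setoid.sym (S i) (p i)
    ; trans = λ p q i → Setoid.trans (S i) (p i) (q i)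
    }
  }

HasCardinality : Setoid 0ℓ 0ℓ → ℕ → Set
HasCardinality S N = Bijection S (setoid (Fin N))

-- Subsets of [n], with i ∈ [n] represented by the element of Fin n of
-- value i - 1

initial : ∀ m → Subset n
initial m = tabulate λ i → does (toℕ i ℕ.<? m)

image : (Fin k → Fin n) → Subset k → Subset n
image φ S = tabulate λ y → does (any? λ x → (x ∈ˢ? S) ×-dec (φ x ≟ y))

∈-image⁺ : (φ : Fin k → Fin n) {S : Subset k} → ∀ {x} → x ∈ˢ S → φ x ∈ˢ image φ S
∈-image⁺ φ {x = x} x∈S = lookup⇒[]= (φ x) _
  (trans (lookup∘tabulate _ (φ x)) (dec-true (any? _) (x , x∈S , refl)))

∈-image⁻ : (φ : Fin k → Fin n) {S : Subset k} → ∀ {y} → y ∈ˢ image φ S →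
           ∃[ x ] x ∈ˢ S × φ x ≡ y
∈-image⁻ φ {S} {y} y∈ = toWitness
  {a? = any? λ x → (x ∈ˢ? S) ×-dec (φ x ≟ y)}
  (subst T (trans (sym ([]=⇒lookup y∈)) (trans (lookup∘tabulate _ y) (sym (isYes≗does _)))) _)

image-id : (S : Subset n) → image (λ x → x) S ≡ S
image-id S = ⊆-antisym
  (λ y∈ → let _ , x∈S , x≡y = ∈-image⁻ _ y∈ in subst (_∈ˢ S) x≡y x∈S)
  (∈-image⁺ _)

record Graph (r n : ℕ) : Set where
  field
    edges   : List (Subset n)
    uniform : All (λ E → ∣ E ∣ ≡ r) edges
    unique  : Unique edges

  size : ℕ
  size = length edges

  edge : Fin size → Subset n
  edge = lookup edges

open Graph public

-- The order in which the edges are listed is immaterial.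
Graph-setoid : ℕ → ℕ → Setoid 0ℓ 0ℓ
Graph-setoid r n = On.setoid {B = Graph r n} ([ set ]-Equality (Subset n)) edges

infix 4 _≈ᴳ_
_≈ᴳ_ : Graph r n → Graph r n → Set
_≈ᴳ_ {r} {n} = Setoid._≈_ (Graph-setoid r n)

-- φ is a bijection from [k] onto E carrying E(H) onto E(G).
IsCopyOn : Graph m k → Subset n → Graph m n → Set
IsCopyOn {k = k} {n = n} H E G =
  ∃[ φ ] Injective _≡_ _≡_ φ
       × image φ ⊤ ≡ E
       × edges G ∼[ set ] map (image {k} {n} φ) (edges H)

CopiesContainingInitial : Graph m k → Setoid 0ℓ 0ℓ
CopiesContainingInitial {m} {k} H =
  Subsetoid (Graph-setoid m k) λ G → IsCopyOn H ⊤ G × initial m ∈ edges G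

Aut : Graph m k → Setoid 0ℓ 0ℓ
Aut {k = k} H = Subsetoid Permutation-setoid λ σ →
  map (image (σ ⟨$⟩ʳ_)) (edges H) ∼[ set ] edges H
  where
  Permutation-setoid : Setoid 0ℓ 0ℓ
  Permutation-setoid = On.setoid {B = Permutation′ k} (Fin k →-setoid Fin k) _⟨$⟩ʳ_

IsTreeOrdering : ℕ → {e : ℕ} → (Fin e → Subset n) → Set
IsTreeOrdering m E = ∀ i → 0 < toℕ i → ∃[ j ]
    j Fin.< i
  × ∣ E i ∩ E j ∣ ≡ m
  × (∀ h → h Fin.< i → Empty ((E i ─ E j) ∩ E h))

record IsTree (m : ℕ) (T : Graph k n) : Set where
  field
    nonEmpty   : 0 < size T
    noIsolated : ∀ v → ∃[ i ] v ∈ˢ edge T i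
    ordering   : Σ[ σ ∈ Permutation′ (size T) ] IsTreeOrdering m λ i → edge T (σ ⟨$⟩ʳ i)

record BuiltTree (H : Graph m k) (n : ℕ) : Set where
  field
    tree    : Graph k n
    isTree  : IsTree m tree
    block   : Fin (size tree) → Graph m n
    isCopy  : ∀ i → IsCopyOn H (edge tree i) (block i)
    laps    : ∀ i j → i ≢ j → ∣ edge tree i ∩ edge tree j ∣ ≡ m →
                edge tree i ∩ edge tree j ∈ edges (block i)
              × edge tree i ∩ edge tree j ∈ edges (block j)

open BuiltTree public

RootedAt : {H : Graph m k} → Subset n → BuiltTree H n → Set
RootedAt L t = ∃[ i ] L ∈ edges (block t i)

-- Same tree, and the same H-graph on each of its edges; the indices of
-- an edge in the two listings need not agree.
infix 4 _≈ᵀ_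
_≈ᵀ_ : {H : Graph m k} → BuiltTree H n → BuiltTree H n → Set
t ≈ᵀ u = tree t ≈ᴳ tree u
       × (∀ i j → edge (tree t) i ≡ edge (tree u) j → block t i ≈ᴳ block u j)

private
  lookup-injective : ∀ {A : Set} {xs : List A} → Unique xs →
                     ∀ i j → lookup xs i ≡ lookup xs j → i ≡ j
  lookup-injective (_ ∷ _)  zero    zero    _  = refl
  lookup-injective (p ∷ _)  zero    (suc j) eq = contradiction eq (All.lookup p (∈-lookup j))
  lookup-injective (p ∷ _)  (suc i) zero    eq = contradiction (sym eq) (All.lookup p (∈-lookup i))
  lookup-injective (_ ∷ ps) (suc i) (suc j) eq = cong suc (lookup-injective ps i j eq)

  module G {r n} = Setoid (Graph-setoid r n)

  ≈ᵀ-refl : {H : Graph m k} {t : BuiltTree H n} → t ≈ᵀ t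
  ≈ᵀ-refl {t = t} = G.refl {x = tree t} , λ i j eq →
    subst (λ j → block t i ≈ᴳ block t j)
          (lookup-injective (unique (tree t)) i j eq)
          (G.refl {x = block t i})

  ≈ᵀ-sym : {H : Graph m k} {t u : BuiltTree H n} → t ≈ᵀ u → u ≈ᵀ t
  ≈ᵀ-sym {t = t} {u} (p , q) = G.sym {x = tree t} {tree u} p , λ i j eq →
    G.sym {x = block t j} {block u i} (q j i (sym eq))

  ≈ᵀ-trans : {H : Graph m k} {t u v : BuiltTree H n} → t ≈ᵀ u → u ≈ᵀ v → t ≈ᵀ v
  ≈ᵀ-trans {t = t} {u} {v} (p , q) (p′ , q′) =
    G.trans {i = tree t} {tree u} {tree v} p p′ , λ i j eq →
      let i∈u = Equivalence.to p (∈-lookup {xs = edges (tree t)} i)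
          eq′ = lookup-index i∈u
      in G.trans {i = block t i} {block u (index i∈u)} {block v j}
           (q i (index i∈u) eq′) (q′ (index i∈u) j (trans (sym eq′) eq))

BuiltTree-setoid : Graph m k → ℕ → Setoid 0ℓ 0ℓ
BuiltTree-setoid H n = record
  { Carrier       = BuiltTree H n
  ; _≈_           = _≈ᵀ_
  ; isEquivalence = record
    { refl  = λ {t} → ≈ᵀ-refl {t = t}
    ; sym   = λ {t} {u} → ≈ᵀ-sym {t = t} {u}
    ; trans = λ {t} {u} {v} → ≈ᵀ-trans {t = t} {u} {v}
    }
  }

RootedBuiltTrees : (H : Graph m k) → (e : ℕ) → Subset n → Setoid 0ℓ 0ℓ
RootedBuiltTrees {n = n} H e L =
  Subsetoid (BuiltTree-setoid H n) λ t → size (tree t) ≡ e × RootedAt L t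

module _ {A B C : Set} (γ : B → A) (f : A → B ⊎ C) where

  -- The sequence x, (f ∘ γ) x, (f ∘ γ)² x, … reaches an element of C,
  -- where it stops. Disjointness of A, B and C is built into the types.
  data Reaches : B ⊎ C → Set where
    stop : ∀ {c} → Reaches (inj₂ c)
    step : ∀ {b} → Reaches (f (γ b)) → Reaches (inj₁ b)

  CycleFree : Set
  CycleFree = ∀ b → Reaches (inj₁ b)

-- γ is not required to be surjective: for a graph with a single edge it
-- is the map out of the empty set [e] × [0].
CycleFreeFunctions : (A B C : Set) → (B → A) → Setoid 0ℓ 0ℓ
CycleFreeFunctions A B C γ = Subsetoid (A →-setoid (B ⊎ C)) (CycleFree γ)

nCk-nonZero : k ≤ n → NonZero (n C k)
nCk-nonZero {zero}  {n}     _   = ≢-nonZero λ eq → contradiction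
  (trans (sym (nCn≡1 n)) (trans (nCk≡nC[n∸k] {n} ℕ.≤-refl) (trans (cong (n C_) (ℕ.n∸n≡0 n)) eq))) λ ()
nCk-nonZero {suc k} {suc n} k≤n = subst NonZero (nCk+nC[k+1]≡[n+1]C[k+1] n k)
  (>-nonZero (ℕ.≤-trans (ℕ.>-nonZero⁻¹ (n C k) {{nCk-nonZero (s≤s⁻¹ k≤n)}}) (ℕ.m≤m+n (n C k) _)))

Aut-nonZero : (H : Graph m k) → ∀ {a} → HasCardinality (Aut H) a → NonZero a
Aut-nonZero {k = k} H {zero}  c = contradiction (Bijection.to c (Perm.id , identity)) λ ()
  where
  identity : map (image {k} (λ x → x)) (edges H) ∼[ set ] edges H
  identity = subst (_∼[ set ] edges H)
    (sym (trans (map-cong image-id (edges H)) (map-id (edges H))))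
    (Setoid.refl ([ set ]-Equality _) {edges H})
Aut-nonZero H {suc a} c = _

{-# OPTIONS --safe #-}
module Submission where

-- Both Y and Z are counted.
--
-- Directing a rooted H-built-tree away from its root lap [m] gives every edge a parent lap. Removing
-- the parent laps from the edges leaves a partition of [n] ∖ [m], which is listed so that each part
-- contains the least vertex not in an earlier one. Relabelling an edge so that its parent lap
-- becomes [m] turns its block into a member of R_H, and sending an edge to its parent lap (a
-- non-root lap of another edge, or [m]) is a cycle-free function. These data determine the tree,
-- and every choice of them occurs.
--
-- The cycle-free functions f are counted by deleting a ∈ A: if f a = t, then the elements of B over a
-- can be regarded as lying over γ t, and as terminal if t ∈ C. This leaves |B ∪ C| unchanged, and
-- gives |C| |B ∪ C|^(|A| - 1) by induction on |A|. Finally |R_H| |Aut H| = l m! (k - m)!, both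
-- sides being the number of permutations of [k] which map some edge of H to [m].

-- Labels are the obstacle: a built-tree is an unordered set of edges, whereas a code numbers them
-- by `Fin e`. The canonical order of the parts removes this freedom, since a tree that determines
-- its parts also determines the number of every edge. Each lap other than the root lap is uniquely
-- a pair `(c, j)`: it contains a vertex of the part of `c`, and `j` numbers the edges of the
-- template of `c` other than [m], whence l - 1. Several edges may hang at one lap; they all point
-- to the edge `c` where the lap first occurs, never to each other. The measure is the level of an
-- edge, its number of steps to the root under f. A parent lap has its vertices in the root lap and
-- in parts of lower level, so two edges meet inside the parent lap of the one whose level is not
-- lower, and sorting by level gives a tree ordering. Conversely, a given tree ordering need not
-- begin near [m], and an initial segment of it may miss [m] altogether. The orientation of an
-- initial segment is therefore constructed for an arbitrary root lap.

open import Defs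
open import Axiom.UniquenessOfIdentityProofs using (module Decidable⇒UIP)
import Algebra.Properties.CommutativeSemigroup
import Data.Bool.Properties as Bool
open import Data.Empty using (⊥-elim)
open import Data.Fin.Base using (Fin; zero; suc; toℕ; fromℕ<; splitAt; cast; combine; remQuot; punchIn; punchOut; _↑ˡ_; _↑ʳ_)
import Data.Fin.Base as F
open import Data.Fin.Permutation as Perm using (Permutation′; permutation; _⟨$⟩ʳ_; _⟨$⟩ˡ_; inverseˡ; inverseʳ; insert; insert-punchIn; ↔⇒≡)
import Data.Fin.Properties as Fin
open import Data.Fin.Subset using (Subset; Side; inside; outside; ∣_∣; _∩_; _∪_; _─_; _-_; ⁅_⁆; Empty; Nonempty; ∁; ⊤; ⊥; _⊆_; _∈_; _∉_)
open import Data.Fin.Subset.Properties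
open import Data.List.Base using (List; []; _∷_; length; lookup; map; tabulate)
open import Data.List.Membership.DecPropositional using () renaming (_∈?_ to member?)
import Data.List.Membership.Propositional as L
open import Data.List.Membership.Propositional.Properties using (∈-lookup; ∈-map⁺; ∈-map⁻)
import Data.List.Properties as List
open import Data.List.Relation.Binary.BagAndSetEquality using (_∼[_]_; set; [_]-Equality) renaming (map-cong to ∼-map-cong)
open import Data.List.Relation.Unary.All as All using (All)
import Data.List.Relation.Unary.All.Properties as All
open import Data.List.Relation.Unary.AllPairs using (_∷_)
import Data.List.Relation.Unary.Any as Any
open import Data.List.Relation.Unary.Any.Properties using (lookup-index)
open import Data.List.Relation.Unary.Unique.Propositional using (Unique)
import Data.List.Relation.Unary.Unique.Propositional.Properties as Unique
open import Data.Maybe.Base using (Maybe; just; nothing)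
open import Data.Nat.Base using (ℕ; zero; suc; _+_; _*_; _∸_; _^_; _≤_; _<_; s≤s; z≤n; _!; NonZero)
open import Data.Nat.Combinatorics using (_C_; nCk≡n!/k![n-k]!; k![n∸k]!∣n!; nCk+nC[k+1]≡[n+1]C[k+1])
open import Data.Nat.DivMod using (m/n*n≡m)
open import Data.Nat.Induction using (<-wellFounded)
open import Data.Nat.Properties using (m*n≢0; _!≢0; <⇒≤; _!*_!≢0; m^n≢0)
import Data.Nat.Properties as ℕ
open import Data.Nat.Tactic.RingSolver using (solve-∀)
open import Data.Product.Base using (Σ-syntax; ∃-syntax; _×_; _,_; proj₁; proj₂)
open import Data.Product.Relation.Binary.Pointwise.NonDependent using (×-setoid)
open import Data.Sum.Base using (_⊎_; inj₁; inj₂; [_,_]′)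
open import Data.Vec.Base as Vec using ([]; _∷_; here; there)
open import Data.Vec.Functional using (updateAt)
open import Data.Vec.Functional.Properties using (updateAt-updates; updateAt-minimal)
import Data.Vec.Properties as Vec
open import Function.Base using (_∘_; const)
open import Function.Bundles using (Bijection; Equivalence; Inverse; mk⇔)
open import Function.Definitions using (Injective)
open import Function.Properties.Bijection using (Bijection⇒Inverse; sym-≡) renaming (refl to Bijection-refl; trans to _⨾_)
open import Function.Properties.Inverse using (Inverse⇒Bijection) renaming (sym to Inverse-sym)
open import Induction.WellFounded using (Acc; acc)
open import Level using (0ℓ)
open import Relation.Binary.Bundles using (Setoid)
open import Relation.Binary.Definitions using (_Respects_; Decidable)
open import Relation.Binary.PropositionalEquality
open import Relation.Nullary using (¬_; Dec; yes; no; contradiction; ¬?; map′; _×-dec_)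
open import Relation.Nullary.Decidable using (dec-false)
open import Relation.Unary using (Pred) renaming (Decidable to Decidable₁)
open import Algebra.Properties.Semiring.Sum ℕ.+-*-semiring using (sum; ∑-distrib-+; *-distribˡ-sum; *-distribʳ-sum; sum-cong-≗)

open Setoid using (Carrier)

private
  variable
    d e k m n : ℕ

-- Bijections and cardinalities of setoids

module _ (S T : Setoid 0ℓ 0ℓ) where
  private
    module S = Setoid S
    module T = Setoid T

  mkBijection : (to : S.Carrier → T.Carrier) →
                (∀ {x y} → x S.≈ y → to x T.≈ to y) →
                (∀ {x y} → to x T.≈ to y → x S.≈ y) →
                (∀ y → ∃[ x ] to x T.≈ y) → Bijection S T
  mkBijection to cong injective surjective = record
    { to        = to
    ; cong      = cong
    ; bijective = injective , λ y → let x , eq = surjective y in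
                  x , λ z≈x → T.trans (cong z≈x) eq
    }

Bijection-sym : {S T : Setoid 0ℓ 0ℓ} → Bijection S T → Bijection T S
Bijection-sym = Inverse⇒Bijection ∘ Inverse-sym ∘ Bijection⇒Inverse

module HasCardinality (S : Setoid 0ℓ 0ℓ) {N : ℕ} (c : HasCardinality S N) where
  private module S = Setoid S

  index : S.Carrier → Fin N
  index = Bijection.to c

  abstract
    element : Fin N → S.Carrier
    element = Inverse.from (Bijection⇒Inverse c)

    index∘element : ∀ i → index (element i) ≡ i
    index∘element i = proj₂ (Bijection.strictlySurjective c i)

    element∘index : ∀ s → element (index s) S.≈ s
    element∘index s = Bijection.injective c (index∘element (index s))

  element-injective : ∀ {i j} → element i S.≈ element j → i ≡ j
  element-injective eq = trans (sym (index∘element _)) (trans (Bijection.cong c eq) (index∘element _))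

cardinality-unique : (S : Setoid 0ℓ 0ℓ) → ∀ {a b} → HasCardinality S a → HasCardinality S b → a ≡ b
cardinality-unique S c d = ↔⇒≡ (Bijection⇒Inverse (sym-≡ c ⨾ d))

Fin-cardinality : ∀ n → HasCardinality (setoid (Fin n)) n
Fin-cardinality n = Bijection-refl

empty-cardinality : (S : Setoid 0ℓ 0ℓ) → ¬ Carrier S → HasCardinality S 0
empty-cardinality S ¬s = mkBijection S _ (λ s → ⊥-elim (¬s s))
  (λ {x} → ⊥-elim (¬s x)) (λ {x} → ⊥-elim (¬s x)) λ ()

singleton-cardinality : (S : Setoid 0ℓ 0ℓ) (x : Carrier S) → (∀ y → Setoid._≈_ S y x) →
                        HasCardinality S 1
singleton-cardinality S x all = mkBijection S _ (λ _ → zero) (λ _ → refl)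
  (λ {y} {z} _ → S.trans (all y) (S.sym (all z))) λ { zero → x , refl }
  where module S = Setoid S

private
  join : ∀ {M} (c : Fin M → ℕ) i → Fin (c i) → Fin (sum c)
  join c zero    j = j ↑ˡ _
  join c (suc i) j = c zero ↑ʳ join (c ∘ suc) i j

  split : ∀ {M} (c : Fin M → ℕ) x → ∃[ i ] ∃[ j ] join c i j ≡ x
  split {suc M} c x with splitAt (c zero) x in eq
  ... | inj₁ j = zero , j , Fin.splitAt⁻¹-↑ˡ eq
  ... | inj₂ y = let i , j , p = split (c ∘ suc) y in
    suc i , j , trans (cong (c zero ↑ʳ_) p) (Fin.splitAt⁻¹-↑ʳ eq)

  join-injective : ∀ {M} (c : Fin M → ℕ) i i′ {j j′} → join c i j ≡ join c i′ j′ →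
                   Σ[ eq ∈ i ≡ i′ ] subst (Fin ∘ c) eq j ≡ j′
  join-injective c zero    zero     eq = refl , Fin.↑ˡ-injective _ _ _ eq
  join-injective c zero    (suc i′) {j} {j′} eq = contradiction
    (trans (sym (Fin.splitAt-↑ˡ (c zero) j _))
      (trans (cong (splitAt (c zero)) eq) (Fin.splitAt-↑ʳ (c zero) _ (join (c ∘ suc) i′ j′)))) λ ()
  join-injective c (suc i) zero     {j} {j′} eq = contradiction
    (trans (sym (Fin.splitAt-↑ˡ (c zero) j′ _))
      (trans (cong (splitAt (c zero)) (sym eq)) (Fin.splitAt-↑ʳ (c zero) _ (join (c ∘ suc) i j)))) λ ()
  join-injective c (suc i) (suc i′) eq
    with refl , p ← join-injective (c ∘ suc) i i′ (Fin.↑ʳ-injective (c zero) _ _ eq) = refl , p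

module _ (S : Setoid 0ℓ 0ℓ) where
  private module S = Setoid S

  fibre : {I : Set} → (S.Carrier → I) → I → Setoid 0ℓ 0ℓ
  fibre g i = Subsetoid S λ s → g s ≡ i

  -- `Fin (sum c)` is a row of consecutive blocks of lengths `c i`; an element goes into the block
  -- of its fibre, at the position which `card` gives it there.
  fibre-sum : ∀ {M} (g : S.Carrier → Fin M) → (∀ {s t} → s S.≈ t → g s ≡ g t) →
              (c : Fin M → ℕ) → (∀ i → HasCardinality (fibre g i) (c i)) →
              HasCardinality S (sum c)
  fibre-sum g g-cong c card = mkBijection S _ to to-cong injective surjective
    where
    ix : ∀ i s → g s ≡ i → Fin (c i)
    ix i s p = Bijection.to (card i) (s , p)

    to : S.Carrier → Fin (sum c)
    to s = join c (g s) (ix (g s) s refl)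

    to≡ : ∀ s {i} (p : g s ≡ i) → to s ≡ join c i (ix i s p)
    to≡ s refl = refl

    to-cong : ∀ {s t} → s S.≈ t → to s ≡ to t
    to-cong {s} {t} eq = trans (to≡ s (g-cong eq)) (cong (join c (g t)) (Bijection.cong (card (g t)) eq))

    injective : ∀ {s t} → to s ≡ to t → s S.≈ t
    injective {s} {t} eq = go (proj₁ (join-injective c _ _ eq)) eq
      where
      go : g s ≡ g t → to s ≡ to t → s S.≈ t
      go p eq with join-injective c (g t) (g t) (trans (sym (to≡ s p)) eq)
      -- The proof `q` of `g t ≡ g t` is arbitrary; decidable equality on `Fin` identifies it with
      -- `refl`, so the transport disappears.
      ... | q , r = Bijection.injective (card (g t)) {s , p} {t , refl}
        (trans (cong (λ q → subst (Fin ∘ c) q _) (Decidable⇒UIP.≡-irrelevant Fin._≟_ refl q)) r)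

    surjective : ∀ x → ∃[ s ] to s ≡ x
    surjective x with split c x
    ... | i , j , eq with Bijection.strictlySurjective (card i) j
    ... | (s , p) , r = s , trans (to≡ s p) (trans (cong (join c i) r) eq)

sum-const : ∀ M c → sum {M} (λ _ → c) ≡ M * c
sum-const zero    c = refl
sum-const (suc M) c = cong (c +_) (sum-const M c)

-- Fibres are taken up to the equality of `I`; an enumeration of `I` turns them into the fibres of
-- `fibre-sum`, all of size `c`.
fibre-product : (S I : Setoid 0ℓ 0ℓ) → let open Setoid I in
  (g : Carrier S → Carrier I) → (∀ {s t} → Setoid._≈_ S s t → g s ≈ g t) →
  ∀ {M c} → HasCardinality I M →
  (∀ i → HasCardinality (Subsetoid S λ s → g s ≈ i) c) → HasCardinality S (M * c)
fibre-product S I g g-cong {M} {c} card fibres =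
  subst (HasCardinality S) (sum-const M c)
    (fibre-sum S (index ∘ g) (Bijection.cong card ∘ g-cong) (λ _ → c) λ i →
      mkBijection _ _
        (λ (s , p) → s , I.trans (I.sym (element∘index (g s))) (I.reflexive (cong element p)))
        (λ eq → eq) (λ eq → eq)
        (λ (s , p) → (s , trans (Bijection.cong card p) (index∘element i)) , Setoid.refl S)
      ⨾ fibres (element i))
  where
  module I = Setoid I
  open HasCardinality I card

×-cardinality : (S T : Setoid 0ℓ 0ℓ) → ∀ {a b} → HasCardinality S a → HasCardinality T b →
                HasCardinality (×-setoid S T) (a * b)
×-cardinality S T c d = fibre-product (×-setoid S T) S proj₁ proj₁ c λ s →
  mkBijection _ T (proj₂ ∘ proj₁) proj₂
    (λ {((s₁ , _) , p)} {((s₂ , _) , q)} eq → S.trans p (S.sym q) , eq)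
    (λ t → ((s , t) , S.refl) , Setoid.refl T)
  ⨾ d
  where module S = Setoid S

Π-cardinality : ∀ n (S : Fin n → Setoid 0ℓ 0ℓ) (c : Fin n → ℕ) →
                (∀ i → HasCardinality (S i) (c i)) → HasCardinality (Π-setoid S) (∏ c)
Π-cardinality zero    S c cards = singleton-cardinality (Π-setoid S) (λ ()) λ _ ()
Π-cardinality (suc n) S c cards =
  mkBijection (Π-setoid S) (×-setoid (S zero) (Π-setoid (S ∘ suc)))
    (λ f → f zero , f ∘ suc)
    (λ eq → eq zero , λ i → eq (suc i))
    (λ { (p , q) zero → p ; (p , q) (suc i) → q i })
    (λ (x , f) → (λ { zero → x ; (suc i) → f i }) , Setoid.refl (S zero) , λ i → Setoid.refl (S (suc i)))
  ⨾ ×-cardinality (S zero) (Π-setoid (S ∘ suc)) (cards zero) (Π-cardinality n (S ∘ suc) (c ∘ suc) (cards ∘ suc))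

split-cardinality : (S : Setoid 0ℓ 0ℓ) {P : Pred (Carrier S) 0ℓ} → Decidable₁ P →
  P Respects (Setoid._≈_ S) → ∀ {a b} →
  HasCardinality (Subsetoid S P) a → HasCardinality (Subsetoid S (¬_ ∘ P)) b → HasCardinality S (a + b)
split-cardinality S {P} P? resp {a} {b} c d =
  subst (HasCardinality S) (cong (a +_) (ℕ.+-identityʳ b))
    (fibre-sum S (flag ∘ P?) (λ eq → flag-cong (resp eq) (resp (S.sym eq)) (P? _) (P? _)) counts cards)
  where
  module S = Setoid S
  flag : {A : Set} → Dec A → Fin 2
  flag (yes _) = zero
  flag (no _)  = suc zero

  flag-cong : {A B : Set} → (A → B) → (B → A) → (p : Dec A) (q : Dec B) → flag p ≡ flag q
  flag-cong f g (yes _) (yes _) = refl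
  flag-cong f g (yes a) (no ¬b) = contradiction (f a) ¬b
  flag-cong f g (no ¬a) (yes b) = contradiction (g b) ¬a
  flag-cong f g (no _)  (no _)  = refl

  flag-yes : {A : Set} (p : Dec A) → flag p ≡ zero → A
  flag-yes (yes a) _ = a
  flag-no : {A : Set} (p : Dec A) → flag p ≡ suc zero → ¬ A
  flag-no (no ¬a) _ = ¬a

  counts : Fin 2 → ℕ
  counts zero    = a
  counts (suc _) = b

  cards : ∀ i → HasCardinality (fibre S (flag ∘ P?) i) (counts i)
  cards zero = mkBijection _ (Subsetoid S P) (λ (s , p) → s , flag-yes (P? s) p) (λ eq → eq) (λ eq → eq)
    (λ (s , p) → (s , flag-cong (λ p → p) (λ p → p) (P? s) (yes p)) , S.refl) ⨾ c
  cards (suc zero) = mkBijection _ (Subsetoid S (¬_ ∘ P)) (λ (s , p) → s , flag-no (P? s) p) (λ eq → eq) (λ eq → eq)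
    (λ (s , ¬p) → (s , flag-cong (λ p → contradiction p ¬p) (λ p → p) (P? s) (no ¬p)) , S.refl) ⨾ d

-- Dropping `h zero` from the list of values loses a class exactly when `h zero` is not equivalent
-- to a later value.
quotient-cardinality : ∀ {N} (T : Setoid 0ℓ 0ℓ) → Decidable (Setoid._≈_ T) → (h : Fin N → Carrier T) →
  ∃[ c ] HasCardinality (Subsetoid T λ t → ∃[ i ] Setoid._≈_ T (h i) t) c
quotient-cardinality {zero}  T _≟_ h = 0 , empty-cardinality _ λ { (_ , () , _) }
quotient-cardinality {suc N} T _≟_ h = proj₁ ih + proj₁ rest ,
  split-cardinality range (λ (t , _) → Fin.any? λ i → h (suc i) ≟ t) (λ eq (i , p) → i , T.trans p eq)
    (mkBijection _ later (λ ((t , _) , p) → t , p) (λ eq → eq) (λ eq → eq)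
      (λ (t , i , p) → ((t , suc i , p) , i , p) , T.refl) ⨾ proj₂ ih)
    (proj₂ rest)
  where
  module T = Setoid T
  range later : Setoid 0ℓ 0ℓ
  range = Subsetoid T λ t → ∃[ i ] h i T.≈ t
  later = Subsetoid T λ t → ∃[ i ] h (suc i) T.≈ t
  ih = quotient-cardinality T _≟_ (h ∘ suc)
  only-first = Subsetoid range λ (t , _) → ¬ (∃[ i ] h (suc i) T.≈ t)

  first : ∀ t → (∃[ i ] h i T.≈ t) → ¬ (∃[ i ] h (suc i) T.≈ t) → h zero T.≈ t
  first t (zero , p)  _  = p
  first t (suc i , p) ¬p = contradiction (i , p) ¬p

  rest : ∃[ c ] HasCardinality only-first c
  rest with Fin.any? (λ i → h (suc i) ≟ h zero)
  ... | yes (i , p) = 0 , empty-cardinality _ λ { ((t , q) , ¬q) → ¬q (i , T.trans p (first t q ¬q)) }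
  ... | no ¬p       = 1 , singleton-cardinality _ ((h zero , zero , T.refl) , ¬p)
                            λ { ((t , q) , ¬q) → T.sym (first t q ¬q) }

surjection-cardinality : (S T : Setoid 0ℓ 0ℓ) → Decidable (Setoid._≈_ T) → ∀ {N} → HasCardinality S N →
  (g : Carrier S → Carrier T) → (∀ {x y} → Setoid._≈_ S x y → Setoid._≈_ T (g x) (g y)) →
  (∀ t → ∃[ s ] Setoid._≈_ T (g s) t) → ∃[ c ] HasCardinality T c
surjection-cardinality S T _≟_ card g g-cong onto = proj₁ q ,
  (mkBijection T _ (λ t → t , index (proj₁ (onto t)) , T.trans (g-cong (element∘index _)) (proj₂ (onto t)))
    (λ eq → eq) (λ eq → eq) (λ (t , _) → t , T.refl) ⨾ proj₂ q)
  where
  module T = Setoid T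
  open HasCardinality S card
  q = quotient-cardinality T _≟_ (g ∘ element)

subset-cardinality : (S : Setoid 0ℓ 0ℓ) {P : Pred (Carrier S) 0ℓ} → Decidable₁ P →
  P Respects (Setoid._≈_ S) → ∀ {N} → HasCardinality S N → ∃[ c ] HasCardinality (Subsetoid S P) c
subset-cardinality S {P} P? resp {N} card = sum (proj₁ ∘ counted) ,
  fibre-sum (Subsetoid S P) (index ∘ proj₁) (Bijection.cong card) (proj₁ ∘ counted) (proj₂ ∘ counted)
  where
  module S = Setoid S
  open HasCardinality S card
  back : ∀ {i s} → index s ≡ i → s S.≈ element i
  back eq = S.trans (S.sym (element∘index _)) (S.reflexive (cong element eq))
  counted : ∀ i → ∃[ c ] HasCardinality (fibre (Subsetoid S P) (index ∘ proj₁) i) c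
  counted i with P? (element i)
  ... | yes p = 1 , singleton-cardinality _ ((element i , p) , index∘element i) λ (_ , eq) → back eq
  ... | no ¬p = 0 , empty-cardinality _ λ ((_ , p) , eq) → ¬p (resp (back eq) p)

-- Counting cycle-free functions

-- d ∈ Fin N lies over the element a of Fin e if owner d ≡ just a, and is terminal if owner d ≡ nothing.
module _ {e N : ℕ} (owner : Fin N → Maybe (Fin e)) (f : Fin e → Fin N) where

  data Terminates (d : Fin N) : Set where
    terminal : owner d ≡ nothing → Terminates d
    iterate  : ∀ {a} → owner d ≡ just a → Terminates (f a) → Terminates d

terminates-owner : ∀ {e N} {owner : Fin N → Maybe (Fin e)} {f} {d d′} → owner d ≡ owner d′ →
                   Terminates owner f d → Terminates owner f d′
terminates-owner eq (terminal p)  = terminal (trans (sym eq) p)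
terminates-owner eq (iterate p t) = iterate (trans (sym eq) p) t

-- `owner` generalises the projection of B to A: after a contraction the fibres may have different
-- sizes and elements may have become terminal, so a product no longer describes them.
TerminatingFunctions : ∀ {e N} → (Fin N → Maybe (Fin e)) → Setoid 0ℓ 0ℓ
TerminatingFunctions {e} {N} owner = Subsetoid (Fin e →-setoid Fin N) λ f → ∀ d → Terminates owner f d

nothing? : {A : Set} → Maybe A → ℕ
nothing? nothing  = 1
nothing? (just _) = 0

terminals : ∀ {e N} → (Fin N → Maybe (Fin e)) → ℕ
terminals owner = sum (nothing? ∘ owner)

private
  zero? suc? : ∀ {e} → Maybe (Fin (suc e)) → ℕ
  zero? (just zero) = 1
  zero? _           = 0
  suc? (just (suc _)) = 1
  suc? _              = 0

  trichotomy : ∀ {e} (x : Maybe (Fin (suc e))) → suc? x + nothing? x + zero? x ≡ 1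
  trichotomy nothing        = refl
  trichotomy (just zero)    = refl
  trichotomy (just (suc _)) = refl

  ones : ∀ N → sum {N} (λ _ → 1) ≡ N
  ones N = trans (sum-const N 1) (ℕ.*-identityʳ N)

-- Deleting the element zero of Fin (suc e): whatever lay over it now lies over s.
contract : ∀ {e} → Maybe (Fin e) → Maybe (Fin (suc e)) → Maybe (Fin e)
contract s nothing        = nothing
contract s (just zero)    = s
contract s (just (suc a)) = just a

-- The value `t` of `f zero` is fixed. By `owner-t`, `s` is the owner of `t` after the deletion of
-- zero; `loopless` excludes that zero leads back to itself.
module _ {e N : ℕ} (owner : Fin N → Maybe (Fin (suc e))) (t : Fin N)
         {s : Maybe (Fin e)} (loopless : owner t ≢ just zero) (owner-t : contract s (owner t) ≡ s) where

  private
    contracted : Fin N → Maybe (Fin e)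
    contracted d = contract s (owner d)

    -- A step through zero leads to `t`, whose owner after contraction is that of everything that
    -- lay over zero, so the step can be skipped.
    restrict : ∀ {f d} → f zero ≡ t → Terminates owner f d → Terminates contracted (f ∘ suc) d
    restrict p (terminal q) = terminal (cong (contract s) q)
    restrict p (iterate {zero} q r) = terminates-owner
      (trans owner-t (sym (cong (contract s) q)))
      (subst (Terminates contracted _) p (restrict p r))
    restrict p (iterate {suc a} q r) = iterate (cong (contract s) q) (restrict p r)

    _◂_ : Fin N → (Fin e → Fin N) → Fin (suc e) → Fin N
    (x ◂ f) zero    = x
    (x ◂ f) (suc a) = f a

    cases : (x : Maybe (Fin (suc e))) → (x ≡ nothing) ⊎ (x ≡ just zero) ⊎ (∃[ a ] x ≡ just (suc a))
    cases nothing        = inj₁ refl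
    cases (just zero)    = inj₂ (inj₁ refl)
    cases (just (suc a)) = inj₂ (inj₂ (a , refl))

    at-t : ∀ {f} → (s ≡ nothing ⊎ ∃[ a ] s ≡ just a × Terminates owner (t ◂ f) (f a)) → Terminates owner (t ◂ f) t
    at-t h with cases (owner t)
    at-t h | inj₁ p = terminal p
    at-t h | inj₂ (inj₁ p) = contradiction p loopless
    at-t h | inj₂ (inj₂ (a , p)) with trans (sym owner-t) (cong (contract s) p)
    at-t (inj₂ (_ , refl , r)) | inj₂ (inj₂ (a , p)) | refl = iterate p r

    -- The converse of `restrict`: an element over zero regains the step from zero to `t`, and
    -- `at-t` continues from there.
    extend : ∀ {f d} → Terminates contracted f d → Terminates owner (t ◂ f) d
    extend {f} {d} r with cases (owner d)
    extend (terminal q) | inj₁ p = terminal p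
    extend (iterate q r) | inj₁ p = contradiction (trans (sym q) (cong (contract s) p)) λ ()
    extend (terminal q) | inj₂ (inj₁ p) = iterate p (at-t (inj₁ (trans (sym (cong (contract s) p)) q)))
    extend (iterate q r) | inj₂ (inj₁ p) =
      iterate p (at-t (inj₂ (_ , trans (sym (cong (contract s) p)) q , extend r)))
    extend (terminal q) | inj₂ (inj₂ (a , p)) = contradiction (trans (sym q) (cong (contract s) p)) λ ()
    extend (iterate q r) | inj₂ (inj₂ (a , p)) with refl ← trans (sym q) (cong (contract s) p) = iterate p (extend r)

  contraction : Bijection (fibre (TerminatingFunctions owner) (λ (f , _) → f zero) t)
                          (TerminatingFunctions λ d → contract s (owner d))
  contraction = mkBijection (fibre (TerminatingFunctions owner) (λ (f , _) → f zero) t)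
                            (TerminatingFunctions λ d → contract s (owner d))
    (λ ((f , r) , p) → f ∘ suc , restrict p ∘ r)
    (λ eq → eq ∘ suc)
    (λ { {(_ , p)} {(_ , q)} eq zero → trans p (sym q) ; eq (suc a) → eq a })
    (λ (f , r) → ((t ◂ f , extend ∘ r) , refl) , λ _ → refl)

-- The count `terminals owner * N ^ (e - 1)`, multiplied by `N` so that `e = 0` is included: then
-- all of `Fin N` is terminal.
TerminatingFunctions-cardinality : ∀ {N} e (owner : Fin N → Maybe (Fin e)) →
  ∃[ c ] HasCardinality (TerminatingFunctions owner) c × c * N ≡ terminals owner * N ^ e
TerminatingFunctions-cardinality {N} zero owner =
  1 , singleton-cardinality _ ((λ ()) , λ d → terminal (all-terminal (owner d))) (λ _ ()) ,
  trans (ℕ.*-comm 1 N) (cong (_* 1) (sym (trans (sum-cong-≗ (one ∘ owner)) (ones N))))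
  where
  all-terminal : (x : Maybe (Fin 0)) → x ≡ nothing
  all-terminal nothing = refl
  one : (x : Maybe (Fin 0)) → nothing? x ≡ 1
  one nothing = refl
TerminatingFunctions-cardinality {N} (suc e) owner =
  sum (proj₁ ∘ counted) ,
  fibre-sum (TerminatingFunctions owner) (λ (f , _) → f zero) (λ eq → eq zero)
    (proj₁ ∘ counted) (proj₁ ∘ proj₂ ∘ counted) ,
  (begin
    sum (proj₁ ∘ counted) * N
      ≡⟨ *-distribʳ-sum N (proj₁ ∘ counted) ⟩
    sum (λ t → proj₁ (counted t) * N)
      ≡⟨ sum-cong-≗ (proj₂ ∘ proj₂ ∘ counted) ⟩
    sum (λ t → weight (owner t) * N ^ e)
      ≡⟨ *-distribʳ-sum (N ^ e) (weight ∘ owner) ⟨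
    sum (weight ∘ owner) * N ^ e
      ≡⟨ cong (_* N ^ e) total ⟩
    c * N * N ^ e
      ≡⟨ ℕ.*-assoc c N (N ^ e) ⟩
    c * (N * N ^ e) ∎)
  where
  open ≡-Reasoning
  c z s : ℕ
  c = terminals owner
  z = sum (zero? ∘ owner)
  s = sum (suc? ∘ owner)

  -- The number of terminals after the choice `f zero ≡ t`, as a function of `owner t`: unchanged if
  -- `t` lies over another element, increased by the `z` elements over zero if `t` is terminal, and
  -- 0 if `t` lies over zero, where no function exists.
  weight : Maybe (Fin (suc e)) → ℕ
  weight x = c * suc? x + (c + z) * nothing? x

  split-N : s + c + z ≡ N
  split-N = begin
    s + c + z ≡⟨ cong (_+ z) (∑-distrib-+ (suc? ∘ owner) (nothing? ∘ owner)) ⟨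
    sum (λ d → suc? (owner d) + nothing? (owner d)) + z
      ≡⟨ ∑-distrib-+ (λ d → suc? (owner d) + nothing? (owner d)) (zero? ∘ owner) ⟨
    sum (λ d → suc? (owner d) + nothing? (owner d) + zero? (owner d)) ≡⟨ sum-cong-≗ (trichotomy ∘ owner) ⟩
    sum {N} (λ _ → 1) ≡⟨ ones N ⟩
    N ∎

  -- There are `s` choices of `t` over other elements and `c` terminal ones, so `c` factors out and
  -- leaves `s + c + z`, which is `N`.
  total : sum (weight ∘ owner) ≡ c * N
  total = begin
    sum (weight ∘ owner)
      ≡⟨ ∑-distrib-+ (λ d → c * suc? (owner d)) (λ d → (c + z) * nothing? (owner d)) ⟩
    sum (λ d → c * suc? (owner d)) + sum (λ d → (c + z) * nothing? (owner d))
      ≡⟨ cong₂ _+_ (*-distribˡ-sum c (suc? ∘ owner)) (*-distribˡ-sum (c + z) (nothing? ∘ owner)) ⟨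
    c * s + (c + z) * c ≡⟨ factor c s z ⟩
    c * (s + c + z)     ≡⟨ cong (c *_) split-N ⟩
    c * N               ∎
    where
    factor : ∀ c s z → c * s + (c + z) * c ≡ c * (s + c + z)
    factor = solve-∀

  terminals-just : ∀ a → terminals (λ d → contract (just a) (owner d)) ≡ c
  terminals-just a = sum-cong-≗ (lemma ∘ owner)
    where
    lemma : ∀ x → nothing? (contract (just a) x) ≡ nothing? x
    lemma nothing        = refl
    lemma (just zero)    = refl
    lemma (just (suc _)) = refl

  terminals-nothing : terminals (λ d → contract nothing (owner d)) ≡ c + z
  terminals-nothing = trans (sum-cong-≗ (lemma ∘ owner)) (∑-distrib-+ (nothing? ∘ owner) (zero? ∘ owner))
    where
    lemma : (x : Maybe (Fin (suc e))) → nothing? (contract nothing x) ≡ nothing? x + zero? x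
    lemma nothing        = refl
    lemma (just zero)    = refl
    lemma (just (suc _)) = refl

  no-loop : ∀ {f t d} → owner t ≡ just zero → f zero ≡ t → d ≡ t → ¬ Terminates owner f d
  no-loop p q refl (terminal r) = contradiction (trans (sym p) r) λ ()
  no-loop p q refl (iterate r h) with refl ← trans (sym p) r = no-loop p q q h

  counted : ∀ t → ∃[ n ] HasCardinality (fibre (TerminatingFunctions owner) (λ (f , _) → f zero) t) n
                       × n * N ≡ weight (owner t) * N ^ e
  counted t with owner t in eq
  ... | nothing =
    let n , card , p = TerminatingFunctions-cardinality e (λ d → contract nothing (owner d)) in
    n , contraction owner t (λ p → contradiction (trans (sym eq) p) λ ()) (cong (contract nothing) eq) ⨾ card ,
    trans p (cong (_* N ^ e) (trans terminals-nothing (one c (c + z))))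
    where
    one : ∀ x y → y ≡ x * 0 + y * 1
    one = solve-∀
  ... | just zero = 0 , empty-cardinality _ (λ ((f , r) , p) → no-loop eq p refl (r t)) ,
    cong (_* N ^ e) (none c (c + z))
    where
    none : ∀ x y → 0 ≡ x * 0 + y * 0
    none = solve-∀
  ... | just (suc a) =
    let n , card , p = TerminatingFunctions-cardinality e (λ d → contract (just a) (owner d)) in
    n , contraction owner t (λ p → contradiction (trans (sym eq) p) λ ()) (cong (contract (just a)) eq) ⨾ card ,
    trans p (cong (_* N ^ e) (trans (terminals-just a) (one c (c + z))))
    where
    one : ∀ x y → x ≡ x * 1 + y * 0
    one = solve-∀

CycleFreeFunctions-cardinality : ∀ e q {Root : Set} (c₀ : Root) → (∀ c → c ≡ c₀) → 1 ≤ e →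
  HasCardinality (CycleFreeFunctions (Fin e) (Fin e × Fin q) Root proj₁) (suc (e * q) ^ (e ∸ 1))
CycleFreeFunctions-cardinality e q {Root} c₀ unique 1≤e =
  subst (HasCardinality _) (cancel e 1≤e (proj₂ (proj₂ counted))) (reindexing ⨾ proj₁ (proj₂ counted))
  where
  B = Fin e × Fin q
  F = CycleFreeFunctions (Fin e) B Root proj₁
  N = suc (e * q)

  encode : B ⊎ Root → Fin N
  encode (inj₁ (a , j)) = suc (combine a j)
  encode (inj₂ _)       = zero

  decode : Fin N → B ⊎ Root
  decode zero    = inj₂ c₀
  decode (suc x) = inj₁ (remQuot q x)

  decode∘encode : ∀ x → decode (encode x) ≡ x
  decode∘encode (inj₁ (a , j)) = cong inj₁ (Fin.remQuot-combine a j)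
  decode∘encode (inj₂ c)       = cong inj₂ (sym (unique c))

  encode∘decode : ∀ x → encode (decode x) ≡ x
  encode∘decode zero    = refl
  encode∘decode (suc x) = cong suc (Fin.combine-remQuot {e} q x)

  owner : Fin N → Maybe (Fin e)
  owner zero    = nothing
  owner (suc x) = just (proj₁ (remQuot q x))

  owner-encode : ∀ a j → owner (encode (inj₁ (a , j))) ≡ just a
  owner-encode a j = cong (just ∘ proj₁) (Fin.remQuot-combine a j)

  counted = TerminatingFunctions-cardinality e owner

  forwards : ∀ {f x} → Reaches {B = B} {C = Root} proj₁ f x → Terminates owner (encode ∘ f) (encode x)
  forwards stop               = terminal refl
  forwards (step {a , j} r) = iterate (owner-encode a j) (forwards r)

  backwards : ∀ {f d} → Terminates owner f d → Reaches {B = B} {C = Root} proj₁ (decode ∘ f) (decode d)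
  backwards {d = zero}  _             = stop
  backwards {d = suc x} (iterate refl t) = step (backwards t)

  forwards-all : ∀ {f} → CycleFree {B = B} {C = Root} proj₁ f → ∀ d → Terminates owner (encode ∘ f) d
  forwards-all cf zero    = terminal refl
  forwards-all cf (suc x) = subst (Terminates owner _) (encode∘decode (suc x)) (forwards (cf (remQuot q x)))

  reindexing : Bijection F (TerminatingFunctions owner)
  reindexing = mkBijection F (TerminatingFunctions owner)
    (λ (f , cf) → encode ∘ f , forwards-all cf)
    (λ eq a → cong encode (eq a))
    (λ eq a → trans (sym (decode∘encode _)) (trans (cong decode (eq a)) (decode∘encode _)))
    (λ (f , t) → (decode ∘ f , λ b → subst (Reaches proj₁ _) (decode∘encode (inj₁ b)) (backwards (t (encode (inj₁ b))))) ,
                 λ a → encode∘decode (f a))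

  one-terminal : terminals owner ≡ 1
  one-terminal = cong suc (trans (sum-const (e * q) 0) (ℕ.*-zeroʳ (e * q)))

  -- With a single terminal, the count times `N` is `N ^ e`; `1 ≤ e` provides the factor `N` to
  -- cancel.
  cancel : ∀ e {c} → 1 ≤ e → c * N ≡ terminals owner * N ^ e → c ≡ N ^ (e ∸ 1)
  cancel (suc e) {c} _ eq = ℕ.*-cancelʳ-≡ c (N ^ e) N
    (trans eq (trans (cong (_* (N * N ^ e)) one-terminal) (trans (ℕ.*-identityˡ _) (ℕ.*-comm N (N ^ e)))))

-- Finite subsets and lists without repetition

Elements : Subset n → Setoid 0ℓ 0ℓ
Elements {n} S = Subsetoid (setoid (Fin n)) (_∈ S)

Members : {A : Set} → List A → Setoid 0ℓ 0ℓ
Members {A} xs = Subsetoid (setoid A) (L._∈ xs)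

Disjoint : Subset n → Subset n → Set
Disjoint p q = ∀ {x} → x ∈ p → x ∉ q

x∈p─q⇒x∉q : ∀ {x : Fin n} p q → x ∈ p ─ q → x ∉ q
x∈p─q⇒x∉q (s ∷ p) (inside  ∷ q) ()         here
x∈p─q⇒x∉q (s ∷ p) (t ∷ q)       (there x∈) (there x∈q) = x∈p─q⇒x∉q p q x∈ x∈q

∣p∣≡∣p∩q∣+∣p─q∣ : (p q : Subset n) → ∣ p ∣ ≡ ∣ p ∩ q ∣ + ∣ p ─ q ∣
∣p∣≡∣p∩q∣+∣p─q∣ []            []            = refl
∣p∣≡∣p∩q∣+∣p─q∣ (outside ∷ p) (outside ∷ q) = ∣p∣≡∣p∩q∣+∣p─q∣ p q
∣p∣≡∣p∩q∣+∣p─q∣ (outside ∷ p) (inside  ∷ q) = ∣p∣≡∣p∩q∣+∣p─q∣ p q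
∣p∣≡∣p∩q∣+∣p─q∣ (inside  ∷ p) (outside ∷ q) =
  trans (cong suc (∣p∣≡∣p∩q∣+∣p─q∣ p q)) (sym (ℕ.+-suc _ _))
∣p∣≡∣p∩q∣+∣p─q∣ (inside  ∷ p) (inside  ∷ q) = cong suc (∣p∣≡∣p∩q∣+∣p─q∣ p q)

∣p∣≡∣q∣+∣p─q∣ : {p q : Subset n} → q ⊆ p → ∣ p ∣ ≡ ∣ q ∣ + ∣ p ─ q ∣
∣p∣≡∣q∣+∣p─q∣ {p = p} {q} q⊆p = trans (∣p∣≡∣p∩q∣+∣p─q∣ p q)
  (cong (λ r → ∣ r ∣ + ∣ p ─ q ∣) (⊆-antisym (p∩q⊆q p q) λ x∈q → x∈p∩q⁺ (q⊆p x∈q , x∈q)))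

∣p∪q∣≡∣p∣+∣q∣ : {p q : Subset n} → Disjoint p q → ∣ p ∪ q ∣ ≡ ∣ p ∣ + ∣ q ∣
∣p∪q∣≡∣p∣+∣q∣ {p = p} {q} disjoint = trans (∣p∣≡∣q∣+∣p─q∣ {q = p} (p⊆p∪q q))
  (cong (λ r → ∣ p ∣ + ∣ r ∣) (⊆-antisym
    (λ x∈ → [ (λ x∈p → contradiction x∈p (x∈p─q⇒x∉q (p ∪ q) p x∈)) , (λ x∈q → x∈q) ]′
               (x∈p∪q⁻ p q (p─q⊆p (p ∪ q) p x∈)))
    λ x∈q → x∈p∧x∉q⇒x∈p─q (q⊆p∪q p q x∈q) λ x∈p → disjoint x∈p x∈q))

∣p∣≡suc∣p-x∣ : {p : Subset n} {x : Fin n} → x ∈ p → ∣ p ∣ ≡ suc ∣ p - x ∣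
∣p∣≡suc∣p-x∣ {p = p} {x} x∈p = trans
  (∣p∣≡∣q∣+∣p─q∣ λ y∈ → subst (_∈ p) (sym (x∈⁅y⁆⇒x≡y x y∈)) x∈p)
  (cong (_+ ∣ p - x ∣) (∣⁅x⁆∣≡1 x))

p⊆q∧∣q∣≤∣p∣⇒p≡q : {p q : Subset n} → p ⊆ q → ∣ q ∣ ≤ ∣ p ∣ → p ≡ q
p⊆q∧∣q∣≤∣p∣⇒p≡q {p = p} {q} p⊆q le = ⊆-antisym p⊆q λ {x} x∈q → q⊆p x x∈q
  where
  q⊆p : ∀ x → x ∈ q → x ∈ p
  q⊆p x x∈q with x ∈? p
  ... | yes x∈p = x∈p
  ... | no x∉p  = contradiction (p⊂q⇒∣p∣<∣q∣ (p⊆q , x , x∈q , x∉p)) (ℕ.≤⇒≯ le)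

Empty⇒∣p∣≡0 : {p : Subset n} → Empty p → ∣ p ∣ ≡ 0
Empty⇒∣p∣≡0 {n} empty = trans (cong ∣_∣ (Empty-unique empty)) (∣⊥∣≡0 n)

0<∣p∣⇒∃ : {p : Subset n} → 0 < ∣ p ∣ → ∃[ x ] x ∈ p
0<∣p∣⇒∃ {p = p} 0< with nonempty? p
... | yes x∈p  = x∈p
... | no empty = contradiction (Empty⇒∣p∣≡0 empty) (ℕ.m<n⇒n≢0 0<)

∈-initial⁻ : ∀ {m} {x : Fin n} → x ∈ initial m → toℕ x < m
∈-initial⁻ {m = m} {x} x∈ with toℕ x ℕ.<? m
... | yes x<m = x<m
... | no x≮m  = contradiction
  (trans (sym (Vec.[]=⇒lookup x∈)) (trans (Vec.lookup∘tabulate _ x) (dec-false (toℕ x ℕ.<? m) x≮m))) λ ()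

∣initial∣ : ∀ {m n} → m ≤ n → ∣ initial {n} m ∣ ≡ m
∣initial∣ {n = zero}  z≤n = refl
∣initial∣ {zero} {suc n}  z≤n = ∣initial∣ {zero} {n} z≤n
∣initial∣ {suc m} {suc n} (s≤s m≤n) = cong suc (∣initial∣ m≤n)

Elements-cardinality : (S : Subset n) → HasCardinality (Elements S) ∣ S ∣
Elements-cardinality [] = empty-cardinality _ λ ()
Elements-cardinality (outside ∷ S) =
  mkBijection (Elements (outside ∷ S)) (Elements S)
    (λ { (suc x , there x∈S) → x , x∈S })
    (λ { {_ , there _} {_ , there _} eq → Fin.suc-injective eq })
    (λ { {_ , there _} {_ , there _} eq → cong suc eq })
    (λ (x , x∈S) → (suc x , there x∈S) , refl)
  ⨾ Elements-cardinality S
Elements-cardinality (inside ∷ S) =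
  split-cardinality (Elements (inside ∷ S)) (λ (x , _) → x Fin.≟ zero) (λ { refl p → p })
    (singleton-cardinality _ ((zero , here) , refl) λ (_ , eq) → eq)
    (mkBijection rest (Elements S)
      (λ { ((zero , here) , ≢0) → contradiction refl ≢0 ; ((suc x , there x∈S) , _) → x , x∈S })
      (λ { {(zero , here) , ≢0} _ → contradiction refl ≢0
         ; {_} {(zero , here) , ≢0} _ → contradiction refl ≢0
         ; {(suc _ , there _) , _} {(suc _ , there _) , _} eq → Fin.suc-injective eq })
      (λ { {(zero , here) , ≢0} _ → contradiction refl ≢0
         ; {_} {(zero , here) , ≢0} _ → contradiction refl ≢0
         ; {(suc _ , there _) , _} {(suc _ , there _) , _} eq → cong suc eq })
      (λ (x , x∈S) → ((suc x , there x∈S) , λ ()) , refl)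
    ⨾ Elements-cardinality S)
  where
  rest = Subsetoid (Elements (inside ∷ S)) λ (x , _) → ¬ (x ≡ zero)

lookup-injective : {A : Set} {xs : List A} → Unique xs → ∀ i j → lookup xs i ≡ lookup xs j → i ≡ j
lookup-injective (_ ∷ _)  zero    zero    _  = refl
lookup-injective (p ∷ _)  zero    (suc j) eq = contradiction eq (All.lookup p (∈-lookup j))
lookup-injective (p ∷ _)  (suc i) zero    eq = contradiction (sym eq) (All.lookup p (∈-lookup i))
lookup-injective (_ ∷ ps) (suc i) (suc j) eq = cong suc (lookup-injective ps i j eq)

Members-cardinality : {A : Set} {xs : List A} → Unique xs → HasCardinality (Members xs) (length xs)
Members-cardinality {xs = xs} unique = mkBijection (Members xs) _
  (λ (_ , x∈) → Any.index x∈)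
  (λ { {_ , x∈} {_ , y∈} eq → lookup-injective unique _ _
         (trans (sym (lookup-index x∈)) (trans eq (lookup-index y∈))) })
  (λ { {_ , x∈} {_ , y∈} eq → trans (lookup-index x∈) (trans (cong (lookup xs) eq) (sym (lookup-index y∈))) })
  (λ i → (lookup xs i , ∈-lookup i) , lookup-injective unique _ _ (sym (lookup-index (∈-lookup {xs = xs} i))))

-- Images of subsets and of lists of subsets

image-∘ : ∀ {l} (φ : Fin k → Fin m) (χ : Fin m → Fin l) (S : Subset k) →
          image χ (image φ S) ≡ image (χ ∘ φ) S
image-∘ φ χ S = ⊆-antisym
  (λ z∈ → let _ , y∈ , χy≡z = ∈-image⁻ χ z∈
              _ , x∈ , φx≡y = ∈-image⁻ φ y∈ in
          subst (_∈ image (χ ∘ φ) S) (trans (cong χ φx≡y) χy≡z) (∈-image⁺ (χ ∘ φ) x∈))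
  (λ z∈ → let _ , x∈ , eq = ∈-image⁻ (χ ∘ φ) z∈ in
          subst (_∈ image χ (image φ S)) eq (∈-image⁺ χ (∈-image⁺ φ x∈)))

image-cong : {φ χ : Fin k → Fin n} → φ ≗ χ → (S : Subset k) → image φ S ≡ image χ S
image-cong {φ = φ} {χ} eq S = ⊆-antisym (half eq) (half (sym ∘ eq))
  where
  half : {φ χ : Fin _ → Fin _} → φ ≗ χ → image φ S ⊆ image χ S
  half {φ} {χ} eq z∈ = let x , x∈ , φx≡z = ∈-image⁻ φ z∈ in
    subst (_∈ image χ S) (trans (sym (eq x)) φx≡z) (∈-image⁺ χ x∈)

image-mono : (φ : Fin k → Fin n) {S S′ : Subset k} → S ⊆ S′ → image φ S ⊆ image φ S′
image-mono φ S⊆S′ z∈ = let x , x∈ , eq = ∈-image⁻ φ z∈ in subst (_∈ _) eq (∈-image⁺ φ (S⊆S′ x∈))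

module _ {φ : Fin k → Fin n} (φ-injective : Injective _≡_ _≡_ φ) where

  ∈-image-injective : ∀ {S x} → φ x ∈ image φ S → x ∈ S
  ∈-image-injective {S} φx∈ = let y , y∈ , eq = ∈-image⁻ φ φx∈ in subst (_∈ S) (φ-injective eq) y∈

  image-injective : ∀ {S S′} → image φ S ≡ image φ S′ → S ≡ S′
  image-injective eq = ⊆-antisym
    (λ x∈ → ∈-image-injective (subst (_ ∈_) eq (∈-image⁺ φ x∈)))
    (λ x∈ → ∈-image-injective (subst (_ ∈_) (sym eq) (∈-image⁺ φ x∈)))

  ∣image∣ : ∀ S → ∣ image φ S ∣ ≡ ∣ S ∣
  ∣image∣ S = sym (cardinality-unique (Elements S) (Elements-cardinality S)
    (mkBijection (Elements S) (Elements (image φ S))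
      (λ (x , x∈) → φ x , ∈-image⁺ φ x∈) (cong φ) φ-injective
      (λ (y , y∈) → let x , x∈ , eq = ∈-image⁻ φ y∈ in (x , x∈) , eq)
    ⨾ Elements-cardinality (image φ S)))

  imageGraph : Graph m k → Graph m n
  imageGraph G = record
    { edges   = map (image φ) (edges G)
    ; uniform = All.map⁺ (All.map (trans (∣image∣ _)) (uniform G))
    ; unique  = Unique.map⁺ image-injective (unique G)
    }

  images-injective : {xs ys : List (Subset k)} → map (image φ) xs ∼[ set ] map (image φ) ys → xs ∼[ set ] ys
  images-injective {xs} {ys} eq = mk⇔ (half (Equivalence.to eq)) (half (Equivalence.from eq))
    where
    half : ∀ {xs ys} → (∀ {S} → S L.∈ map (image φ) xs → S L.∈ map (image φ) ys) →
           ∀ {S} → S L.∈ xs → S L.∈ ys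
    half sub S∈ = let _ , S′∈ , eq = ∈-map⁻ (image φ) (sub (∈-map⁺ (image φ) S∈)) in
      subst (L._∈ _) (sym (image-injective eq)) S′∈

-- The image of `⊤` has `n` elements and is therefore `⊤`.
injective⇒surjective : {φ : Fin n → Fin n} → Injective _≡_ _≡_ φ → ∀ y → ∃[ x ] φ x ≡ y
injective⇒surjective {n} {φ} inj y =
  let x , _ , eq = ∈-image⁻ φ (subst (y ∈_) (sym full) ∈⊤) in x , eq
  where
  full : image φ ⊤ ≡ ⊤
  full = ∣p∣≡n⇒p≡⊤ (trans (∣image∣ inj ⊤) (∣⊤∣≡n n))

injective⇒permutation : {φ : Fin n → Fin n} → Injective _≡_ _≡_ φ → Permutation′ n
injective⇒permutation {φ = φ} inj = permutation φ (proj₁ ∘ onto)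
  (λ y → proj₂ (onto y)) (λ x → inj (proj₂ (onto (φ x))))
  where onto = injective⇒surjective inj

∼-length : {A : Set} {xs ys : List A} → Unique xs → Unique ys → xs ∼[ set ] ys → length xs ≡ length ys
∼-length {xs = xs} {ys} u v eq = cardinality-unique (Members xs) (Members-cardinality u)
  (mkBijection (Members xs) (Members ys)
    (λ (x , x∈) → x , Equivalence.to eq x∈) (λ p → p) (λ p → p)
    (λ (y , y∈) → (y , Equivalence.from eq y∈) , refl)
  ⨾ Members-cardinality v)

-- Injections mapping L into T inside and the complement of L into T outside

Injections : ∀ k n → Setoid 0ℓ 0ℓ
Injections k n = Subsetoid (Fin k →-setoid Fin n) (Injective _≡_ _≡_)

InjectionsInto : Subset k → (Side → Subset n) → Setoid 0ℓ 0ℓ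
InjectionsInto {k} {n} L T = Subsetoid (Injections k n) λ (φ , _) → ∀ i → φ i ∈ T (Vec.lookup L i)

private
  count : Side → Subset k → ℕ
  count inside  L = ∣ L ∣
  count outside L = ∣ ∁ L ∣

  without : (Side → Subset n) → Fin n → Side → Subset n
  without T v s = T s - v

  x∉p⇒p-x≡p : {p : Subset n} {x : Fin n} → x ∉ p → p - x ≡ p
  x∉p⇒p-x≡p {p = p} {x} x∉p = ⊆-antisym (p─q⊆p p ⁅ x ⁆)
    λ y∈p → x∈p∧x≢y⇒x∈p-y y∈p λ { refl → x∉p y∈p }

  -- Once position zero takes the value `v`, the rest avoids `v`. Removing `v` from both targets is
  -- uniform in the side; for disjoint targets it changes only that of side `s`.
  head-fibre : ∀ s (L : Subset k) (T : Side → Subset n) (v : Fin n) → v ∈ T s →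
    Bijection (Subsetoid (InjectionsInto (s ∷ L) T) λ ((φ , _) , _) → φ zero ≡ v) (InjectionsInto L (without T v))
  head-fibre {k} {n} s L T v v∈ = mkBijection (Subsetoid (InjectionsInto (s ∷ L) T) _) (InjectionsInto L (without T v))
    (λ (((φ , inj) , into) , eq) → (φ ∘ suc , λ p → Fin.suc-injective (inj p)) ,
      λ i → x∈p∧x≢y⇒x∈p-y (into (suc i)) λ φi≡v → contradiction (inj (trans φi≡v (sym eq))) λ ())
    (λ eq → eq ∘ suc)
    (λ { {_ , p} {_ , q} eq zero → trans p (sym q) ; eq (suc i) → eq i })
    (λ ((φ , inj) , into) →
      let v≢ : ∀ i → v ≢ φ i
          v≢ i eq = x∈p─q⇒x∉q (T (Vec.lookup L i)) ⁅ v ⁆ (into i) (subst (_∈ ⁅ v ⁆) eq (x∈⁅x⁆ v)) in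
      ((((λ { zero → v ; (suc i) → φ i }) ,
        λ { {zero}  {zero}  _  → refl
          ; {zero}  {suc j} eq → contradiction eq (v≢ j)
          ; {suc i} {zero}  eq → contradiction (sym eq) (v≢ i)
          ; {suc i} {suc j} eq → cong suc (inj eq) }) ,
       λ { zero → v∈ ; (suc i) → p─q⊆p _ _ (into i) }) , refl) , λ _ → refl)

InjectionsInto-cardinality : (L : Subset k) (T : Side → Subset n) → (∀ {x} → x ∈ T inside → x ∉ T outside) →
  ∣ T inside ∣ ≡ ∣ L ∣ → ∣ T outside ∣ ≡ ∣ ∁ L ∣ → HasCardinality (InjectionsInto L T) (∣ L ∣ ! * ∣ ∁ L ∣ !)
InjectionsInto-cardinality [] T disjoint p q =
  singleton-cardinality _ (((λ ()) , λ { {()} }) , λ ()) λ _ ()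
InjectionsInto-cardinality (inside ∷ L) T disjoint p q =
  subst (HasCardinality _) (sym (ℕ.*-assoc (suc ∣ L ∣) (∣ L ∣ !) _))
    (fibre-product (InjectionsInto (inside ∷ L) T) (Elements (T inside)) (λ ((φ , _) , into) → φ zero , into zero)
      (λ eq → eq zero) (subst (HasCardinality (Elements (T inside))) p (Elements-cardinality (T inside)))
      λ (v , v∈) → head-fibre inside L T v v∈ ⨾
        InjectionsInto-cardinality L (without T v) (λ x∈ x∈′ → disjoint (p─q⊆p _ _ x∈) (p─q⊆p _ _ x∈′))
          (ℕ.suc-injective (trans (sym (∣p∣≡suc∣p-x∣ v∈)) p))
          (trans (cong ∣_∣ (x∉p⇒p-x≡p (disjoint v∈))) q))
InjectionsInto-cardinality (outside ∷ L) T disjoint p q =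
  subst (HasCardinality _) (swap (suc ∣ ∁ L ∣) (∣ L ∣ !) _)
    (fibre-product (InjectionsInto (outside ∷ L) T) (Elements (T outside)) (λ ((φ , _) , into) → φ zero , into zero)
      (λ eq → eq zero) (subst (HasCardinality (Elements (T outside))) q (Elements-cardinality (T outside)))
      λ (v , v∈) → head-fibre outside L T v v∈ ⨾
        InjectionsInto-cardinality L (without T v) (λ x∈ x∈′ → disjoint (p─q⊆p _ _ x∈) (p─q⊆p _ _ x∈′))
          (trans (cong ∣_∣ (x∉p⇒p-x≡p λ v∈′ → disjoint v∈′ v∈)) p)
          (ℕ.suc-injective (trans (sym (∣p∣≡suc∣p-x∣ v∈)) q)))
  where
  swap : ∀ a b c → a * (b * c) ≡ b * (a * c)
  swap a b c = trans (sym (ℕ.*-assoc a b c)) (trans (cong (_* c) (ℕ.*-comm a b)) (ℕ.*-assoc b a c))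

Injections-cardinality : ∀ k → ∃[ N ] HasCardinality (Injections k k) N
Injections-cardinality k = _ ,
  (mkBijection (Injections k k) (InjectionsInto ⊤ T) (λ (φ , inj) → (φ , inj) , λ i → subst (λ s → φ i ∈ T s) (sym (lookup-⊤ i)) ∈⊤)
    (λ eq → eq) (λ eq → eq) (λ ((φ , inj) , _) → (φ , inj) , λ _ → refl)
  ⨾ InjectionsInto-cardinality ⊤ T (λ _ → ∉⊥) refl ∣⊥∣≡∣∁⊤∣)
  where
  T : Side → Subset k
  T inside  = ⊤
  T outside = ⊥
  lookup-⊤ : ∀ {n} (i : Fin n) → Vec.lookup ⊤ i ≡ inside
  lookup-⊤ {n} i = Vec.[]=⇒lookup (∈⊤ {n} {i})
  ∣⊥∣≡∣∁⊤∣ : ∣ T outside ∣ ≡ ∣ ∁ (⊤ {k}) ∣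
  ∣⊥∣≡∣∁⊤∣ = trans (∣⊥∣≡0 k) (sym (trans (∣∁p∣≡n∸∣p∣ (⊤ {k})) (trans (cong (k ∸_) (∣⊤∣≡n k)) (ℕ.n∸n≡0 k))))

-- As the sizes agree, an injection sends `L` onto `M` exactly when it sends `L` into `M` and the
-- complement of `L` into that of `M`.
injections-sending : (L M : Subset k) → ∣ M ∣ ≡ ∣ L ∣ →
  HasCardinality (Subsetoid (Injections k k) λ (φ , _) → image φ L ≡ M) (∣ L ∣ ! * (k ∸ ∣ L ∣) !)
injections-sending {k} L M eq = subst (λ c → HasCardinality sending (∣ L ∣ ! * c !)) (∣∁p∣≡n∸∣p∣ L)
  (mkBijection sending (InjectionsInto L T)
    (λ ((φ , inj) , p) → (φ , inj) , λ i → into inj p (Vec.lookup L i) refl)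
    (λ eq → eq) (λ eq → eq)
    (λ ((φ , inj) , into) → ((φ , inj) , onto inj into) , λ _ → refl)
  ⨾ InjectionsInto-cardinality L T x∈p⇒x∉∁p eq
      (trans (∣∁p∣≡n∸∣p∣ M) (trans (cong (k ∸_) eq) (sym (∣∁p∣≡n∸∣p∣ L)))))
  where
  sending = Subsetoid (Injections k k) λ (φ , _) → image φ L ≡ M
  T : Side → Subset k
  T inside  = M
  T outside = ∁ M

  into : ∀ {φ} → Injective _≡_ _≡_ φ → image φ L ≡ M → ∀ {i} s → Vec.lookup L i ≡ s → φ i ∈ T s
  into {φ} inj p {i} inside  q = subst (φ i ∈_) p (∈-image⁺ φ (Vec.lookup⇒[]= i L q))
  into {φ} inj p {i} outside q = x∉p⇒x∈∁p λ φi∈ → contradiction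
    (trans (sym q) (Vec.[]=⇒lookup (∈-image-injective inj (subst (φ i ∈_) (sym p) φi∈)))) λ ()

  onto : ∀ {φ} → Injective _≡_ _≡_ φ → (∀ i → φ i ∈ T (Vec.lookup L i)) → image φ L ≡ M
  onto {φ} inj into = p⊆q∧∣q∣≤∣p∣⇒p≡q
    (λ z∈ → let x , x∈ , φx≡z = ∈-image⁻ φ z∈ in
      subst (_∈ M) φx≡z (subst (λ s → φ x ∈ T s) (Vec.[]=⇒lookup x∈) (into x)))
    (ℕ.≤-reflexive (trans eq (sym (∣image∣ inj L))))

-- Copies and automorphisms of H

module SetEq {A : Set} = Setoid ([ set ]-Equality A)

_≟ˢ_ : Decidable (_≡_ {A = Subset n})
_≟ˢ_ = Vec.≡-dec Bool._≟_

_∼?_ : Decidable {A = List (Subset n)} _∼[ set ]_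
xs ∼? ys = map′
  (λ (p , q) → mk⇔ (All.lookup p) (All.lookup q))
  (λ eq → All.tabulate (Equivalence.to eq) , All.tabulate (Equivalence.from eq))
  (All.all? (λ S → member? _≟ˢ_ S ys) xs ×-dec All.all? (λ S → member? _≟ˢ_ S xs) ys)

≡⇒∼ : {A : Set} {xs ys : List A} → xs ≡ ys → xs ∼[ set ] ys
≡⇒∼ refl = SetEq.refl

map-image-∘ : ∀ {l} (φ : Fin k → Fin m) (χ : Fin m → Fin l) (xs : List (Subset k)) →
              map (image χ) (map (image φ) xs) ≡ map (image (χ ∘ φ)) xs
map-image-∘ φ χ xs = trans (sym (List.map-∘ xs)) (List.map-cong (image-∘ φ χ) xs)

map-image-cong : {φ χ : Fin k → Fin n} → φ ≗ χ → (xs : List (Subset k)) → map (image φ) xs ≡ map (image χ) xs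
map-image-cong eq = List.map-cong (image-cong eq)

image-⊤ : {φ : Fin n → Fin n} → Injective _≡_ _≡_ φ → image φ ⊤ ≡ ⊤
image-⊤ inj = ∣p∣≡n⇒p≡⊤ (trans (∣image∣ inj ⊤) (∣⊤∣≡n _))

permutation-injective : (σ : Permutation′ n) → Injective _≡_ _≡_ (σ ⟨$⟩ʳ_)
permutation-injective σ eq = trans (sym (inverseˡ σ)) (trans (cong (σ ⟨$⟩ˡ_) eq) (inverseˡ σ))

module _ (H : Graph m k) where

  Aut-cardinality : ∃[ a ] HasCardinality (Aut H) a
  Aut-cardinality = proj₁ automorphisms ,
    (mkBijection (Aut H) (Subsetoid (Injections k k) preserves)
      (λ (σ , p) → ((σ ⟨$⟩ʳ_) , permutation-injective σ) , p) (λ eq → eq) (λ eq → eq)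
      (λ ((φ , inj) , p) → (injective⇒permutation inj , p) , λ _ → refl)
    ⨾ proj₂ automorphisms)
    where
    preserves : Setoid.Carrier (Injections k k) → Set
    preserves (φ , _) = map (image φ) (edges H) ∼[ set ] edges H
    automorphisms = subset-cardinality (Injections k k) (λ (φ , _) → map (image φ) (edges H) ∼? edges H)
      (λ eq p → subst (_∼[ set ] edges H) (map-image-cong eq (edges H)) p)
      (proj₂ (Injections-cardinality k))

  -- The labellings φ of [k] under which [m] becomes an edge of H. Counted by the edge mapped to [m]
  -- there are l m! (k - m)! of them, and counted by the resulting copy of H there are |R_H| |Aut H|.
  private
    Labellings : Setoid 0ℓ 0ℓ
    Labellings = Subsetoid (Injections k k) λ (φ , _) → initial m L.∈ map (image φ) (edges H)

    Copies = CopiesContainingInitial H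

    rooted-edge : {φ : Fin k → Fin k} → initial m L.∈ map (image φ) (edges H) → ∃[ L ] L L.∈ edges H × initial m ≡ image φ L
    rooted-edge {φ} = ∈-map⁻ (image φ)

    rooted-edge-unique : {φ χ : Fin k → Fin k} → Injective _≡_ _≡_ φ → φ ≗ χ → ∀ {L M : Subset k} →
                         initial m ≡ image φ L → initial m ≡ image χ M → L ≡ M
    rooted-edge-unique inj eq {M = M} p q = image-injective inj (trans (sym p) (trans q (sym (image-cong eq M))))

    copy : Setoid.Carrier Labellings → Setoid.Carrier Copies
    copy ((φ , inj) , m∈) = imageGraph inj H , (φ , inj , image-⊤ inj , SetEq.refl) , m∈

    copy-cong : ∀ {x y} → Setoid._≈_ Labellings x y → Setoid._≈_ Copies (copy x) (copy y)
    copy-cong {x} {y} eq = ≡⇒∼ (map-image-cong eq (edges H))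

  Labellings-cardinality : m ≤ k → HasCardinality Labellings (size H * (m ! * (k ∸ m) !))
  Labellings-cardinality m≤k = fibre-product Labellings (Members (edges H))
    (λ (_ , m∈) → proj₁ (rooted-edge m∈) , proj₁ (proj₂ (rooted-edge m∈)))
    (λ { {(φ , inj) , p} {χ , q} eq →
      rooted-edge-unique inj eq (proj₂ (proj₂ (rooted-edge p))) (proj₂ (proj₂ (rooted-edge q))) })
    (Members-cardinality (unique H))
    λ (L , L∈) → let ∣L∣≡m = All.lookup (uniform H) L∈ in
      mkBijection _ (Subsetoid (Injections k k) λ (φ , _) → image φ L ≡ initial m)
        (λ ((φ , m∈) , eq) → φ , trans (cong (image (proj₁ φ)) (sym eq)) (sym (proj₂ (proj₂ (rooted-edge m∈)))))
        (λ eq → eq) (λ eq → eq)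
        (λ ((φ , inj) , eq) → let m∈ = subst (L._∈ _) eq (∈-map⁺ (image φ) L∈) in
          (((φ , inj) , m∈) ,
          rooted-edge-unique inj (λ _ → refl) (proj₂ (proj₂ (rooted-edge m∈))) (sym eq)) , λ _ → refl)
      ⨾ subst (λ l → HasCardinality (Subsetoid (Injections k k) λ (φ , _) → image φ L ≡ initial m) (l ! * (k ∸ l) !)) ∣L∣≡m
          (injections-sending L (initial m) (trans (∣initial∣ m≤k) (sym ∣L∣≡m)))

  -- Every member of R_H arises from a labelling, and `_∼?_` decides when two labellings give the
  -- same copy.
  copies-finite : m ≤ k → ∃[ r ] HasCardinality Copies r
  copies-finite m≤k = surjection-cardinality Labellings Copies
    (λ (G , _) (G′ , _) → edges G ∼? edges G′) (Labellings-cardinality m≤k) copy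
    (λ {x} {y} → copy-cong {x} {y})
    λ (G , (φ , inj , _ , eq) , m∈) → ((φ , inj) , Equivalence.to eq m∈) , SetEq.sym eq

  copies*automorphisms : m ≤ k → ∀ {r a} → HasCardinality Copies r → HasCardinality (Aut H) a →
                         r * a ≡ size H * (m ! * (k ∸ m) !)
  copies*automorphisms m≤k {r} {a} c d = cardinality-unique Labellings
    (fibre-product Labellings Copies copy (λ {x} {y} → copy-cong {x} {y}) c
      (λ x → Bijection-sym (from-Aut x) ⨾ d))
    (Labellings-cardinality m≤k)
    where
    -- If `φ` produces the copy `G`, the labellings producing `G` are the composites of `φ` with
    -- automorphisms of `H`: the fibre is a coset.
    from-Aut : ∀ (x : Setoid.Carrier Copies) →
      Bijection (Aut H) (Subsetoid Labellings λ y → Setoid._≈_ Copies (copy y) x)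
    from-Aut (G , (φ , inj , _ , eq) , m∈) = mkBijection (Aut H) _
      (λ (σ , p) →
        let composite = begin
              map (image (φ ∘ (σ ⟨$⟩ʳ_))) (edges H)               ≈⟨ ≡⇒∼ (map-image-∘ (σ ⟨$⟩ʳ_) φ (edges H)) ⟨
              map (image φ) (map (image (σ ⟨$⟩ʳ_)) (edges H))      ≈⟨ ∼-map-cong (λ _ → refl) p ⟩
              map (image φ) (edges H)                              ≈⟨ eq ⟨
              edges G                                              ∎ in
        (((φ ∘ (σ ⟨$⟩ʳ_)) , permutation-injective σ ∘ inj) ,
         Equivalence.from composite m∈) , composite)
      (λ eq → cong φ ∘ eq)
      (λ eq → inj ∘ eq)
      λ (((χ , χ-inj) , _) , χH∼G) →
        let back : ∀ y → ∃[ x ] φ x ≡ y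
            back = injective⇒surjective inj
            σ = λ x → proj₁ (back (χ x))
            φσ≗χ = λ x → proj₂ (back (χ x)) in
        (injective⇒permutation {φ = σ} (λ {x} {y} p → χ-inj (trans (sym (φσ≗χ x)) (trans (cong φ p) (φσ≗χ y)))) ,
         images-injective inj (begin
           map (image φ) (map (image σ) (edges H)) ≡⟨ map-image-∘ σ φ (edges H) ⟩
           map (image (φ ∘ σ)) (edges H)           ≡⟨ map-image-cong φσ≗χ (edges H) ⟩
           map (image χ) (edges H)                 ≈⟨ χH∼G ⟩
           edges G                                 ≈⟨ eq ⟩
           map (image φ) (edges H)                 ∎)) ,
        φσ≗χ
      where open import Relation.Binary.Reasoning.Setoid ([ set ]-Equality (Subset k))

-- Partitions ordered by least elements

data Least : Subset n → Fin n → Set where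
  here  : {U : Subset n} → Least (inside ∷ U) zero
  there : {U : Subset n} {i : Fin n} → Least U i → Least (outside ∷ U) (suc i)

Least-∈ : {U : Subset n} {i : Fin n} → Least U i → i ∈ U
Least-∈ here      = here
Least-∈ (there l) = there (Least-∈ l)

Least-unique : {U : Subset n} {i j : Fin n} → Least U i → Least U j → i ≡ j
Least-unique here      here      = refl
Least-unique (there l) (there k) = cong suc (Least-unique l k)

least : (U : Subset n) → Nonempty U → ∃[ i ] Least U i
least (inside  ∷ U) _                     = zero , here
least (outside ∷ U) (suc x , there x∈) = let i , l = least U (x , x∈) in suc i , there l

IsFirstPart : ℕ → Subset n → Subset n → Set
IsFirstPart d U P = P ⊆ U × ∣ P ∣ ≡ d × ∃[ i ] Least U i × i ∈ P

IsOrderedPartition : ℕ → Subset n → (Fin e → Subset n) → Set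
IsOrderedPartition {e = zero}  d U P = Empty U
IsOrderedPartition {e = suc e} d U P = IsFirstPart d U (P zero) × IsOrderedPartition d (U ─ P zero) (P ∘ suc)

FirstParts : ℕ → Subset n → Setoid 0ℓ 0ℓ
FirstParts {n} d U = Subsetoid (setoid (Subset n)) (IsFirstPart d U)

OrderedPartitions : ℕ → ℕ → Subset n → Setoid 0ℓ 0ℓ
OrderedPartitions {n} d e U = Subsetoid (Fin e →-setoid Subset n) (IsOrderedPartition d U)

SubsetsOfSize : ℕ → Subset n → Setoid 0ℓ 0ℓ
SubsetsOfSize {n} d U = Subsetoid (setoid (Subset n)) λ P → P ⊆ U × ∣ P ∣ ≡ d

private
  with-outside : {s : Side} {U : Subset n} → Setoid.Carrier (SubsetsOfSize d U) → Setoid.Carrier (SubsetsOfSize d (s ∷ U))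
  with-outside (P , P⊆ , size) = outside ∷ P , out⊆ P⊆ , size

SubsetsOfSize-cardinality : ∀ d (U : Subset n) → HasCardinality (SubsetsOfSize d U) (∣ U ∣ C d)
SubsetsOfSize-cardinality zero    [] = singleton-cardinality _ ([] , (λ ()) , refl) λ { ([] , _) → refl }
SubsetsOfSize-cardinality (suc d) [] = empty-cardinality _ λ { ([] , _ , ()) }
SubsetsOfSize-cardinality d (outside ∷ U) =
  Bijection-sym (mkBijection (SubsetsOfSize d U) (SubsetsOfSize d (outside ∷ U))
    with-outside (cong (outside ∷_)) Vec.∷-injectiveʳ
    λ { (outside ∷ P , P⊆ , size) → (P , drop-∷-⊆ P⊆ , size) , refl
      ; (inside ∷ P , P⊆ , size) → contradiction (P⊆ here) λ () })
  ⨾ SubsetsOfSize-cardinality d U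
SubsetsOfSize-cardinality zero (inside ∷ U) =
  Bijection-sym (mkBijection (SubsetsOfSize zero U) (SubsetsOfSize zero (inside ∷ U))
    with-outside (cong (outside ∷_)) Vec.∷-injectiveʳ
    λ { (outside ∷ P , P⊆ , size) → (P , drop-∷-⊆ P⊆ , size) , refl })
  ⨾ SubsetsOfSize-cardinality zero U
SubsetsOfSize-cardinality (suc d) (inside ∷ U) =
  subst (HasCardinality _) (nCk+nC[k+1]≡[n+1]C[k+1] ∣ U ∣ d)
    (split-cardinality (SubsetsOfSize (suc d) (inside ∷ U)) (λ (P , _) → zero ∈? P) (λ { refl p → p })
      (Bijection-sym (mkBijection (SubsetsOfSize d U) (Subsetoid (SubsetsOfSize (suc d) (inside ∷ U)) λ (P , _) → zero ∈ P)
        (λ (P , P⊆ , size) → (inside ∷ P , in⊆in P⊆ , cong suc size) , here) (cong (inside ∷_)) Vec.∷-injectiveʳ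
        λ { ((inside ∷ P , P⊆ , size) , _) → (P , drop-∷-⊆ P⊆ , ℕ.suc-injective size) , refl
          ; ((outside ∷ P , _) , ()) })
      ⨾ SubsetsOfSize-cardinality d U)
      (Bijection-sym (mkBijection (SubsetsOfSize (suc d) U) (Subsetoid (SubsetsOfSize (suc d) (inside ∷ U)) λ (P , _) → zero ∉ P)
        (λ P → with-outside P , λ ()) (cong (outside ∷_)) Vec.∷-injectiveʳ
        λ { ((outside ∷ P , P⊆ , size) , _) → (P , drop-∷-⊆ P⊆ , size) , refl
          ; ((inside ∷ P , _) , ∉) → contradiction here ∉ })
      ⨾ SubsetsOfSize-cardinality (suc d) U))

-- The least element of `U` is forced into the part; the other `d - 1` elements are chosen among the
-- remaining `∣ U ∣ - 1`.
FirstParts-cardinality : ∀ d (U : Subset n) → 1 ≤ d → 1 ≤ ∣ U ∣ → HasCardinality (FirstParts d U) ((∣ U ∣ ∸ 1) C (d ∸ 1))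
FirstParts-cardinality d (outside ∷ U) 1≤d 1≤U =
  Bijection-sym (mkBijection (FirstParts d U) (FirstParts d (outside ∷ U))
    (λ (P , P⊆ , size , i , l , i∈) → outside ∷ P , out⊆ P⊆ , size , suc i , there l , there i∈)
    (cong (outside ∷_)) Vec.∷-injectiveʳ
    λ { (outside ∷ P , P⊆ , size , suc i , there l , there i∈) → (P , drop-∷-⊆ P⊆ , size , i , l , i∈) , refl
      ; (inside ∷ P , P⊆ , _) → contradiction (P⊆ here) λ () })
  ⨾ FirstParts-cardinality d U 1≤d 1≤U
FirstParts-cardinality (suc d) (inside ∷ U) 1≤d 1≤U =
  Bijection-sym (mkBijection (SubsetsOfSize d U) (FirstParts (suc d) (inside ∷ U))
    (λ (P , P⊆ , size) → inside ∷ P , in⊆in P⊆ , cong suc size , zero , here , here)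
    (cong (inside ∷_)) Vec.∷-injectiveʳ
    λ { (inside ∷ P , P⊆ , size , _) → (P , drop-∷-⊆ P⊆ , ℕ.suc-injective size) , refl
      ; (outside ∷ P , _ , _ , zero , here , ()) })
  ⨾ SubsetsOfSize-cardinality d U

-- After `i` parts `d * (e - i)` elements are left, whichever parts were chosen.
OrderedPartitions-cardinality : ∀ d e (U : Subset n) → 1 ≤ d → ∣ U ∣ ≡ d * e →
  HasCardinality (OrderedPartitions d e U) (∏ {e} λ i → (d * (e ∸ toℕ i) ∸ 1) C (d ∸ 1))
OrderedPartitions-cardinality d zero U 1≤d ∣U∣ = singleton-cardinality _
  ((λ ()) , λ (x , x∈) → contradiction (trans (sym (∣p∣≡suc∣p-x∣ x∈)) (trans ∣U∣ (ℕ.*-zeroʳ d))) λ ()) λ _ ()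
OrderedPartitions-cardinality (suc d) (suc e) U 1≤d ∣U∣ =
  fibre-product (OrderedPartitions (suc d) (suc e) U) (FirstParts (suc d) U)
    (λ (P , first , _) → P zero , first) (λ eq → eq zero)
    (subst (λ N → HasCardinality (FirstParts (suc d) U) ((N ∸ 1) C d)) ∣U∣
      (FirstParts-cardinality (suc d) U 1≤d (ℕ.≤-trans (s≤s z≤n) (ℕ.≤-reflexive (sym ∣U∣)))))
    λ (Q , first@(Q⊆U , ∣Q∣ , _)) →
      Bijection-sym (mkBijection (OrderedPartitions (suc d) e (U ─ Q)) (Subsetoid (OrderedPartitions (suc d) (suc e) U) λ (P , _) → P zero ≡ Q)
        (λ (P , parts) → ((λ { zero → Q ; (suc i) → P i }) , first , parts) , refl)
        (λ { eq zero → refl ; eq (suc i) → eq i })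
        (λ eq → eq ∘ suc)
        (λ { ((P , _ , parts) , refl) → ((P ∘ suc) , parts) , λ { zero → refl ; (suc i) → refl } }))
      ⨾ OrderedPartitions-cardinality (suc d) e (U ─ Q) 1≤d
          (ℕ.+-cancelˡ-≡ (suc d) _ _
            (trans (cong (_+ ∣ U ─ Q ∣) (sym ∣Q∣)) (trans (sym (∣p∣≡∣q∣+∣p─q∣ Q⊆U)) (trans ∣U∣ (ℕ.*-suc (suc d) e)))))

part-⊆ : {U : Subset n} {P : Fin e → Subset n} → IsOrderedPartition d U P → ∀ i → P i ⊆ U
part-⊆ ((P⊆ , _) , _)    zero    = P⊆
part-⊆ {U = U} {P} (_ , parts) (suc i) = p─q⊆p U (P zero) ∘ part-⊆ parts i

part-size : {U : Subset n} {P : Fin e → Subset n} → IsOrderedPartition d U P → ∀ i → ∣ P i ∣ ≡ d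
part-size ((_ , size , _) , _) zero    = size
part-size (_ , parts)          (suc i) = part-size parts i

part-disjoint : {U : Subset n} {P : Fin e → Subset n} → IsOrderedPartition d U P →
                ∀ {i j x} → x ∈ P i → x ∈ P j → i ≡ j
part-disjoint parts {zero} {zero} x∈ x∈′ = refl
part-disjoint {U = U} {P} (_ , parts) {zero} {suc j} x∈ x∈′ =
  contradiction x∈ (x∈p─q⇒x∉q U (P zero) (part-⊆ parts j x∈′))
part-disjoint {U = U} {P} (_ , parts) {suc i} {zero} x∈ x∈′ =
  contradiction x∈′ (x∈p─q⇒x∉q U (P zero) (part-⊆ parts i x∈))
part-disjoint (_ , parts) {suc i} {suc j} x∈ x∈′ = cong suc (part-disjoint parts x∈ x∈′)

part-covers : {U : Subset n} {P : Fin e → Subset n} → IsOrderedPartition d U P →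
              ∀ {x} → x ∈ U → ∃[ i ] x ∈ P i
part-covers {e = zero}  empty x∈ = contradiction (_ , x∈) empty
part-covers {e = suc e} {P = P} (_ , parts) {x} x∈ with x ∈? P zero
... | yes x∈P = zero , x∈P
... | no x∉P  = let i , x∈P = part-covers parts (x∈p∧x∉q⇒x∈p─q x∈ x∉P) in suc i , x∈P

-- The first part is the one containing the least element of U.
ordered-partition-unique : {U : Subset n} {P Q : Fin e → Subset n} → 1 ≤ d →
  IsOrderedPartition d U P → IsOrderedPartition d U Q → (∀ i → ∃[ j ] P i ≡ Q j) → P ≗ Q
ordered-partition-unique {e = suc e} {d} {U} {P} {Q} 1≤d pp@(firstP@(_ , _ , u , l , u∈P) , parts) qq@((_ , _ , v , l′ , v∈Q) , parts′) match = go
  where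
  first : P zero ≡ Q zero
  first with match zero
  ... | j , eq with part-disjoint {U = U} {Q} qq {j} {zero} (subst (u ∈_) eq u∈P) (subst (_∈ Q zero) (Least-unique l′ l) v∈Q)
  ... | refl = eq

  match-rest : ∀ i → ∃[ j ] P (suc i) ≡ Q (suc j)
  match-rest i with match (suc i)
  ... | suc j , eq = j , eq
  -- A later part matching `Q zero` would equal the first part, although it is non-empty and
  -- disjoint from it.
  ... | zero , eq =
    let x , x∈ = 0<∣p∣⇒∃ (subst (0 <_) (sym (part-size {U = U} {P} pp (suc i))) 1≤d) in
    contradiction (part-disjoint {U = U} {P} pp {suc i} {zero} x∈ (subst (x ∈_) (trans eq (sym first)) x∈)) λ ()

  go : P ≗ Q
  go zero    = first
  go (suc i) = ordered-partition-unique 1≤d parts (subst (λ R → IsOrderedPartition d (U ─ R) (Q ∘ suc)) (sym first) parts′) match-rest i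

-- The part containing the least element of `U` is put first, and the others are ordered recursively
-- in what it leaves.
order-partition : {U : Subset n} {P : Fin e → Subset n} → 1 ≤ d → (∀ i → ∣ P i ∣ ≡ d) → (∀ i → P i ⊆ U) →
  (∀ {i j x} → x ∈ P i → x ∈ P j → i ≡ j) → (∀ {x} → x ∈ U → ∃[ i ] x ∈ P i) →
  Σ[ σ ∈ Permutation′ e ] IsOrderedPartition d U (P ∘ (σ ⟨$⟩ʳ_))
order-partition {e = zero} 1≤d size P⊆ disjoint covers =
  Perm.id , λ (x , x∈) → contradiction (proj₁ (covers x∈)) λ ()
order-partition {e = suc e} {d} {U} {P} 1≤d size P⊆ disjoint covers =
  insert zero b π , (P⊆ b , size b , u , l , u∈) ,
  extend (λ i → cong P (sym (insert-punchIn zero b π i))) (proj₂ rest)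
  where
  nonempty : Nonempty U
  nonempty = let x , x∈ = 0<∣p∣⇒∃ (subst (0 <_) (sym (size zero)) 1≤d) in x , P⊆ zero x∈
  u = proj₁ (least U nonempty)
  l = proj₂ (least U nonempty)
  b = proj₁ (covers (Least-∈ l))
  u∈ = proj₂ (covers (Least-∈ l))

  covers-rest : ∀ {x} → x ∈ U ─ P b → ∃[ i ] x ∈ P (punchIn b i)
  covers-rest {x} x∈ with covers (p─q⊆p U (P b) x∈)
  ... | i , x∈Pi with b Fin.≟ i
  ... | yes refl = contradiction x∈Pi (x∈p─q⇒x∉q U (P b) x∈)
  ... | no b≢i  = punchOut b≢i , subst (λ i → x ∈ P i) (sym (Fin.punchIn-punchOut b≢i)) x∈Pi

  rest : Σ[ σ ∈ Permutation′ e ] IsOrderedPartition d (U ─ P b) (P ∘ punchIn b ∘ (σ ⟨$⟩ʳ_))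
  rest = order-partition 1≤d (size ∘ punchIn b)
    (λ i x∈ → x∈p∧x∉q⇒x∈p─q (P⊆ (punchIn b i) x∈) λ x∈b → Fin.punchInᵢ≢i b i (disjoint x∈ x∈b))
    (λ x∈ x∈′ → Fin.punchIn-injective b _ _ (disjoint x∈ x∈′)) covers-rest
  π = proj₁ rest

  extend : ∀ {e} {U : Subset _} {P Q : Fin e → Subset _} → P ≗ Q → IsOrderedPartition d U P → IsOrderedPartition d U Q
  extend {zero}  eq parts = parts
  extend {suc e} {U} {P} {Q} eq (first , parts) = subst (IsFirstPart d U) (eq zero) first ,
    subst (λ R → IsOrderedPartition d (U ─ R) (Q ∘ suc)) (eq zero) (extend (eq ∘ suc) parts)

-- Relabelling an edge by its parent lap and its part

nth : (S : Subset n) → Fin ∣ S ∣ → Fin n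
nth S i = proj₁ (HasCardinality.element (Elements S) (Elements-cardinality S) i)

nth-∈ : (S : Subset n) (i : Fin ∣ S ∣) → nth S i ∈ S
nth-∈ S i = proj₂ (HasCardinality.element (Elements S) (Elements-cardinality S) i)

nth-injective : (S : Subset n) {i j : Fin ∣ S ∣} → nth S i ≡ nth S j → i ≡ j
nth-injective S = HasCardinality.element-injective (Elements S) (Elements-cardinality S)

cast-injective : ∀ .(eq : m ≡ n) {i j : Fin m} → cast eq i ≡ cast eq j → i ≡ j
cast-injective eq {i} {j} p =
  Fin.toℕ-injective (trans (sym (Fin.toℕ-cast eq i)) (trans (cong toℕ p) (Fin.toℕ-cast eq j)))

-- The size proofs are irrelevant arguments, so that a relabelling is determined by the sets `L` and
-- `P`. Positions below `m` enumerate `L`, the others `P`.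
module _ (L P : Subset n) .(m≤k : m ≤ k) .(∣L∣ : ∣ L ∣ ≡ m) .(∣P∣ : ∣ P ∣ ≡ k ∸ m) where

  private
    side : Fin k → Fin m ⊎ Fin (k ∸ m)
    side i = splitAt m (cast (sym (ℕ.m+[n∸m]≡n m≤k)) i)

    place : Fin m ⊎ Fin (k ∸ m) → Fin n
    place (inj₁ x) = nth L (cast (sym ∣L∣) x)
    place (inj₂ y) = nth P (cast (sym ∣P∣) y)

    side-initial : ∀ i → toℕ i < m → ∃[ x ] side i ≡ inj₁ x
    side-initial i i<m = _ , Fin.splitAt-< m (cast _ i) (subst (_< m) (sym (Fin.toℕ-cast _ i)) i<m)

    side-injective : ∀ {i j} → side i ≡ side j → i ≡ j
    side-injective {i} {j} eq = cast-injective _ (trans (sym (Fin.join-splitAt m (k ∸ m) _))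
      (trans (cong (F.join m (k ∸ m)) eq) (Fin.join-splitAt m (k ∸ m) _)))

  relabel : Fin k → Fin n
  relabel i = place (side i)

  relabel-initial : ∀ {i} → toℕ i < m → relabel i ∈ L
  relabel-initial {i} i<m with x , eq ← side-initial i i<m rewrite eq = nth-∈ L _

  relabel-∈ : ∀ i → relabel i ∈ L ⊎ relabel i ∈ P
  relabel-∈ i with side i
  ... | inj₁ x = inj₁ (nth-∈ L _)
  ... | inj₂ y = inj₂ (nth-∈ P _)

  relabel-injective : Disjoint L P → Injective _≡_ _≡_ relabel
  relabel-injective disjoint {i} {j} eq = side-injective (place-injective (side i) (side j) eq)
    where
    place-injective : ∀ x y → place x ≡ place y → x ≡ y
    place-injective (inj₁ x) (inj₁ y) eq = cong inj₁ (cast-injective (sym ∣L∣) (nth-injective L eq))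
    place-injective (inj₁ x) (inj₂ y) eq = contradiction (subst (_∈ P) (sym eq) (nth-∈ P _)) (disjoint (nth-∈ L _))
    place-injective (inj₂ x) (inj₁ y) eq = contradiction (subst (_∈ P) eq (nth-∈ P _)) (disjoint (nth-∈ L _))
    place-injective (inj₂ x) (inj₂ y) eq = cong inj₂ (cast-injective (sym ∣P∣) (nth-injective P eq))

module _ {L P : Subset n} (m≤k : m ≤ k) (∣L∣ : ∣ L ∣ ≡ m) (∣P∣ : ∣ P ∣ ≡ k ∸ m) (disjoint : Disjoint L P) where

  private
    ψ = relabel L P m≤k ∣L∣ ∣P∣
    ψ-injective = relabel-injective L P m≤k ∣L∣ ∣P∣ disjoint

  image-relabel-initial : image ψ (initial m) ≡ L
  image-relabel-initial = p⊆q∧∣q∣≤∣p∣⇒p≡q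
    (λ z∈ → let x , x∈ , eq = ∈-image⁻ ψ z∈ in
      subst (_∈ L) eq (relabel-initial L P m≤k ∣L∣ ∣P∣ (∈-initial⁻ x∈)))
    (ℕ.≤-reflexive (trans ∣L∣ (sym (trans (∣image∣ ψ-injective (initial m)) (∣initial∣ m≤k)))))

  image-relabel-⊤ : image ψ ⊤ ≡ L ∪ P
  image-relabel-⊤ = p⊆q∧∣q∣≤∣p∣⇒p≡q
    (λ z∈ → let x , _ , eq = ∈-image⁻ ψ z∈ in
      subst (_∈ L ∪ P) eq (x∈p∪q⁺ (relabel-∈ L P m≤k ∣L∣ ∣P∣ x)))
    (ℕ.≤-reflexive (trans (∣p∪q∣≡∣p∣+∣q∣ disjoint) (trans (cong₂ _+_ ∣L∣ ∣P∣) (trans (ℕ.m+[n∸m]≡n m≤k)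
      (sym (trans (∣image∣ ψ-injective ⊤) (∣⊤∣≡n k)))))))

minimum : ∀ {e} (d : Fin (suc e) → ℕ) → ∃[ a ] ∀ b → d a ≤ d b
minimum {zero}  d = zero , λ { zero → ℕ.≤-refl }
minimum {suc e} d with minimum (d ∘ suc)
... | a , min with ℕ.≤-total (d zero) (d (suc a))
... | inj₁ le = zero , λ { zero → ℕ.≤-refl ; (suc b) → ℕ.≤-trans le (min b) }
... | inj₂ ge = suc a , λ { zero → ge ; (suc b) → min b }

sort : ∀ {e} (d : Fin e → ℕ) → Σ[ σ ∈ Permutation′ e ] (∀ {i j} → i F.≤ j → d (σ ⟨$⟩ʳ i) ≤ d (σ ⟨$⟩ʳ j))
sort {zero}  d = Perm.id , λ { {()} }
sort {suc e} d with minimum d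
... | a , min with sort (d ∘ punchIn a)
... | σ , mono = insert zero a σ , sorted
  where
  sorted : ∀ {i j} → i F.≤ j → d (insert zero a σ ⟨$⟩ʳ i) ≤ d (insert zero a σ ⟨$⟩ʳ j)
  sorted {zero}            _        = min _
  sorted {suc i} {suc j} (s≤s i≤j) = subst₂ _≤_
    (cong d (sym (insert-punchIn zero a σ i))) (cong d (sym (insert-punchIn zero a σ j))) (mono i≤j)

-- Built trees given by families of edges and blocks

IsTreeOrdering-cong : {E E′ : Fin e → Subset n} → E ≗ E′ → IsTreeOrdering m E → IsTreeOrdering m E′
IsTreeOrdering-cong {m = m} eq ord i 0<i with ord i 0<i
... | j , j<i , size , fresh = j , j<i , subst₂ (λ A B → ∣ A ∩ B ∣ ≡ m) (eq i) (eq j) size , λ h h<i →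
  subst₂ (λ A B → Empty (A ∩ B)) (cong₂ _─_ (eq i) (eq j)) (eq h) (fresh h h<i)

-- A built-tree with edges numbered by `Fin e` itself: the index type of a `BuiltTree` comes from
-- its edge list and agrees with `Fin e` only through an equation.
record IsFamily (H : Graph m k) {n e : ℕ} (E : Fin e → Subset n) (G : Fin e → Graph m n) : Set where
  field
    E-injective : ∀ {a b} → E a ≡ E b → a ≡ b
    E-size      : ∀ a → ∣ E a ∣ ≡ k
    E-covers    : ∀ v → ∃[ a ] v ∈ E a
    E-ordering  : Σ[ σ ∈ Permutation′ e ] IsTreeOrdering m (E ∘ (σ ⟨$⟩ʳ_))
    G-copy      : ∀ a → IsCopyOn H (E a) (G a)
    G-laps      : ∀ a b → a ≢ b → ∣ E a ∩ E b ∣ ≡ m → E a ∩ E b L.∈ edges (G a) × E a ∩ E b L.∈ edges (G b)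

record Represents {H : Graph m k} (t : BuiltTree H n) (E : Fin e → Subset n) (G : Fin e → Graph m n) : Set where
  field
    edge⇒family : ∀ i → ∃[ a ] edge (tree t) i ≡ E a
    family⇒edge : ∀ a → ∃[ i ] edge (tree t) i ≡ E a
    same-block  : ∀ i a → edge (tree t) i ≡ E a → block t i ≈ᴳ G a

module _ {H : Graph m k} where

  private
    -- For a variable list the equation `length xs ≡ e` can be matched with `refl`, after which `E`
    -- and `G` are families on the positions of `xs`.
    realise-list : (xs : List (Subset n)) → All (λ E → ∣ E ∣ ≡ k) xs → Unique xs → length xs ≡ e → 1 ≤ e →
      (E : Fin e → Subset n) (G : Fin e → Graph m n) →
      (∀ i .(eq : e ≡ length xs) → lookup xs (cast eq i) ≡ E i) → IsFamily H E G →
      Σ[ t ∈ BuiltTree H n ] size (tree t) ≡ e × Represents t E G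
    realise-list {n} xs unif uniq refl 1≤e E G same fam = t , refl , record
      { edge⇒family = λ i → i , ≡E i
      ; family⇒edge = λ i → i , ≡E i
      ; same-block  = λ i a eq → subst (λ a → G i ≈ᴳ G a) (E-injective (trans (sym (≡E i)) eq))
                                    (Setoid.refl (Graph-setoid _ _) {G i})
      }
      where
      open IsFamily fam
      ≡E : ∀ i → lookup xs i ≡ E i
      ≡E i = trans (cong (lookup xs) (sym (Fin.cast-is-id refl i))) (same i refl)

      T : Graph k n
      T = record { edges = xs ; uniform = unif ; unique = uniq }

      t : BuiltTree H n
      t = record
        { tree   = T
        ; isTree = record
          { nonEmpty   = 1≤e
          ; noIsolated = λ v → let a , v∈ = E-covers v in a , subst (v ∈_) (sym (≡E a)) v∈
          ; ordering   = proj₁ E-ordering , IsTreeOrdering-cong (λ i → sym (≡E _)) (proj₂ E-ordering)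
          }
        ; block  = G
        ; isCopy = λ i → subst (λ S → IsCopyOn H S (G i)) (sym (≡E i)) (G-copy i)
        ; laps   = λ i j i≢j → subst₂ (λ A B → ∣ A ∩ B ∣ ≡ m → A ∩ B L.∈ edges (G i) × A ∩ B L.∈ edges (G j))
                     (sym (≡E i)) (sym (≡E j)) (G-laps i j i≢j)
        }

  realise : {E : Fin e → Subset n} {G : Fin e → Graph m n} → 1 ≤ e → IsFamily H E G →
            Σ[ t ∈ BuiltTree H n ] size (tree t) ≡ e × Represents t E G
  realise {E = E} {G} 1≤e fam = realise-list (tabulate E) (All.tabulate⁺ E-size) (Unique.tabulate⁺ E-injective)
    (List.length-tabulate E) 1≤e E G (λ i _ → List.lookup-tabulate E i) fam
    where open IsFamily fam

  family : (t : BuiltTree H n) → size (tree t) ≡ e →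
           Σ[ E ∈ (Fin e → Subset n) ] Σ[ G ∈ (Fin e → Graph m n) ] IsFamily H E G × Represents t E G
  family t refl = edge (tree t) , block t ,
    record
      { E-injective = lookup-injective (unique (tree t)) _ _
      ; E-size      = λ a → All.lookup (uniform (tree t)) (∈-lookup a)
      ; E-covers    = noIsolated
      ; E-ordering  = ordering
      ; G-copy      = isCopy t
      ; G-laps      = laps t
      } ,
    record
      { edge⇒family = λ i → i , refl
      ; family⇒edge = λ i → i , refl
      ; same-block  = λ i a eq → subst (λ a → block t i ≈ᴳ block t a) (lookup-injective (unique (tree t)) _ _ eq)
                                    (Setoid.refl (Graph-setoid _ _) {block t i})
      }
    where open IsTree (isTree t)

  module _ {n e : ℕ} {t u : BuiltTree H n} {E E′ : Fin e → Subset n} {G G′ : Fin e → Graph m n}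
           (rt : Represents t E G) (ru : Represents u E′ G′) where
    private
      module T = Represents rt
      module U = Represents ru
      module Gr = Setoid (Graph-setoid m n)

    represents-≈ : (∀ a → ∃[ b ] E a ≡ E′ b × G a ≈ᴳ G′ b) → (∀ b → ∃[ a ] E a ≡ E′ b × G a ≈ᴳ G′ b) →
                   (∀ {a b} → E a ≡ E b → a ≡ b) → t ≈ᵀ u
    represents-≈ forth back E-injective =
      mk⇔ (λ x∈ → let a , p = T.edge⇒family (Any.index x∈)
                      b , q , _ = forth a
                      j , r = U.family⇒edge b in
                  subst (L._∈ edges (tree u)) (trans r (sym (trans (lookup-index x∈) (trans p q)))) (∈-lookup j))
          (λ x∈ → let b , p = U.edge⇒family (Any.index x∈)
                      a , q , _ = back b
                      i , r = T.family⇒edge a in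
                  subst (L._∈ edges (tree t)) (trans r (trans q (sym (trans (lookup-index x∈) p)))) (∈-lookup i)) ,
      λ i j eq → let b , p = U.edge⇒family j
                     a , q , G≈ = back b in
        Gr.trans {block t i} {G a} {block u j} (T.same-block i a (trans eq (trans p (sym q))))
          (Gr.trans {G a} {G′ b} {block u j} G≈ (Gr.sym {block u j} {G′ b} (U.same-block j b p)))

    ≈-represents : t ≈ᵀ u → ∀ a → ∃[ b ] E a ≡ E′ b × G a ≈ᴳ G′ b
    ≈-represents (p , q) a =
      let i , r = T.family⇒edge a
          j∈ = Equivalence.to p (∈-lookup i)
          j = Any.index j∈
          b , s = U.edge⇒family j
          eq = lookup-index j∈ in
      b , trans (sym r) (trans eq s) ,
      Gr.trans {G a} {block t i} {G′ b} (Gr.sym {block t i} {G a} (T.same-block i a r))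
        (Gr.trans {block t i} {block u j} {G′ b} (q i j eq) (U.same-block j b s))

-- R_H enumerated by `Fin r`. `child c` numbers the edges other than [m], so that an element of
-- `Fin q` names a lap of any edge through its template.
record Templates {m k : ℕ} (H : Graph m k) (r q : ℕ) : Set where
  field
    template  : Fin r → Graph m k
    copy      : ∀ c → IsCopyOn H ⊤ (template c)
    rooted    : ∀ c → initial m L.∈ edges (template c)
    distinct  : ∀ {c c′} → template c ≈ᴳ template c′ → c ≡ c′
    complete  : ∀ G → IsCopyOn H ⊤ G → initial m L.∈ edges G → ∃[ c ] template c ≈ᴳ G
    child     : Fin r → Fin q → Subset k
    child-∈   : ∀ c j → child c j L.∈ edges (template c)
    child-≢   : ∀ c j → child c j ≢ initial m
    child-injective : ∀ c {i j} → child c i ≡ child c j → i ≡ j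
    child-onto : ∀ c {S} → S L.∈ edges (template c) → S ≡ initial m ⊎ ∃[ j ] S ≡ child c j

-- The iteration is deterministic. Hence `depth` does not depend on the proof of cycle-freeness.
reaches-irrelevant : {A B Root : Set} {γ : B → A} {f : A → B ⊎ Root} {x : B ⊎ Root} (p q : Reaches γ f x) → p ≡ q
reaches-irrelevant stop     stop     = refl
reaches-irrelevant (step p) (step q) = cong step (reaches-irrelevant p q)

depth : {A B Root : Set} {γ : B → A} {f : A → B ⊎ Root} {x : B ⊎ Root} → Reaches γ f x → ℕ
depth stop     = 0
depth (step r) = suc (depth r)

-- The built-tree of a code

module Assembly {m k n e q r : ℕ} (m<k : m < k) (m≤n : m ≤ n) {H : Graph m k} (templates : Templates H r q) {Root : Set} where

  open Templates templates

  m≤k : m ≤ k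
  m≤k = ℕ.<⇒≤ m<k

  root : Subset n
  root = initial m

  ∣root∣ : ∣ root ∣ ≡ m
  ∣root∣ = ∣initial∣ m≤n

  template-size : ∀ c {S} → S L.∈ edges (template c) → ∣ S ∣ ≡ m
  template-size c = All.lookup (uniform (template c))

  record Code : Set where
    field
      parts      : Fin e → Subset n
      partition  : IsOrderedPartition (k ∸ m) (∁ root) parts
      kind       : Fin e → Fin r
      parent     : Fin e → (Fin e × Fin q) ⊎ Root
      cycle-free : CycleFree {B = Fin e × Fin q} proj₁ parent

  relabelling : (L P : Subset n) → .(∣ L ∣ ≡ m) → .(∣ P ∣ ≡ k ∸ m) → Fin k → Fin n
  relabelling L P = relabel L P m≤k

  module Layout (z : Code) where
    open Code z

    ∣parts∣ : ∀ a → ∣ parts a ∣ ≡ k ∸ m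
    ∣parts∣ = part-size partition

    root-disjoint : ∀ a → Disjoint root (parts a)
    root-disjoint a v∈root v∈P = x∈∁p⇒x∉p (part-⊆ partition a v∈P) v∈root

    reach : ∀ a → Reaches proj₁ parent (parent a)
    reach a with parent a
    ... | inj₁ b = cycle-free b
    ... | inj₂ _ = stop

    level : Fin e → ℕ
    level a = depth (reach a)

    reach-level : ∀ {a} (p : Reaches proj₁ parent (parent a)) → depth p ≡ level a
    reach-level p = cong depth (reaches-irrelevant p (reach _))

    -- An m-set which can serve as the parent lap of a part of level d.
    Lap : ℕ → Set
    Lap d = Σ[ S ∈ Subset n ] ∣ S ∣ ≡ m × (∀ {v} → v ∈ S → v ∈ root ⊎ ∃[ a ] v ∈ parts a × level a < d)

    lap-disjoint : ∀ {a d} → d ≤ level a → (S : Lap d) → Disjoint (proj₁ S) (parts a)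
    lap-disjoint {a} d≤ (S , _ , below) v∈S v∈P with below v∈S
    ... | inj₁ v∈root = root-disjoint a v∈root v∈P
    ... | inj₂ (b , v∈Pb , <d) with refl ← part-disjoint partition v∈P v∈Pb = ℕ.<⇒≱ <d d≤

    -- Laps are built from the root lap outwards, because relabelling an edge needs its parent lap.
    -- The level bound carried by `Lap` makes that lap disjoint from the part of the edge, and the
    -- relabelling injective.
    lap : ∀ {x} (p : Reaches proj₁ parent x) → Lap (depth p)
    lap stop = root , ∣root∣ , inj₁
    lap (step {a , j} p) with lap p | lap-disjoint (ℕ.≤-reflexive (reach-level p)) (lap p)
    ... | S , ∣S∣ , below | disjoint =
      image φ (child (kind a) j) ,
      trans (∣image∣ (relabel-injective S (parts a) m≤k ∣S∣ (∣parts∣ a) disjoint) _) (template-size (kind a) (child-∈ (kind a) j)) ,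
      λ v∈ → let x , _ , eq = ∈-image⁻ φ v∈ in lifted (subst (λ v → v ∈ S ⊎ v ∈ parts a) eq (relabel-∈ S (parts a) m≤k ∣S∣ (∣parts∣ a) x))
      where
      φ = relabelling S (parts a) ∣S∣ (∣parts∣ a)
      lifted : ∀ {v} → v ∈ S ⊎ v ∈ parts a → v ∈ root ⊎ ∃[ b ] v ∈ parts b × level b < suc (depth p)
      lifted (inj₂ v∈P) = inj₂ (a , v∈P , s≤s (ℕ.≤-reflexive (sym (reach-level p))))
      lifted (inj₁ v∈S) with below v∈S
      ... | inj₁ v∈root = inj₁ v∈root
      ... | inj₂ (b , v∈P , <d) = inj₂ (b , v∈P , ℕ.m<n⇒m<1+n <d)

    parentLap : Fin e → Subset n
    parentLap a = proj₁ (lap (reach a))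

    ∣parentLap∣ : ∀ a → ∣ parentLap a ∣ ≡ m
    ∣parentLap∣ a = proj₁ (proj₂ (lap (reach a)))

    disjoint : ∀ a → Disjoint (parentLap a) (parts a)
    disjoint a = lap-disjoint ℕ.≤-refl (lap (reach a))

    ψ : Fin e → Fin k → Fin n
    ψ a = relabelling (parentLap a) (parts a) (∣parentLap∣ a) (∣parts∣ a)

    ψ-injective : ∀ a → Injective _≡_ _≡_ (ψ a)
    ψ-injective a = relabel-injective (parentLap a) (parts a) m≤k (∣parentLap∣ a) (∣parts∣ a) (disjoint a)

    childLap : Fin e → Fin q → Subset n
    childLap a j = image (ψ a) (child (kind a) j)

    parentLap-root : ∀ {a c} → parent a ≡ inj₂ c → parentLap a ≡ root
    parentLap-root {a} eq = go (reach a) eq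
      where
      go : ∀ {x c} (p : Reaches proj₁ parent x) → x ≡ inj₂ c → proj₁ (lap p) ≡ root
      go stop _ = refl

    parentLap-child : ∀ {a c j} → parent a ≡ inj₁ (c , j) → parentLap a ≡ childLap c j × level c < level a
    parentLap-child {a} eq = go (reach a) eq
      where
      go : ∀ {x c j} (p : Reaches proj₁ parent x) → x ≡ inj₁ (c , j) →
           proj₁ (lap p) ≡ childLap c j × level c < depth p
      go (step {c , j} p) refl with refl ← reaches-irrelevant p (reach c) = refl , s≤s ℕ.≤-refl

    attachment : ∀ a → parentLap a ≡ root ⊎ ∃[ c ] ∃[ j ] parentLap a ≡ childLap c j × level c < level a
    attachment a = go (parent a) refl
      where
      go : ∀ x → parent a ≡ x → parentLap a ≡ root ⊎ ∃[ c ] ∃[ j ] parentLap a ≡ childLap c j × level c < level a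
      go (inj₂ _)       eq = inj₁ (parentLap-root eq)
      go (inj₁ (c , j)) eq = inj₂ (c , j , parentLap-child eq)

    edgeSet : Fin e → Subset n
    edgeSet a = parentLap a ∪ parts a

    blockOf : Fin e → Graph m n
    blockOf a = imageGraph (ψ-injective a) (template (kind a))

    image-ψ-initial : ∀ a → image (ψ a) (initial m) ≡ parentLap a
    image-ψ-initial a = image-relabel-initial m≤k (∣parentLap∣ a) (∣parts∣ a) (disjoint a)

    image-ψ-⊤ : ∀ a → image (ψ a) ⊤ ≡ edgeSet a
    image-ψ-⊤ a = image-relabel-⊤ m≤k (∣parentLap∣ a) (∣parts∣ a) (disjoint a)

    lap⊆edgeSet : ∀ a → parentLap a ⊆ edgeSet a
    lap⊆edgeSet a = p⊆p∪q (parts a)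

    parts⊆edgeSet : ∀ a → parts a ⊆ edgeSet a
    parts⊆edgeSet a = q⊆p∪q (parentLap a) (parts a)

    block-⊆ : ∀ a {S} → S L.∈ edges (blockOf a) → S ⊆ edgeSet a
    block-⊆ a S∈ v∈ with _ , _ , refl ← ∈-map⁻ (image (ψ a)) S∈ =
      subst (_ ∈_) (image-ψ-⊤ a) (image-mono (ψ a) ⊆⊤ v∈)

    block-size : ∀ a {S} → S L.∈ edges (blockOf a) → ∣ S ∣ ≡ m
    block-size a = All.lookup (uniform (blockOf a))

    parentLap-∈ : ∀ a → parentLap a L.∈ edges (blockOf a)
    parentLap-∈ a = subst (L._∈ edges (blockOf a)) (image-ψ-initial a) (∈-map⁺ (image (ψ a)) (rooted (kind a)))

    childLap-∈ : ∀ a j → childLap a j L.∈ edges (blockOf a)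
    childLap-∈ a j = ∈-map⁺ (image (ψ a)) (child-∈ (kind a) j)

    childLap-≢ : ∀ a j → childLap a j ≢ parentLap a
    childLap-≢ a j eq = child-≢ (kind a) j (image-injective (ψ-injective a) (trans eq (sym (image-ψ-initial a))))

    block-laps : ∀ a {S} → S L.∈ edges (blockOf a) → S ≡ parentLap a ⊎ ∃[ j ] S ≡ childLap a j
    block-laps a S∈ with T , T∈ , refl ← ∈-map⁻ (image (ψ a)) S∈ with child-onto (kind a) T∈
    ... | inj₁ refl       = inj₁ (image-ψ-initial a)
    ... | inj₂ (j , refl) = inj₂ (j , refl)

    same-size-⊆ : ∀ {S T : Subset n} → ∣ S ∣ ≡ m → ∣ T ∣ ≡ m → S ⊆ T → S ≡ T
    same-size-⊆ p q S⊆T = p⊆q∧∣q∣≤∣p∣⇒p≡q S⊆T (ℕ.≤-reflexive (trans q (sym p)))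

    -- A child lap has the size of the parent lap and differs from it, so it is not contained in it.
    -- The vertex found here identifies the edge where the lap first occurs.
    childLap-meets : ∀ a j → ∃[ v ] v ∈ childLap a j × v ∈ parts a
    childLap-meets a j with Fin.any? (λ v → v ∈? (childLap a j ∩ parts a))
    ... | yes (v , v∈) = v , x∈p∩q⁻ (childLap a j) (parts a) v∈
    ... | no none = contradiction
      (same-size-⊆ (block-size a (childLap-∈ a j)) (∣parentLap∣ a) λ {v} v∈ →
        [ (λ p → p) , (λ v∈P → contradiction (v , x∈p∩q⁺ (v∈ , v∈P)) none) ]′
          (x∈p∪q⁻ (parentLap a) (parts a) (block-⊆ a (childLap-∈ a j) v∈)))
      (childLap-≢ a j)

    -- An edge consists of its part and of a parent lap with vertices in the root lap or in parts of
    -- lower level.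
    part-in-edgeSet : ∀ {a b v} → v ∈ parts a → v ∈ edgeSet b → a ≡ b ⊎ level a < level b
    part-in-edgeSet {a} {b} v∈P v∈E with x∈p∪q⁻ (parentLap b) (parts b) v∈E
    ... | inj₂ v∈Pb = inj₁ (part-disjoint partition v∈P v∈Pb)
    ... | inj₁ v∈L with proj₂ (proj₂ (lap (reach b))) v∈L
    ... | inj₁ v∈root = contradiction v∈P (root-disjoint a v∈root)
    ... | inj₂ (c , v∈Pc , c<b) = inj₂ (subst (λ x → level x < level b) (part-disjoint partition v∈Pc v∈P) c<b)

    -- A common vertex in the part of `a` would force `b` to have the higher level.
    edgeSet-∩ : ∀ {a b} → a ≢ b → level b ≤ level a → edgeSet a ∩ edgeSet b ⊆ parentLap a
    edgeSet-∩ {a} {b} a≢b b≤a v∈ with x∈p∩q⁻ (edgeSet a) (edgeSet b) v∈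
    ... | v∈Ea , v∈Eb with x∈p∪q⁻ (parentLap a) (parts a) v∈Ea
    ... | inj₁ v∈L = v∈L
    ... | inj₂ v∈P with part-in-edgeSet v∈P v∈Eb
    ... | inj₁ a≡b = contradiction a≡b a≢b
    ... | inj₂ a<b = contradiction b≤a (ℕ.<⇒≱ a<b)

    root-in-edgeSet : ∀ {b} → root ⊆ edgeSet b → root ≡ parentLap b
    root-in-edgeSet {b} sub = same-size-⊆ ∣root∣ (∣parentLap∣ b) λ v∈ →
      [ (λ p → p) , (λ v∈P → contradiction v∈P (root-disjoint b v∈)) ]′ (x∈p∪q⁻ (parentLap b) (parts b) (sub v∈))

    -- The vertex of the lap in the part of `c` places `c` strictly below `b`; the two edges then
    -- meet inside `parentLap b`, which has the size of the lap.
    childLap-in-edgeSet : ∀ {c j b} → c ≢ b → childLap c j ⊆ edgeSet b → childLap c j ≡ parentLap b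
    childLap-in-edgeSet {c} {j} {b} c≢b sub with childLap-meets c j
    ... | v , v∈S , v∈P with part-in-edgeSet v∈P (sub v∈S)
    ... | inj₁ c≡b = contradiction c≡b c≢b
    ... | inj₂ c<b = same-size-⊆ (block-size c (childLap-∈ c j)) (∣parentLap∣ b) λ v∈ →
      edgeSet-∩ (c≢b ∘ sym) (ℕ.<⇒≤ c<b) (x∈p∩q⁺ (sub v∈ , block-⊆ c (childLap-∈ c j) v∈))

    -- Supplies the second half of the lap condition: a child lap of `b` is in the block by
    -- construction, and any other lap inside the edge is the parent lap of `b`.
    parentLap-in-edgeSet : ∀ {a b} → parentLap a ⊆ edgeSet b → parentLap a L.∈ edges (blockOf b)
    parentLap-in-edgeSet {a} {b} sub with attachment a
    ... | inj₁ La≡root = subst (L._∈ edges (blockOf b))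
      (sym (trans La≡root (root-in-edgeSet λ v∈ → sub (subst (_ ∈_) (sym La≡root) v∈)))) (parentLap-∈ b)
    ... | inj₂ (c , j , La≡ , _) with c Fin.≟ b
    ... | yes refl = subst (L._∈ edges (blockOf b)) (sym La≡) (childLap-∈ c j)
    ... | no c≢b = subst (L._∈ edges (blockOf b))
      (sym (trans La≡ (childLap-in-edgeSet c≢b λ v∈ → sub (subst (_ ∈_) (sym La≡) v∈)))) (parentLap-∈ b)

    some-part : ∀ a → ∃[ v ] v ∈ parts a
    some-part a = 0<∣p∣⇒∃ (subst (0 <_) (sym (∣parts∣ a)) (ℕ.m<n⇒0<n∸m m<k))

    edgeSet-injective : ∀ {a b} → edgeSet a ≡ edgeSet b → a ≡ b
    edgeSet-injective {a} {b} eq with some-part a | some-part b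
    ... | v , v∈ | w , w∈ with part-in-edgeSet v∈ (subst (v ∈_) eq (parts⊆edgeSet a v∈))
                             | part-in-edgeSet w∈ (subst (w ∈_) (sym eq) (parts⊆edgeSet b w∈))
    ... | inj₁ p   | _        = p
    ... | inj₂ _   | inj₁ p   = sym p
    ... | inj₂ a<b | inj₂ b<a = contradiction a<b (ℕ.<-asym b<a)

    order : Permutation′ e
    order = proj₁ (sort level)

    order-injective : ∀ {i j} → order ⟨$⟩ʳ i ≡ order ⟨$⟩ʳ j → i ≡ j
    order-injective = permutation-injective order

    order-mono : ∀ {i j} → i F.≤ j → level (order ⟨$⟩ʳ i) ≤ level (order ⟨$⟩ʳ j)
    order-mono = proj₂ (sort level)

    lowest-root : ∀ a → (∀ b → level a ≤ level b) → parentLap a ≡ root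
    lowest-root a low with attachment a
    ... | inj₁ eq = eq
    ... | inj₂ (c , _ , _ , c<a) = contradiction (low c) (ℕ.<⇒≱ c<a)

    attach : ∀ i j → j F.< i → parentLap (order ⟨$⟩ʳ i) ⊆ edgeSet (order ⟨$⟩ʳ j) →
             ∣ edgeSet (order ⟨$⟩ʳ i) ∩ edgeSet (order ⟨$⟩ʳ j) ∣ ≡ m ×
             (∀ h → h F.< i → Empty ((edgeSet (order ⟨$⟩ʳ i) ─ edgeSet (order ⟨$⟩ʳ j)) ∩ edgeSet (order ⟨$⟩ʳ h)))
    attach i j j<i sub =
      trans (cong ∣_∣ (⊆-antisym (earlier j<i) λ v∈ → x∈p∩q⁺ (lap⊆edgeSet _ v∈ , sub v∈))) (∣parentLap∣ _) ,
      λ h h<i (v , v∈) → let v∈─ , v∈Eh = x∈p∩q⁻ (Ei ─ Ej) (edgeSet (order ⟨$⟩ʳ h)) v∈ in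
        x∈p─q⇒x∉q Ei Ej v∈─ (sub (earlier h<i (x∈p∩q⁺ (p─q⊆p Ei Ej v∈─ , v∈Eh))))
      where
      Ei = edgeSet (order ⟨$⟩ʳ i)
      Ej = edgeSet (order ⟨$⟩ʳ j)
      earlier : ∀ {h} → h F.< i → Ei ∩ edgeSet (order ⟨$⟩ʳ h) ⊆ parentLap (order ⟨$⟩ʳ i)
      earlier h<i = edgeSet-∩ (λ eq → Fin.<⇒≢ h<i (sym (order-injective eq))) (order-mono (ℕ.<⇒≤ h<i))

    -- Sorted by level, an edge follows the edge it hangs from and meets every earlier edge inside
    -- its parent lap.
    tree-ordering : IsTreeOrdering m (edgeSet ∘ (order ⟨$⟩ʳ_))
    tree-ordering i@(suc _) _ with attachment (order ⟨$⟩ʳ i)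
    -- Edges at the root lap are joined to the first edge, which has the least level and so hangs at
    -- the root lap too.
    ... | inj₁ eq = zero , s≤s z≤n , attach i zero (s≤s z≤n) λ v∈ →
      lap⊆edgeSet _ (subst (_ ∈_) (trans eq (sym (lowest-root _ lowest))) v∈)
      where
      lowest : ∀ b → level (order ⟨$⟩ʳ zero) ≤ level b
      lowest b = subst (λ b → level (order ⟨$⟩ʳ zero) ≤ level b) (inverseʳ order {b})
        (order-mono {zero} {order ⟨$⟩ˡ b} z≤n)
    ... | inj₂ (c , j , eq , c<) = h , h<i , attach i h h<i λ v∈ → block-⊆ _
      (subst (λ b → childLap c j L.∈ edges (blockOf b)) (sym (inverseʳ order)) (childLap-∈ c j)) (subst (_ ∈_) eq v∈)
      where
      h = order ⟨$⟩ˡ c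
      h<i : h F.< i
      h<i = ℕ.≰⇒> λ i≤h → ℕ.<⇒≱ (subst (λ x → level x < level (order ⟨$⟩ʳ i)) (sym (inverseʳ order)) c<) (order-mono i≤h)

    -- Descending along parents from any edge ends at the root lap. This is why [m] is covered and
    -- the tree is rooted at it.
    some-root : Fin e → ∃[ a ] parentLap a ≡ root
    some-root a = go a (<-wellFounded (level a))
      where
      go : ∀ a → Acc _<_ (level a) → ∃[ b ] parentLap b ≡ root
      go a (acc rec) with attachment a
      ... | inj₁ eq                = a , eq
      ... | inj₂ (c , _ , _ , c<a) = go c (rec c<a)

    -- By `edgeSet-∩`, an intersection of size `m` is the whole of `parentLap a`.
    laps-ordered : ∀ {a b} → a ≢ b → level b ≤ level a → ∣ edgeSet a ∩ edgeSet b ∣ ≡ m →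
      edgeSet a ∩ edgeSet b L.∈ edges (blockOf a) × edgeSet a ∩ edgeSet b L.∈ edges (blockOf b)
    laps-ordered {a} {b} a≢b b≤a size =
      subst (L._∈ edges (blockOf a)) (sym eq) (parentLap-∈ a) ,
      subst (L._∈ edges (blockOf b)) (sym eq) (parentLap-in-edgeSet λ v∈ →
        p∩q⊆q (edgeSet a) (edgeSet b) (subst (_ ∈_) (sym eq) v∈))
      where
      eq : edgeSet a ∩ edgeSet b ≡ parentLap a
      eq = same-size-⊆ size (∣parentLap∣ a) (edgeSet-∩ a≢b b≤a)

    isFamily : Fin e → IsFamily H edgeSet blockOf
    isFamily a₀ = record
      { E-injective = edgeSet-injective
      ; E-size      = λ a → trans (∣p∪q∣≡∣p∣+∣q∣ (disjoint a))
                        (trans (cong₂ _+_ (∣parentLap∣ a) (∣parts∣ a)) (ℕ.m+[n∸m]≡n m≤k))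
      ; E-covers    = covers
      ; E-ordering  = order , tree-ordering
      ; G-copy      = λ a → let φ , inj , _ , eq = copy (kind a) in
          ψ a ∘ φ , inj ∘ ψ-injective a ,
          trans (sym (image-∘ φ (ψ a) ⊤)) (trans (cong (image (ψ a)) (image-⊤ inj)) (image-ψ-⊤ a)) ,
          SetEq.trans (∼-map-cong (λ _ → refl) eq) (≡⇒∼ (map-image-∘ φ (ψ a) (edges H)))
      ; G-laps      = laps′
      }
      where
      covers : ∀ v → ∃[ a ] v ∈ edgeSet a
      covers v with v ∈? root
      ... | yes v∈ = let a , eq = some-root a₀ in a , lap⊆edgeSet a (subst (v ∈_) (sym eq) v∈)
      ... | no v∉  = let a , v∈ = part-covers partition (x∉p⇒x∈∁p v∉) in a , parts⊆edgeSet a v∈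

      laps′ : ∀ a b → a ≢ b → ∣ edgeSet a ∩ edgeSet b ∣ ≡ m →
        edgeSet a ∩ edgeSet b L.∈ edges (blockOf a) × edgeSet a ∩ edgeSet b L.∈ edges (blockOf b)
      laps′ a b a≢b size with ℕ.≤-total (level b) (level a)
      ... | inj₁ b≤a = laps-ordered a≢b b≤a size
      ... | inj₂ a≤b = let p , q = laps-ordered (a≢b ∘ sym) a≤b (trans (cong ∣_∣ (∩-comm (edgeSet b) (edgeSet a))) size) in
        subst (L._∈ edges (blockOf a)) (∩-comm (edgeSet b) (edgeSet a)) q ,
        subst (L._∈ edges (blockOf b)) (∩-comm (edgeSet b) (edgeSet a)) p

p∪q─p≡q : ∀ {n} {p q : Subset n} → Disjoint p q → (p ∪ q) ─ p ≡ q
p∪q─p≡q {p = p} {q} disjoint = ⊆-antisym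
  (λ x∈ → [ (λ x∈p → contradiction x∈p (x∈p─q⇒x∉q (p ∪ q) p x∈)) , (λ x∈q → x∈q) ]′
             (x∈p∪q⁻ p q (p─q⊆p (p ∪ q) p x∈)))
  λ x∈q → x∈p∧x∉q⇒x∈p─q (q⊆p∪q p q x∈q) λ x∈p → disjoint x∈p x∈q

-- Codes with the same tree

module CodeEquality {m k n e q r : ℕ} (m<k : m < k) (m≤n : m ≤ n) {H : Graph m k} (templates : Templates H r q)
                    {Root : Set} where

  open Assembly {e = e} m<k m≤n templates {Root}
  open Templates templates
  open Code

  private
    relabelling-cong : ∀ {L L′ P P′ : Subset n} .{p : ∣ L ∣ ≡ m} .{p′ : ∣ L′ ∣ ≡ m}
      .{q : ∣ P ∣ ≡ k ∸ m} .{q′ : ∣ P′ ∣ ≡ k ∸ m} → L ≡ L′ → P ≡ P′ →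
      relabelling L P p q ≡ relabelling L′ P′ p′ q′
    relabelling-cong refl refl = refl

  -- The laps of a code are the only solution of the equations imposed by `parent`. This is applied
  -- to the laps of an equal code and to those of an orientation.
  module _ (z : Code) {L P : Fin e → Subset n} {κ : Fin e → Fin r}
           (∣L∣ : ∀ a → ∣ L a ∣ ≡ m) (∣P∣ : ∀ a → ∣ P a ∣ ≡ k ∸ m)
           (parts≗ : parts z ≗ P) (kind≗ : kind z ≗ κ)
           (attached-root  : ∀ {a c} → parent z a ≡ inj₂ c → L a ≡ root)
           (attached-child : ∀ {a c j} → parent z a ≡ inj₁ (c , j) →
                             L a ≡ image (relabelling (L c) (P c) (∣L∣ c) (∣P∣ c)) (child (κ c) j)) where
    open Layout z

    layout-unique : parentLap ≗ L
    layout-unique a = go a (<-wellFounded (level a))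
      where
      go : ∀ a → Acc _<_ (level a) → parentLap a ≡ L a
      go a (acc rec) = by (parent z a) refl
        where
        by : ∀ x → parent z a ≡ x → parentLap a ≡ L a
        by (inj₂ _)       eq = trans (parentLap-root eq) (sym (attached-root eq))
        by (inj₁ (c , j)) eq = let La≡ , c<a = parentLap-child eq in
          trans La≡ (trans (cong (λ φ → image φ (child (kind z c) j)) (relabelling-cong (go c (rec c<a)) (parts≗ c)))
            (trans (cong (λ x → image (relabelling (L c) (P c) (∣L∣ c) (∣P∣ c)) (child x j)) (kind≗ c))
              (sym (attached-child eq))))

    edgeSet-unique : ∀ a → edgeSet a ≡ L a ∪ P a
    edgeSet-unique a = cong₂ _∪_ (layout-unique a) (parts≗ a)

    block-unique : ∀ a → edges (blockOf a) ≡
                   map (image (relabelling (L a) (P a) (∣L∣ a) (∣P∣ a))) (edges (template (κ a)))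
    block-unique a = trans
      (cong (λ φ → map (image φ) (edges (template (kind z a)))) (relabelling-cong (layout-unique a) (parts≗ a)))
      (cong (λ x → map (image (relabelling (L a) (P a) (∣L∣ a) (∣P∣ a))) (edges (template x))) (kind≗ a))

  module _ (z z′ : Code) where
    private
      module Z = Layout z
      module Z′ = Layout z′

    SameCode : Set
    SameCode = parts z ≗ parts z′ × kind z ≗ kind z′ × parent z ≗ parent z′

    SameTree : Set
    SameTree = ∀ a → ∃[ b ] Z.edgeSet a ≡ Z′.edgeSet b × Z.blockOf a ≈ᴳ Z′.blockOf b

    SameCode⇒same : SameCode → ∀ a → Z.edgeSet a ≡ Z′.edgeSet a × Z.blockOf a ≈ᴳ Z′.blockOf a
    SameCode⇒same (parts≗ , kind≗ , parent≗) a =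
      edgeSet-unique z Z′.∣parentLap∣ Z′.∣parts∣ parts≗ kind≗ at-root at-child a ,
      ≡⇒∼ (block-unique z Z′.∣parentLap∣ Z′.∣parts∣ parts≗ kind≗ at-root at-child a)
      where
      at-root : ∀ {a c} → parent z a ≡ inj₂ c → Z′.parentLap a ≡ root
      at-root eq = Z′.parentLap-root (trans (sym (parent≗ _)) eq)
      at-child : ∀ {a c j} → parent z a ≡ inj₁ (c , j) → Z′.parentLap a ≡ Z′.childLap c j
      at-child eq = proj₁ (Z′.parentLap-child (trans (sym (parent≗ _)) eq))

    module _ (unique-root : (c c′ : Root) → c ≡ c′) (same : SameTree) where

      private
        parts-from-laps : ∀ {a b} → Z.edgeSet a ≡ Z′.edgeSet b → Z.parentLap a ≡ Z′.parentLap b → parts z a ≡ parts z′ b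
        parts-from-laps {a} {b} eq lap≡ = trans (sym (p∪q─p≡q (Z.disjoint a)))
          (trans (cong₂ _─_ eq lap≡) (p∪q─p≡q (Z′.disjoint b)))

        -- Induction on the level of `a`. The edge `c` it hangs from matches some `d` with the same
        -- block and, by induction, the same parent lap, so the lap is a child lap of `d`; lying
        -- inside edge `b`, it is the parent lap of `b`.
        parentLap-same : ∀ {a b} → Z.edgeSet a ≡ Z′.edgeSet b → Z.parentLap a ≡ Z′.parentLap b
        parentLap-same {a} = go a (<-wellFounded (Z.level a))
          where
          go : ∀ a → Acc _<_ (Z.level a) → ∀ {b} → Z.edgeSet a ≡ Z′.edgeSet b → Z.parentLap a ≡ Z′.parentLap b
          go a (acc rec) {b} eq with Z.attachment a
          ... | inj₁ La≡root = trans La≡root (Z′.root-in-edgeSet λ v∈ →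
                subst (_ ∈_) eq (Z.lap⊆edgeSet a (subst (_ ∈_) (sym La≡root) v∈)))
          ... | inj₂ (c , j , La≡ , c<a) with same c
          ... | d , Ec≡ , Gc≈ with go c (rec c<a) Ec≡ | Z′.block-laps d (Equivalence.to Gc≈ (Z.childLap-∈ c j))
          ... | Lc≡ | inj₁ S≡ = contradiction (trans S≡ (sym Lc≡)) (Z.childLap-≢ c j)
          ... | Lc≡ | inj₂ (j′ , S≡) = trans La≡ (trans S≡ (Z′.childLap-in-edgeSet d≢b λ v∈ →
                subst (_ ∈_) eq (Z.lap⊆edgeSet a (subst (_ ∈_) (sym (trans La≡ S≡)) v∈))))
            where
            d≢b : d ≢ b
            d≢b refl with refl ← Z.edgeSet-injective {a} {c} (trans eq (sym Ec≡)) = ℕ.<-irrefl refl c<a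

        -- The parts agree up to numbering, and their canonical order fixes the numbering.
        parts-same : parts z ≗ parts z′
        parts-same = ordered-partition-unique (ℕ.m<n⇒0<n∸m m<k) (partition z) (partition z′)
          λ a → let b , eq , _ = same a in b , parts-from-laps eq (parentLap-same eq)

        same-at : ∀ a → Z.edgeSet a ≡ Z′.edgeSet a × Z.blockOf a ≈ᴳ Z′.blockOf a
        same-at a with same a
        ... | b , eq , G≈ with Z.some-part a
        ... | v , v∈ with refl ← part-disjoint (partition z′) (subst (v ∈_) (parts-same a) v∈)
                                   (subst (v ∈_) (parts-from-laps eq (parentLap-same eq)) v∈) = eq , G≈

        lap-same : ∀ a → Z.parentLap a ≡ Z′.parentLap a
        lap-same a = parentLap-same (proj₁ (same-at a))

        ψ-same : ∀ a x → Z.ψ a x ≡ Z′.ψ a x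
        ψ-same a = cong-app (relabelling-cong (lap-same a) (parts-same a))

        kind-same : kind z ≗ kind z′
        kind-same a = distinct (images-injective (Z.ψ-injective a)
          (SetEq.trans (proj₂ (same-at a)) (≡⇒∼ (sym (map-image-cong (ψ-same a) (edges (template (kind z′ a))))))))

        childLap-same : ∀ a j → Z′.childLap a j ≡ Z.childLap a j
        childLap-same a j = trans (sym (image-cong (ψ-same a) _)) (cong (λ x → image (Z.ψ a) (child x j)) (sym (kind-same a)))

        root-≢-childLap : ∀ c j → root ≢ Z.childLap c j
        root-≢-childLap c j eq with Z.childLap-meets c j
        ... | v , v∈S , v∈P = Z.root-disjoint c (subst (v ∈_) (sym eq) v∈S) v∈P

        meets-higher : ∀ {c j c′ j′} → c ≢ c′ → Z.childLap c j ≡ Z.childLap c′ j′ → Z.level c < Z.level c′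
        meets-higher {c} {j} {c′} {j′} c≢c′ eq with Z.childLap-meets c j
        ... | v , v∈S , v∈P with Z.part-in-edgeSet v∈P (Z.block-⊆ c′ (Z.childLap-∈ c′ j′) (subst (v ∈_) eq v∈S))
        ... | inj₁ c≡c′ = contradiction c≡c′ c≢c′
        ... | inj₂ lt   = lt

        -- A lap shared as a child by two different edges would put each of them at a lower level
        -- than the other.
        childLap-injective : ∀ {c j c′ j′} → Z.childLap c j ≡ Z.childLap c′ j′ → (c , j) ≡ (c′ , j′)
        childLap-injective {c} {j} {c′} {j′} eq with c Fin.≟ c′
        ... | yes refl = cong (c ,_) (child-injective (kind z c) (image-injective (Z.ψ-injective c) eq))
        ... | no c≢c′ = contradiction (meets-higher c≢c′ eq) (ℕ.<-asym (meets-higher (c≢c′ ∘ sym) (sym eq)))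

        parent-same : parent z ≗ parent z′
        parent-same a = compare (parent z a) (parent z′ a) refl refl
          where
          compare : ∀ x y → parent z a ≡ x → parent z′ a ≡ y → parent z a ≡ parent z′ a
          compare (inj₁ (c , j)) (inj₁ (c′ , j′)) p q = trans p (trans
            (cong inj₁ (childLap-injective (trans (sym (proj₁ (Z.parentLap-child p)))
              (trans (lap-same a) (trans (proj₁ (Z′.parentLap-child q)) (childLap-same c′ j′)))))) (sym q))
          compare (inj₁ (c , j)) (inj₂ _) p q = contradiction
            (trans (sym (Z′.parentLap-root q)) (trans (sym (lap-same a)) (proj₁ (Z.parentLap-child p)))) (root-≢-childLap c j)
          compare (inj₂ _) (inj₁ (c , j)) p q = contradiction
            (trans (sym (Z.parentLap-root p)) (trans (lap-same a) (trans (proj₁ (Z′.parentLap-child q)) (childLap-same c j))))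
            (root-≢-childLap c j)
          compare (inj₂ c) (inj₂ c′) p q = trans p (trans (cong inj₂ (unique-root c c′)) (sym q))

      SameTree⇒SameCode : SameCode
      SameTree⇒SameCode = parts-same , kind-same , parent-same

-- Orientations of built-trees

-- The edges in I, directed away from the lap R.
record Orientation (I : Fin e → Set) (E : Fin e → Subset n) (G : Fin e → Graph m n) (R : Subset n) : Set where
  field
    lap       : Fin e → Subset n
    level     : Fin e → ℕ
    lap-∈     : ∀ {a} → I a → lap a L.∈ edges (G a)
    attached  : ∀ {a} → I a → lap a ≡ R ⊎
                  -- `lap a ≢ lap c` makes the lap a child lap of `c`; if the two were equal, `a`
                  -- would hang beside `c`.
                  ∃[ c ] I c × level c < level a × lap a L.∈ edges (G c) × lap a ≢ lap c
    separate  : ∀ {a b v} → I a → I b → v ∈ E a → v ∉ lap a → v ∈ E b → v ∉ lap b → a ≡ b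
    root-free : ∀ {a v} → I a → v ∈ R → v ∈ E a → v ∈ lap a

module _ {E : Fin e → Subset n} {G : Fin e → Graph m n} where

  open Orientation

  -- Adds the edge `i` with parent lap `x` at level `l` and moves the root from `R₀` to `R`. Either
  -- the root stays, or `i` comes between `R` and the edges at `R₀`; `level′` allows the old levels
  -- to be raised to make room for it.
  extend-orientation : ∀ {p R₀} {i : Fin e} → toℕ i ≡ p → (o : Orientation (λ a → toℕ a < p) E G R₀) →
    ∀ R x l (level′ : Fin e → ℕ) → (∀ {a b} → level o a < level o b → level′ a < level′ b) →
    x L.∈ edges (G i) →
    (x ≡ R ⊎ ∃[ c ] toℕ c < p × level′ c < l × x L.∈ edges (G c) × x ≢ lap o c) →
    (R₀ ≡ R ⊎ R₀ L.∈ edges (G i) × R₀ ≢ x × (∀ a → l < level′ a)) →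
    (∀ {b v} → toℕ b < p → v ∈ E i → v ∉ x → v ∈ E b → v ∈ lap o b) →
    (∀ {v} → v ∈ R → v ∈ E i → v ∈ x) →
    (∀ {b v} → toℕ b < p → v ∈ R → v ∈ E b → v ∈ lap o b) →
    Orientation (λ a → toℕ a < suc p) E G R
  extend-orientation {p} {R₀} {i} refl o R x l level′ mono x∈ x-attached R₀-attached x-separate x-free old-free = record
    { lap       = lap′
    ; level     = level″
    ; lap-∈     = λ {a} a≤ → by-age (λ a → lap′ a L.∈ edges (G a))
                    (subst (L._∈ edges (G i)) (sym lap-i) x∈)
                    (λ a a< → subst (L._∈ edges (G a)) (sym (lap-old a<)) (lap-∈ o a<)) a a≤
    ; attached  = λ {a} → by-age Attached attached-i attached-old a
    ; separate  = λ {a} {b} a≤ b≤ → by-age (λ a → ∀ b → toℕ b < suc p → ∀ {v} → v ∈ E a → v ∉ lap′ a → v ∈ E b → v ∉ lap′ b → a ≡ b)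
                    (by-age (λ b → ∀ {v} → v ∈ E i → v ∉ lap′ i → v ∈ E b → v ∉ lap′ b → i ≡ b)
                      (λ _ _ _ _ → refl)
                      λ b b< v∈i v∉i v∈b v∉b → contradiction (x-separate b< v∈i (v∉i ∘ subst (_ ∈_) (sym lap-i)) v∈b) (v∉b ∘ subst (_ ∈_) (sym (lap-old b<))))
                    (λ a a< → by-age (λ b → ∀ {v} → v ∈ E a → v ∉ lap′ a → v ∈ E b → v ∉ lap′ b → a ≡ b)
                      (λ v∈a v∉a v∈i v∉i → contradiction (x-separate a< v∈i (v∉i ∘ subst (_ ∈_) (sym lap-i)) v∈a) (v∉a ∘ subst (_ ∈_) (sym (lap-old a<))))
                      (λ b b< v∈a v∉a v∈b v∉b → separate o a< b< v∈a (v∉a ∘ subst (_ ∈_) (sym (lap-old a<))) v∈b (v∉b ∘ subst (_ ∈_) (sym (lap-old b<)))))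
                    a a≤ b b≤
    ; root-free = λ {a} a≤ → by-age (λ a → ∀ {v} → v ∈ R → v ∈ E a → v ∈ lap′ a)
                    (λ v∈R v∈E → subst (_ ∈_) (sym lap-i) (x-free v∈R v∈E))
                    (λ a a< v∈R v∈E → subst (_ ∈_) (sym (lap-old a<)) (old-free a< v∈R v∈E)) a a≤
    }
    where
    by-age : (P : Fin e → Set) → P i → (∀ a → toℕ a < p → P a) → ∀ a → toℕ a < suc p → P a
    by-age P new old a a≤ with toℕ a ℕ.<? p
    ... | yes a<p = old a a<p
    ... | no a≮p  = subst P (Fin.toℕ-injective (ℕ.≤-antisym (ℕ.≮⇒≥ a≮p) (ℕ.≤-pred a≤))) new

    ≢i : ∀ {a} → toℕ a < p → a ≢ i
    ≢i a< refl = ℕ.<-irrefl refl a<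

    lap′ : Fin e → Subset n
    lap′ = updateAt (lap o) i (const x)

    level″ : Fin e → ℕ
    level″ = updateAt level′ i (const l)

    lap-i : lap′ i ≡ x
    lap-i = updateAt-updates i (lap o)

    lap-old : ∀ {a} → toℕ a < p → lap′ a ≡ lap o a
    lap-old a< = updateAt-minimal _ i (lap o) (≢i a<)

    level-i : level″ i ≡ l
    level-i = updateAt-updates i level′

    level-old : ∀ {a} → toℕ a < p → level″ a ≡ level′ a
    level-old a< = updateAt-minimal _ i level′ (≢i a<)

    Attached : Fin e → Set
    Attached a = lap′ a ≡ R ⊎
      ∃[ c ] toℕ c < suc p × level″ c < level″ a × lap′ a L.∈ edges (G c) × lap′ a ≢ lap′ c

    attached-i : Attached i
    attached-i = [ (λ x≡R → inj₁ (trans lap-i x≡R)) , (λ (c , c< , lt , x∈c , x≢) → inj₂ (c , ℕ.m<n⇒m<1+n c< ,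
      subst₂ _<_ (sym (level-old c<)) (sym level-i) lt ,
      subst (L._∈ edges (G c)) (sym lap-i) x∈c ,
      λ eq → x≢ (trans (sym lap-i) (trans eq (lap-old c<))))) ]′ x-attached

    attached-old : ∀ a → toℕ a < p → Attached a
    attached-old a a< with attached o a<
    ... | inj₂ (c , c< , lt , La∈ , La≢) = inj₂ (c , ℕ.m<n⇒m<1+n c< ,
      subst₂ _<_ (sym (level-old c<)) (sym (level-old a<)) (mono lt) ,
      subst (L._∈ edges (G c)) (sym (lap-old a<)) La∈ ,
      λ eq → La≢ (trans (sym (lap-old a<)) (trans eq (lap-old c<))))
    ... | inj₁ La≡R₀ = [ (λ R₀≡R → inj₁ (trans (lap-old a<) (trans La≡R₀ R₀≡R))) , (λ (R₀∈ , R₀≢ , low) → inj₂ (i , ℕ.n<1+n p ,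
      subst₂ _<_ (sym level-i) (sym (level-old a<)) (low a) ,
      subst (L._∈ edges (G i)) (sym (trans (lap-old a<) La≡R₀)) R₀∈ ,
      λ eq → R₀≢ (trans (sym La≡R₀) (trans (sym (lap-old a<)) (trans eq lap-i))))) ]′ R₀-attached

  module _ (ordering : IsTreeOrdering m E)
           (block-⊆ : ∀ a {S} → S L.∈ edges (G a) → S ⊆ E a)
           (laps : ∀ a b → a ≢ b → ∣ E a ∩ E b ∣ ≡ m → E a ∩ E b L.∈ edges (G a) × E a ∩ E b L.∈ edges (G b)) where

    -- If the lap R belongs to the last edge i, direct the earlier edges away from
    -- the lap joining them to i, and then i itself away from R.
    orient : ∀ p → p ≤ e → ∀ {R h} → toℕ h < p → R L.∈ edges (G h) → Orientation (λ a → toℕ a < p) E G R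
    orient (suc p) p<e {R} {h} h≤p R∈ = next p refl
      where
      i : Fin e
      i = fromℕ< p<e

      i≡p : toℕ i ≡ p
      i≡p = Fin.toℕ-fromℕ< p<e

      root-only : p ≡ 0 → Orientation (λ a → toℕ a < suc p) E G R
      root-only refl = extend-orientation i≡p empty R R 0 (level empty) (λ lt → lt) (subst (λ a → R L.∈ edges (G a)) h≡i R∈)
        (inj₁ refl) (inj₁ refl) (λ ()) (λ v∈ _ → v∈) λ ()
        where
        h≡i : h ≡ i
        h≡i = Fin.toℕ-injective (trans (ℕ.n<1⇒n≡0 h≤p) (sym i≡p))
        empty : Orientation (λ a → toℕ a < 0) E G R
        empty = record { lap = λ _ → R ; level = λ _ → 0 ; lap-∈ = λ () ; attached = λ () ; separate = λ () ; root-free = λ () }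

      next : ∀ p′ → p ≡ p′ → Orientation (λ a → toℕ a < suc p) E G R
      next zero     eq = root-only eq
      next (suc p′) eq with ordering i (subst (0 <_) (sym (trans i≡p eq)) (s≤s z≤n))
      ... | j , j<i , size , fresh = attach-last (toℕ h ℕ.<? p)
        where
        S = E i ∩ E j
        <i : ∀ {b} → toℕ b < p → b F.< i
        <i {b} = subst (toℕ b <_) (sym i≡p)
        j<p : toℕ j < p
        j<p = subst (toℕ j <_) i≡p j<i
        S-laps = laps i j (λ i≡j → Fin.<⇒≢ j<i (sym i≡j)) size
        old-∩ : ∀ {b v} → toℕ b < p → v ∈ E i → v ∈ E b → v ∈ S
        old-∩ {b} {v} b<p v∈i v∈b with v ∈? E j
        ... | yes v∈j = x∈p∩q⁺ (v∈i , v∈j)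
        ... | no v∉j  = contradiction (v , x∈p∩q⁺ (x∈p∧x∉q⇒x∈p─q v∈i v∉j , v∈b)) (fresh b (<i b<p))

        attach-last : Dec (toℕ h < p) → Orientation (λ a → toℕ a < suc p) E G R
        attach-last (yes h<p) = extend-orientation i≡p o R S (suc (level o j)) (level o) (λ lt → lt) (proj₁ S-laps)
          S-attached (inj₁ refl) (λ b<p v∈i v∉S v∈b → contradiction (old-∩ b<p v∈i v∈b) v∉S)
          (λ v∈R v∈i → old-∩ h<p v∈i (block-⊆ h R∈ v∈R)) (root-free o)
          where
          o = orient p (ℕ.<⇒≤ p<e) h<p R∈
          S-attached : S ≡ R ⊎ ∃[ c ] toℕ c < p × level o c < suc (level o j) × S L.∈ edges (G c) × S ≢ lap o c
          S-attached with S ≟ˢ lap o j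
          ... | no S≢Lj = inj₂ (j , j<p , ℕ.≤-refl , proj₂ S-laps , S≢Lj)
          -- If `S` is the parent lap of `j` itself, `i` becomes a sibling of `j` and hangs where
          -- `j` does; the level `suc (level o j)` is still large enough.
          ... | yes S≡Lj with attached o j<p
          ... | inj₁ Lj≡R = inj₁ (trans S≡Lj Lj≡R)
          ... | inj₂ (c , c<p , lt , Lj∈ , Lj≢) = inj₂ (c , c<p , ℕ.m<n⇒m<1+n lt ,
            subst (L._∈ edges (G c)) (sym S≡Lj) Lj∈ , λ eq → Lj≢ (trans (sym S≡Lj) eq))
        -- Now `R` is a lap of `i`, so `i` gets level 0 and the earlier levels rise by one. Unless
        -- `S` is `R`, the edges at `S` hang from `i`.
        attach-last (no h≮p) = extend-orientation i≡p o R R 0 (suc ∘ level o) s≤s R∈i (inj₁ refl) R₀-attached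
          (λ b<p v∈i _ v∈b → root-free o b<p (old-∩ b<p v∈i v∈b) v∈b) (λ v∈R _ → v∈R)
          (λ b<p v∈R v∈b → root-free o b<p (old-∩ b<p (block-⊆ i R∈i v∈R) v∈b) v∈b)
          where
          o = orient p (ℕ.<⇒≤ p<e) j<p (proj₂ S-laps)
          R∈i : R L.∈ edges (G i)
          R∈i = subst (λ a → R L.∈ edges (G a)) (Fin.toℕ-injective
            (trans (ℕ.≤-antisym (ℕ.≤-pred h≤p) (ℕ.≮⇒≥ h≮p)) (sym i≡p))) R∈
          R₀-attached : S ≡ R ⊎ S L.∈ edges (G i) × S ≢ R × (∀ a → 0 < suc (level o a))
          R₀-attached with S ≟ˢ R
          ... | yes S≡R = inj₁ S≡R
          ... | no S≢R  = inj₂ (proj₁ S-laps , S≢R , λ _ → s≤s z≤n)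

-- `φ` and `ψ` have the same image, so `φ` is `ψ` after a permutation `χ` of [k], and the graph
-- sought is the image of `H` under `χ`.
pull-back : ∀ {m k n} {H : Graph m k} {E : Subset n} (G : Graph m n) {ψ : Fin k → Fin n} → Injective _≡_ _≡_ ψ →
  image ψ ⊤ ≡ E → IsCopyOn H E G → image ψ (initial m) L.∈ edges G →
  Σ[ G′ ∈ Graph m k ] IsCopyOn H ⊤ G′ × initial m L.∈ edges G′ × map (image ψ) (edges G′) ∼[ set ] edges G
pull-back {m} {k} {H = H} G {ψ} ψ-injective ψ⊤ (φ , inj , φ⊤ , eq) L∈ =
  G′ , (χ , χ-injective , image-⊤ χ-injective , SetEq.refl) , initial-∈ , ψG′∼G
  where
  lift : ∀ x → ∃[ y ] y ∈ ⊤ × ψ y ≡ φ x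
  lift x = ∈-image⁻ ψ (subst (φ x ∈_) (trans φ⊤ (sym ψ⊤)) (∈-image⁺ φ ∈⊤))
  χ : Fin k → Fin k
  χ = proj₁ ∘ lift
  ψχ≗φ : ∀ x → ψ (χ x) ≡ φ x
  ψχ≗φ = proj₂ ∘ proj₂ ∘ lift
  χ-injective : Injective _≡_ _≡_ χ
  χ-injective {x} {y} p = inj (trans (sym (ψχ≗φ x)) (trans (cong ψ p) (ψχ≗φ y)))
  G′ : Graph m k
  G′ = imageGraph χ-injective H
  ψG′∼G : map (image ψ) (edges G′) ∼[ set ] edges G
  ψG′∼G = SetEq.trans (≡⇒∼ (trans (map-image-∘ χ ψ (edges H)) (map-image-cong ψχ≗φ (edges H)))) (SetEq.sym eq)
  initial-∈ : initial m L.∈ edges G′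
  initial-∈ = let _ , S∈ , ψ≡ = ∈-map⁻ (image ψ) (Equivalence.from ψG′∼G L∈) in
    subst (L._∈ edges G′) (sym (image-injective ψ-injective ψ≡)) S∈

images-∼-trans : ∀ {k n} (φ : Fin k → Fin n) {xs ys : List (Subset k)} {zs : List (Subset n)} →
  xs ∼[ set ] ys → map (image φ) ys ∼[ set ] zs → map (image φ) xs ∼[ set ] zs
images-∼-trans φ p q = SetEq.trans (∼-map-cong (λ _ → refl) p) q

≡-∼-trans : {A : Set} {xs ys zs : List A} → xs ≡ ys → ys ∼[ set ] zs → xs ∼[ set ] zs
≡-∼-trans refl q = q

-- The code of an oriented built-tree

module Surjectivity {m k n e q r : ℕ} (m<k : m < k) (m≤n : m ≤ n) {H : Graph m k} (templates : Templates H r q)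
                    {Root : Set} (c₀ : Root) where

  open Assembly {e = e} m<k m≤n templates {Root}
  open CodeEquality {e = e} m<k m≤n templates {Root}
  open Templates templates
  open Code

  -- The code numbers the edges by the canonical order of their parts, the family in its own way;
  -- `τ` translates between the two.
  Encodes : Code → (Fin e → Subset n) → (Fin e → Graph m n) → Set
  Encodes z E G = Σ[ τ ∈ Permutation′ e ] (∀ a → edgeSet a ≡ E (τ ⟨$⟩ʳ a) × blockOf a ≈ᴳ G (τ ⟨$⟩ʳ a))
    where open Layout z

  module _ {E : Fin e → Subset n} {G : Fin e → Graph m n}
           (E-size : ∀ a → ∣ E a ∣ ≡ k) (E-covers : ∀ v → ∃[ a ] v ∈ E a)
           (G-copy : ∀ a → IsCopyOn H (E a) (G a))
           (block-⊆ : ∀ a {S} → S L.∈ edges (G a) → S ⊆ E a)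
           {I : Fin e → Set} (full : ∀ a → I a) (o : Orientation I E G root) where

    open Orientation o

    private
      part : Fin e → Subset n
      part a = E a ─ lap a

      lap⊆E : ∀ a → lap a ⊆ E a
      lap⊆E a = block-⊆ a (lap-∈ (full a))

      ∣lap∣ : ∀ a → ∣ lap a ∣ ≡ m
      ∣lap∣ a = All.lookup (uniform (G a)) (lap-∈ (full a))

      ∣part∣ : ∀ a → ∣ part a ∣ ≡ k ∸ m
      ∣part∣ a = trans (sym (ℕ.m+n∸m≡n m ∣ part a ∣))
        (cong (_∸ m) (trans (cong (_+ ∣ part a ∣) (sym (∣lap∣ a))) (trans (sym (∣p∣≡∣q∣+∣p─q∣ (lap⊆E a))) (E-size a))))

      part-free : ∀ a → part a ⊆ ∁ root
      part-free a v∈ = x∉p⇒x∈∁p λ v∈root →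
        x∈p─q⇒x∉q (E a) (lap a) v∈ (root-free (full a) v∈root (p─q⊆p (E a) (lap a) v∈))

      part-separate : ∀ {a b v} → v ∈ part a → v ∈ part b → a ≡ b
      part-separate {a} {b} v∈a v∈b = separate (full a) (full b)
        (p─q⊆p (E a) (lap a) v∈a) (x∈p─q⇒x∉q (E a) (lap a) v∈a)
        (p─q⊆p (E b) (lap b) v∈b) (x∈p─q⇒x∉q (E b) (lap b) v∈b)

      -- A vertex outside the root lap that lies in the parent lap of an edge also lies in an edge
      -- of lower level; the descent ends where the vertex is new.
      parts-cover : ∀ {v} → v ∈ ∁ root → ∃[ a ] v ∈ part a
      parts-cover {v} v∉ = let a , v∈ = E-covers v in go a (<-wellFounded (level a)) v∈
        where
        go : ∀ a → Acc _<_ (level a) → v ∈ E a → ∃[ b ] v ∈ part b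
        go a (acc rec) v∈E with v ∈? lap a
        ... | no v∉L = a , x∈p∧x∉q⇒x∈p─q v∈E v∉L
        ... | yes v∈L with attached (full a)
        ... | inj₁ La≡root = contradiction (subst (v ∈_) La≡root v∈L) (x∈∁p⇒x∉p v∉)
        ... | inj₂ (c , _ , lt , La∈ , _) = go c (rec lt) (block-⊆ c La∈ v∈L)

      lap-part-disjoint : ∀ a → Disjoint (lap a) (part a)
      lap-part-disjoint a v∈L v∈P = x∈p─q⇒x∉q (E a) (lap a) v∈P v∈L

      lap∪part : ∀ a → lap a ∪ part a ≡ E a
      lap∪part a = p⊆q∧∣q∣≤∣p∣⇒p≡q
        (λ v∈ → [ lap⊆E a , p─q⊆p (E a) (lap a) ]′ (x∈p∪q⁻ (lap a) (part a) v∈))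
        (ℕ.≤-reflexive (trans (∣p∣≡∣q∣+∣p─q∣ (lap⊆E a)) (sym (∣p∪q∣≡∣p∣+∣q∣ (lap-part-disjoint a)))))

      ψ : Fin e → Fin k → Fin n
      ψ a = relabelling (lap a) (part a) (∣lap∣ a) (∣part∣ a)

      ψ-injective : ∀ a → Injective _≡_ _≡_ (ψ a)
      ψ-injective a = relabel-injective (lap a) (part a) m≤k (∣lap∣ a) (∣part∣ a) (lap-part-disjoint a)

      ψ-initial : ∀ a → image (ψ a) (initial m) ≡ lap a
      ψ-initial a = image-relabel-initial m≤k (∣lap∣ a) (∣part∣ a) (lap-part-disjoint a)

      choose-template : ∀ {a} → (Σ[ G′ ∈ Graph m k ] IsCopyOn H ⊤ G′ × initial m L.∈ edges G′ ×
                          map (image (ψ a)) (edges G′) ∼[ set ] edges (G a)) →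
                        ∃[ c ] map (image (ψ a)) (edges (template c)) ∼[ set ] edges (G a)
      choose-template {a} (G′ , isCopy , initial-∈ , ψG′∼G) = let c , c≈G′ = complete G′ isCopy initial-∈ in
        c , images-∼-trans (ψ a) {edges (template c)} {edges G′} {edges (G a)} c≈G′ ψG′∼G

      abstract
        pulled-back : ∀ a → ∃[ c ] map (image (ψ a)) (edges (template c)) ∼[ set ] edges (G a)
        pulled-back a = choose-template (pull-back {H = H} {E a} (G a) {ψ a} (ψ-injective a)
          (trans (image-relabel-⊤ m≤k (∣lap∣ a) (∣part∣ a) (lap-part-disjoint a)) (lap∪part a))
          (G-copy a) (subst (L._∈ edges (G a)) (sym (ψ-initial a)) (lap-∈ (full a))))

      κ : Fin e → Fin r
      κ a = proj₁ (pulled-back a)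

      -- The drop in level is recorded because it yields cycle-freeness in `reach-from`.
      IsParent : Fin e → (Fin e × Fin q) ⊎ Root → Set
      IsParent a (inj₁ (c , j)) = lap a ≡ image (ψ c) (child (κ c) j) × level c < level a
      IsParent a (inj₂ _)       = lap a ≡ root

      template-lap : ∀ c {S} → S L.∈ edges (G c) → ∃[ T ] T L.∈ edges (template (κ c)) × S ≡ image (ψ c) T
      template-lap c S∈ = ∈-map⁻ (image (ψ c)) (Equivalence.from (proj₂ (pulled-back c)) S∈)

      child-lap : ∀ c {S} → S L.∈ edges (G c) → S ≢ lap c → ∃[ j ] S ≡ image (ψ c) (child (κ c) j)
      child-lap c S∈ S≢ =
        let T , T∈ , S≡ = template-lap c S∈ in
        [ (λ T≡ → contradiction (trans S≡ (trans (cong (image (ψ c)) T≡) (ψ-initial c))) S≢) ,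
          (λ (j , T≡) → j , trans S≡ (cong (image (ψ c)) T≡)) ]′ (child-onto (κ c) T∈)

      find-parent : ∀ a → ∃[ x ] IsParent a x
      find-parent a = [ (λ La≡root → inj₂ c₀ , La≡root) ,
        (λ (c , _ , lt , La∈ , La≢) → let j , La≡ = child-lap c La∈ La≢ in inj₁ (c , j) , La≡ , lt) ]′ (attached (full a))

      parent′ : Fin e → (Fin e × Fin q) ⊎ Root
      parent′ = proj₁ ∘ find-parent

      reach-from : ∀ a → Acc _<_ (level a) → Reaches {B = Fin e × Fin q} proj₁ parent′ (parent′ a)
      reach-from a (acc rec) = by (parent′ a) (proj₂ (find-parent a))
        where
        by : ∀ x → IsParent a x → Reaches proj₁ parent′ x
        by (inj₂ _)       _        = stop
        by (inj₁ (c , j)) (_ , lt) = step (reach-from c (rec lt))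

    private
      -- The laps of the code `z` are computed by recursion, those of the orientation are given; as
      -- the latter satisfy `at-root` and `at-child`, the uniqueness of layouts identifies the two.
      encode′ : ∃[ z ] Encodes z E G
      encode′ = z , τ , λ a →
        trans (edgeSet-unique z {lap ∘ τʳ} {part ∘ τʳ} {κ ∘ τʳ} (∣lap∣ ∘ τʳ) (∣part∣ ∘ τʳ) (λ _ → refl) (λ _ → refl) at-root at-child a) (lap∪part (τʳ a)) ,
        ≡-∼-trans {zs = edges (G (τʳ a))} (block-unique z {lap ∘ τʳ} {part ∘ τʳ} {κ ∘ τʳ} (∣lap∣ ∘ τʳ) (∣part∣ ∘ τʳ) (λ _ → refl) (λ _ → refl) at-root at-child a)
          (proj₂ (pulled-back (τʳ a)))
        where
        ordered = order-partition (ℕ.m<n⇒0<n∸m m<k) ∣part∣ part-free part-separate parts-cover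
        τ = proj₁ ordered
        τʳ = τ ⟨$⟩ʳ_

        rename : (Fin e × Fin q) ⊎ Root → (Fin e × Fin q) ⊎ Root
        rename (inj₁ (c , j)) = inj₁ (τ ⟨$⟩ˡ c , j)
        rename (inj₂ c)       = inj₂ c

        renamed-reach : ∀ {x} → Reaches {B = Fin e × Fin q} proj₁ parent′ x → Reaches {B = Fin e × Fin q} proj₁ (rename ∘ parent′ ∘ τʳ) (rename x)
        renamed-reach stop = stop
        renamed-reach (step {c , j} p) =
          step (subst (λ c → Reaches proj₁ (rename ∘ parent′ ∘ τʳ) (rename (parent′ c))) (sym (inverseʳ τ)) (renamed-reach p))

        z : Code
        z = record
          { parts      = part ∘ τʳ
          ; partition  = proj₂ ordered
          ; kind       = κ ∘ τʳ
          ; parent     = rename ∘ parent′ ∘ τʳ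
          ; cycle-free = λ (a , j) → step (renamed-reach (reach-from (τʳ a) (<-wellFounded _)))
          }

        at-root : ∀ {a c} → parent z a ≡ inj₂ c → lap (τʳ a) ≡ root
        at-root {a} = by (parent′ (τʳ a)) (proj₂ (find-parent (τʳ a)))
          where
          by : ∀ x → IsParent (τʳ a) x → ∀ {c} → rename x ≡ inj₂ c → lap (τʳ a) ≡ root
          by (inj₂ _) p _ = p

        at-child : ∀ {a c j} → parent z a ≡ inj₁ (c , j) → lap (τʳ a) ≡ image (ψ (τʳ c)) (child (κ (τʳ c)) j)
        at-child {a} = by (parent′ (τʳ a)) (proj₂ (find-parent (τʳ a)))
          where
          by : ∀ x → IsParent (τʳ a) x → ∀ {c j} → rename x ≡ inj₁ (c , j) → lap (τʳ a) ≡ image (ψ (τʳ c)) (child (κ (τʳ c)) j)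
          by (inj₁ (c , j)) (p , _) refl = trans p (cong (λ c → image (ψ c) (child (κ c) j)) (sym (inverseʳ τ)))

    abstract
      encode : ∃[ z ] Encodes z E G
      encode = encode′

-- The number of rooted built-trees

OtherMembers : {A : Set} → List A → A → Setoid 0ℓ 0ℓ
OtherMembers xs x = Subsetoid (Members xs) λ (y , _) → y ≢ x

OtherMembers-cardinality : {xs : List (Subset k)} {x : Subset k} → Unique xs → x L.∈ xs →
                           HasCardinality (OtherMembers xs x) (length xs ∸ 1)
OtherMembers-cardinality {xs = xs} {x} unique x∈ = subst (HasCardinality (OtherMembers xs x))
  (cong (_∸ 1) (cardinality-unique (Members xs)
    (split-cardinality (Members xs) (λ (y , _) → y ≟ˢ x) (λ { refl p → p })
      (singleton-cardinality _ ((x , x∈) , refl) proj₂) (proj₂ others))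
    (Members-cardinality unique)))
  (proj₂ others)
  where
  others = subset-cardinality (Members xs) (λ (y , _) → ¬? (y ≟ˢ x)) (λ { refl p → p }) (Members-cardinality unique)

copy-size : {H : Graph m k} {E : Subset n} (G : Graph m n) → IsCopyOn H E G → size G ≡ size H
copy-size {H = H} G (φ , inj , _ , eq) =
  trans (∼-length {ys = map (image φ) (edges H)} (unique G) (unique (imageGraph inj H)) eq) (List.length-map (image φ) (edges H))

templates : (H : Graph m k) → ∀ {r} → HasCardinality (CopiesContainingInitial H) r → Templates H r (size H ∸ 1)
templates {m} {k} H {r} card = record
  { template  = template
  ; copy      = template-copy
  ; rooted    = rooted
  ; distinct  = λ {c} {c′} → Copies.element-injective {c} {c′}
  ; complete  = λ G copy m∈ → Copies.index (G , copy , m∈) , Copies.element∘index (G , copy , m∈)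
  ; child     = child
  ; child-∈   = λ c j → proj₂ (proj₁ (Others.element c j))
  ; child-≢   = λ c j → proj₂ (Others.element c j)
  ; child-injective = λ c → Others.element-injective c
  ; child-onto = onto
  }
  where
  module Copies = HasCardinality (CopiesContainingInitial H) card
  template : Fin r → Graph m k
  template c = proj₁ (Copies.element c)

  template-copy : ∀ c → IsCopyOn H ⊤ (template c)
  template-copy c = proj₁ (proj₂ (Copies.element c))

  rooted : ∀ c → initial m L.∈ edges (template c)
  rooted c = proj₂ (proj₂ (Copies.element c))

  template-edges : ∀ c → size (template c) ≡ size H
  template-edges c = copy-size {H = H} {⊤} (template c) (template-copy c)

  module Others c = HasCardinality (OtherMembers (edges (template c)) (initial m))
    (subst (λ N → HasCardinality (OtherMembers (edges (template c)) (initial m)) (N ∸ 1)) (template-edges c)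
      (OtherMembers-cardinality (unique (template c)) (rooted c)))

  child : Fin r → Fin (size H ∸ 1) → Subset k
  child c j = proj₁ (proj₁ (Others.element c j))

  onto : ∀ c {S} → S L.∈ edges (template c) → S ≡ initial m ⊎ ∃[ j ] S ≡ child c j
  onto c {S} S∈ = decide (S ≟ˢ initial m)
    where
    decide : Dec (S ≡ initial m) → S ≡ initial m ⊎ ∃[ j ] S ≡ child c j
    decide (yes eq) = inj₁ eq
    decide (no neq) = inj₂ (Others.index c ((S , S∈) , neq) , sym (Others.element∘index c ((S , S∈) , neq)))

module _ {m k n e q r : ℕ} (m<k : m < k) (m≤n : m ≤ n) (1≤e : 1 ≤ e) {H : Graph m k} (ts : Templates H r q)
         {Root : Set} (c₀ : Root) (unique-root : (c c′ : Root) → c ≡ c′) where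

  open Assembly {e = e} m<k m≤n ts {Root}
  open CodeEquality {e = e} m<k m≤n ts {Root}
  open Surjectivity {e = e} m<k m≤n ts {Root} c₀

  private
    -- A code carries the partition itself in place of an element of the product of the X_i; that
    -- product enters only as the number of ordered partitions.
    Codes Trees : Setoid 0ℓ 0ℓ
    Codes = ×-setoid (CycleFreeFunctions (Fin e) (Fin e × Fin q) Root proj₁)
                     (×-setoid (OrderedPartitions (k ∸ m) e (∁ root)) (Π-setoid λ (_ : Fin e) → setoid (Fin r)))
    Trees = RootedBuiltTrees H e root

    code : Setoid.Carrier Codes → Code
    code ((f , cf) , (P , parts) , κ) = record
      { parts = P ; partition = parts ; kind = κ ; parent = f ; cycle-free = cf }

    a₀ : Fin e
    a₀ = fromℕ< 1≤e

    abstract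
      assembled : (z : Code) → let open Layout z in
                  Σ[ t ∈ BuiltTree H n ] size (tree t) ≡ e × Represents t edgeSet blockOf
      assembled z = realise 1≤e (Layout.isFamily z a₀)

    assembled-rooted : (z : Code) → RootedAt root (proj₁ (assembled z))
    assembled-rooted z =
      let a , La≡root = some-root a₀
          t , _ , rep = assembled z
          i , eq = Represents.family⇒edge rep a in
      i , Equivalence.from (Represents.same-block rep i a eq) (subst (L._∈ edges (blockOf a)) La≡root (parentLap-∈ a))
      where open Layout z

    assemble : Setoid.Carrier Codes → Setoid.Carrier Trees
    assemble x = let z = code x in
      proj₁ (assembled z) , proj₁ (proj₂ (assembled z)) , assembled-rooted z

    assemble-cong : ∀ {x y} → Setoid._≈_ Codes x y → Setoid._≈_ Trees (assemble x) (assemble y)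
    assemble-cong {x} {y} (f≗ , P≗ , κ≗) =
      represents-≈ (proj₂ (proj₂ (assembled (code x)))) (proj₂ (proj₂ (assembled (code y))))
        (λ a → a , same a) (λ a → a , same a) (Layout.edgeSet-injective (code x))
      where same = SameCode⇒same (code x) (code y) (P≗ , κ≗ , f≗)

    assemble-injective : ∀ {x y} → Setoid._≈_ Trees (assemble x) (assemble y) → Setoid._≈_ Codes x y
    assemble-injective {x} {y} eq =
      let P≗ , κ≗ , f≗ = SameTree⇒SameCode (code x) (code y) unique-root
            (≈-represents (proj₂ (proj₂ (assembled (code x)))) (proj₂ (proj₂ (assembled (code y)))) eq) in
      f≗ , P≗ , κ≗

    copy-⊆ : {E : Subset n} {G : Graph m n} → IsCopyOn H E G → ∀ {S} → S L.∈ edges G → S ⊆ E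
    copy-⊆ {E} (φ , _ , φ⊤ , eq) S∈ v∈ =
      let T , _ , S≡ = ∈-map⁻ (image φ) (Equivalence.to eq S∈) in
      subst (_ ∈_) φ⊤ (image-mono φ (⊆⊤ {p = T}) (subst (_ ∈_) S≡ v∈))

    -- An orientation is constructed along a tree ordering, so the family is first permuted by `σ`;
    -- the permutation `τ` of the encoding is then composed with `σ`.
    encode-family : {E : Fin e → Subset n} {G : Fin e → Graph m n} → IsFamily H E G →
                    ∀ {a} → root L.∈ edges (G a) → ∃[ z ] Encodes z E G
    encode-family {E} {G} fam {a} root∈ = let z , τ , matches = encoded in z , τ Perm.∘ₚ σ , matches
      where
      open IsFamily fam
      σ = proj₁ E-ordering
      σʳ = σ ⟨$⟩ʳ_
      block-⊆ : ∀ a {S} → S L.∈ edges (G (σʳ a)) → S ⊆ E (σʳ a)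
      block-⊆ a = copy-⊆ {E (σʳ a)} {G (σʳ a)} (G-copy (σʳ a))
      orientation : Orientation (λ a → toℕ a < e) (E ∘ σʳ) (G ∘ σʳ) root
      orientation = orient (proj₂ E-ordering) block-⊆
        (λ a b a≢b → G-laps (σʳ a) (σʳ b) (a≢b ∘ permutation-injective σ)) e ℕ.≤-refl (Fin.toℕ<n (σ ⟨$⟩ˡ a))
        (subst (λ a → root L.∈ edges (G a)) (sym (inverseʳ σ)) root∈)
      encoded : ∃[ z ] Encodes z (E ∘ σʳ) (G ∘ σʳ)
      encoded = encode {E ∘ σʳ} {G ∘ σʳ} (E-size ∘ σʳ)
        (λ v → let b , v∈ = E-covers v in σ ⟨$⟩ˡ b , subst (λ b → v ∈ E b) (sym (inverseʳ σ)) v∈)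
        (G-copy ∘ σʳ) block-⊆ Fin.toℕ<n orientation

    encodes-≈ : ∀ {x t} {E : Fin e → Subset n} {G : Fin e → Graph m n} → Represents (proj₁ t) E G →
                Encodes (code x) E G → Setoid._≈_ Trees (assemble x) t
    encodes-≈ {x} {E = E} {G} rep (τ , matches) = represents-≈ (proj₂ (proj₂ (assembled (code x)))) rep
      (λ a → (τ ⟨$⟩ʳ a) , matches a)
      (λ b → (τ ⟨$⟩ˡ b) , subst (λ c → Layout.edgeSet (code x) (τ ⟨$⟩ˡ b) ≡ E c × Layout.blockOf (code x) (τ ⟨$⟩ˡ b) ≈ᴳ G c)
        (inverseʳ τ) (matches (τ ⟨$⟩ˡ b)))
      (Layout.edgeSet-injective (code x))

    code⁻¹ : Code → Setoid.Carrier Codes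
    code⁻¹ z = (parent , cycle-free) , (parts , partition) , kind
      where open Code z

    assemble-onto : ∀ t → ∃[ x ] Setoid._≈_ Trees (assemble x) t
    assemble-onto (t , size≡e , i , root∈) =
      let E , G , fam , rep = family t size≡e
          a , eq = Represents.edge⇒family rep i
          z , encodes = encode-family fam (Equivalence.to (Represents.same-block rep i a eq) root∈) in
      code⁻¹ z , encodes-≈ {code⁻¹ z} {t , size≡e , i , root∈} rep encodes

  codes⤖trees : Bijection Codes Trees
  codes⤖trees = mkBijection Codes Trees assemble
    (λ {x} {y} → assemble-cong {x} {y}) (λ {x} {y} → assemble-injective {x} {y}) assemble-onto

∏-const : ∀ e r → ∏ {e} (λ _ → r) ≡ r ^ e
∏-const zero    r = refl
∏-const (suc e) r = cong (r *_) (∏-const e r)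

∏-*-const : ∀ {e} (x : Fin e → ℕ) r → ∏ (λ i → x i * r) ≡ ∏ x * r ^ e
∏-*-const {zero}  x r = refl
∏-*-const {suc e} x r = trans (cong (x zero * r *_) (∏-*-const (x ∘ suc) r))
  (interchange (x zero) r (∏ (x ∘ suc)) (r ^ e))
  where open import Algebra.Properties.CommutativeSemigroup ℕ.*-commutativeSemigroup using (interchange)

RootedBuiltTrees-cardinality : ∀ {m k n} e → m < k → 1 ≤ e → (H : Graph m k) → n ≡ e * (k ∸ m) + m →
  ∀ {r} → HasCardinality (CopiesContainingInitial H) r →
  HasCardinality (RootedBuiltTrees H e (initial {n} m))
    (suc (e * (size H ∸ 1)) ^ (e ∸ 1) * (∏ {e} (λ i → ((k ∸ m) * (e ∸ toℕ i) ∸ 1) C (k ∸ m ∸ 1)) * r ^ e))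
RootedBuiltTrees-cardinality {m} {k} {n} e m<k 1≤e H n≡ {r} card =
  Bijection-sym (codes⤖trees m<k m≤n 1≤e {H = H} (templates H card) {Root} (initial {n} m , refl) λ { (_ , refl) (_ , refl) → refl })
  ⨾ ×-cardinality (CycleFreeFunctions (Fin e) (Fin e × Fin (size H ∸ 1)) Root proj₁) _
      (CycleFreeFunctions-cardinality e (size H ∸ 1) {Root} (initial {n} m , refl) (λ { (_ , refl) → refl }) 1≤e)
      (×-cardinality (OrderedPartitions (k ∸ m) e (∁ (initial {n} m))) (Π-setoid λ (_ : Fin e) → setoid (Fin r))
        (OrderedPartitions-cardinality (k ∸ m) e (∁ (initial {n} m)) (ℕ.m<n⇒0<n∸m m<k) ∣∁∣)
        (subst (HasCardinality _) (∏-const e r)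
          (Π-cardinality e (λ _ → setoid (Fin r)) (λ _ → r) λ _ → Fin-cardinality r)))
  where
  Root : Set
  Root = Σ[ L ∈ Subset n ] L ≡ initial m
  m≤n : m ≤ n
  m≤n = subst (m ≤_) (sym n≡) (ℕ.m≤n+m m _)
  ∣∁∣ : ∣ ∁ (initial {n} m) ∣ ≡ (k ∸ m) * e
  ∣∁∣ = trans (∣∁p∣≡n∸∣p∣ (initial {n} m)) (trans (cong₂ _∸_ n≡ (∣initial∣ {m} {n} m≤n))
    (trans (ℕ.m+n∸n≡m (e * (k ∸ m)) m) (ℕ.*-comm e (k ∸ m))))

-- Evaluation of the count

open import Data.Integer.Base as ℤ using (ℤ; +_)
import Data.Integer.Properties as ℤ
open import Data.Rational.Base as ℚ using (ℚ; _/_)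
open import Data.Rational.Properties using (fromℚᵘ-cong; toℚᵘ-homo-*; toℚᵘ-injective; toℚᵘ-fromℚᵘ; /-cong)
open import Data.Rational.Unnormalised.Base as ℚᵘ using (mkℚᵘ; *≡*)
import Data.Rational.Unnormalised.Properties as ℚᵘ

nCk*k![n∸k]!≡n! : ∀ {n k} → k ≤ n → (n C k) * (k ! * (n ∸ k) !) ≡ n !
nCk*k![n∸k]!≡n! {n} {k} k≤n = trans (cong (_* (k ! * (n ∸ k) !)) (nCk≡n!/k![n-k]! k≤n))
  (m/n*n≡m (k![n∸k]!∣n! k≤n))
  where instance _ = k !* (n ∸ k) !≢0

-- The product counts unordered partitions into `e` parts of size `suc d`; ordering the parts and
-- the elements of each gives every ordering of the set once. The induction peels off one part by
-- C(M, d) d! (M - d)! = M! with M = (e + 1)(d + 1) - 1.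
partition-count : ∀ d e → e ! * ∏ {e} (λ i → (suc d * (e ∸ toℕ i) ∸ 1) C d) * (suc d !) ^ e ≡ (e * suc d) !
partition-count d zero    = refl
partition-count d (suc e) = begin
  suc e * e ! * (x₀ * X) * (suc d * d ! * (suc d !) ^ e)
    ≡⟨ rearrange (suc e) (e !) x₀ X (suc d) (d !) ((suc d !) ^ e) ⟩
  suc e * suc d * (x₀ * (d ! * (e ! * X * (suc d !) ^ e)))
    ≡⟨ cong (λ y → suc e * suc d * (x₀ * (d ! * y))) (partition-count d e) ⟩
  suc e * suc d * (x₀ * (d ! * (e * suc d) !))
    ≡⟨ cong (λ M → suc e * suc d * ((M C d) * (d ! * (e * suc d) !))) (cong (_∸ 1) (ℕ.*-comm (suc d) (suc e))) ⟩
  suc e * suc d * (((d + e * suc d) C d) * (d ! * (e * suc d) !))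
    ≡⟨ cong (λ y → suc e * suc d * (((d + e * suc d) C d) * (d ! * y !))) (ℕ.m+n∸m≡n d (e * suc d)) ⟨
  suc e * suc d * (((d + e * suc d) C d) * (d ! * (d + e * suc d ∸ d) !))
    ≡⟨ cong (suc e * suc d *_) (nCk*k![n∸k]!≡n! (ℕ.m≤m+n d (e * suc d))) ⟩
  suc e * suc d * (d + e * suc d) ! ∎
  where
  open ≡-Reasoning
  x₀ = (suc d * suc e ∸ 1) C d
  X = ∏ {e} (λ i → (suc d * (e ∸ toℕ i) ∸ 1) C d)
  rearrange : ∀ a b c x f g h → a * b * (c * x) * (f * g * h) ≡ a * f * (c * (g * (b * x * h)))
  rearrange = solve-∀

pos-^ : ∀ a b → + (a ^ b) ≡ (+ a) ℤ.^ b
pos-^ a zero    = refl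
pos-^ a (suc b) = trans (ℤ.pos-* a (a ^ b)) (cong (+ a ℤ.*_) (pos-^ a b))

-- If l = 0 then f = 1 - e is negative, but the factor r ^ e vanishes.
count-as-integer : ∀ l e r x → 1 ≤ e → (l ≡ 0 → r ≡ 0) →
  + (suc (e * (l ∸ 1)) ^ (e ∸ 1) * (x * r ^ e)) ≡
  (+ e ℤ.* (+ l ℤ.- + 1) ℤ.+ + 1) ℤ.^ (e ∸ 1) ℤ.* + (x * r ^ e)
count-as-integer zero (suc e) r x _ r≡0 with refl ← r≡0 refl = begin
  + (F * (x * 0))                 ≡⟨ cong (λ y → + (F * y)) (ℕ.*-zeroʳ x) ⟩
  + (F * 0)                       ≡⟨ cong +_ (ℕ.*-zeroʳ F) ⟩
  + 0                             ≡⟨ ℤ.*-zeroʳ f ⟨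
  f ℤ.* + 0                       ≡⟨ cong (λ y → f ℤ.* + y) (ℕ.*-zeroʳ x) ⟨
  f ℤ.* + (x * 0)                 ∎
  where
  open ≡-Reasoning
  F = suc (suc e * 0) ^ e
  f = (+ suc e ℤ.* (+ 0 ℤ.- + 1) ℤ.+ + 1) ℤ.^ e
count-as-integer (suc l) e r x _ _ = begin
  + (suc (e * l) ^ (e ∸ 1) * (x * r ^ e))           ≡⟨ ℤ.pos-* (suc (e * l) ^ (e ∸ 1)) (x * r ^ e) ⟩
  + (suc (e * l) ^ (e ∸ 1)) ℤ.* + (x * r ^ e)       ≡⟨ cong (ℤ._* + (x * r ^ e)) (pos-^ (suc (e * l)) (e ∸ 1)) ⟩
  (+ suc (e * l)) ℤ.^ (e ∸ 1) ℤ.* + (x * r ^ e)     ≡⟨ cong (λ y → y ℤ.^ (e ∸ 1) ℤ.* + (x * r ^ e)) f≡ ⟩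
  (+ e ℤ.* + l ℤ.+ + 1) ℤ.^ (e ∸ 1) ℤ.* + (x * r ^ e) ∎
  where
  open ≡-Reasoning
  f≡ : + suc (e * l) ≡ + e ℤ.* + l ℤ.+ + 1
  f≡ = trans (cong +_ (ℕ.+-comm 1 (e * l))) (cong (ℤ._+ + 1) (ℤ.pos-* e l))

/-≡ : ∀ i j m n .{{_ : NonZero m}} .{{_ : NonZero n}} → i ℤ.* + n ≡ j ℤ.* + m → i / m ≡ j / n
/-≡ i j (suc m) (suc n) eq = fromℚᵘ-cong {mkℚᵘ i m} {mkℚᵘ j n} (*≡* eq)

/-* : ∀ i j m n .{{_ : NonZero m}} .{{_ : NonZero n}} → (i / m) ℚ.* (j / n) ≡ ((i ℤ.* j) / (m * n)) {{m*n≢0 m n}}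
/-* i j (suc m) (suc n) = toℚᵘ-injective (begin
  ℚ.toℚᵘ ((i / suc m) ℚ.* (j / suc n))             ≈⟨ toℚᵘ-homo-* (i / suc m) (j / suc n) ⟩
  ℚ.toℚᵘ (i / suc m) ℚᵘ.* ℚ.toℚᵘ (j / suc n)       ≈⟨ ℚᵘ.*-cong (toℚᵘ-fromℚᵘ (mkℚᵘ i m)) (toℚᵘ-fromℚᵘ (mkℚᵘ j n)) ⟩
  mkℚᵘ i m ℚᵘ.* mkℚᵘ j n                           ≈⟨ toℚᵘ-fromℚᵘ (mkℚᵘ i m ℚᵘ.* mkℚᵘ j n) ⟨
  ℚ.toℚᵘ ((i ℤ.* j) / (suc m * suc n))             ∎)
  where open import Relation.Binary.Reasoning.Setoid ℚᵘ.≃-setoid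

/-^ : ∀ u a .{{_ : NonZero a}} e → ((+ u) / a) ^ℚ e ≡ ((+ (u ^ e)) / (a ^ e)) {{m^n≢0 a e}}
/-^ u a zero    = refl
/-^ u a (suc e) = begin
  ((+ u) / a) ℚ.* ((+ u) / a) ^ℚ e         ≡⟨ cong (((+ u) / a) ℚ.*_) (/-^ u a e) ⟩
  ((+ u) / a) ℚ.* ((+ (u ^ e)) / (a ^ e))  ≡⟨ /-* (+ u) (+ (u ^ e)) a (a ^ e) ⟩
  (+ u ℤ.* + (u ^ e)) / (a * a ^ e)        ≡⟨ cong (_/ (a * a ^ e)) (ℤ.pos-* u (u ^ e)) ⟨
  (+ (u * u ^ e)) / (a * a ^ e)            ∎
  where
  open ≡-Reasoning
  instance
    a^e≢0 : NonZero (a ^ e)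
    a^e≢0 = m^n≢0 a e
    a*a^e≢0 : NonZero (a * a ^ e)
    a*a^e≢0 = m*n≢0 a (a ^ e)

-- The fraction `u / v` is the integer `r`, so its power is `r ^ e`.
first-formula : ∀ N F r X e u v .{{_ : NonZero v}} → + N ≡ F ℤ.* + (X * r ^ e) → u ≡ r * v →
  (+ N) / 1 ≡ (F / 1) ℚ.* ((+ u) / v) ^ℚ e ℚ.* ((+ X) / 1)
first-formula N F r X e u v N≡ refl = begin
  (+ N) / 1
    ≡⟨ cong (_/ 1) N≡ ⟩
  (F ℤ.* + (X * r ^ e)) / 1
    ≡⟨ cong (λ y → (F ℤ.* y) / 1) (trans (cong +_ (ℕ.*-comm X (r ^ e))) (ℤ.pos-* (r ^ e) X)) ⟩
  (F ℤ.* (+ (r ^ e) ℤ.* + X)) / 1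
    ≡⟨ cong (_/ 1) (ℤ.*-assoc F (+ (r ^ e)) (+ X)) ⟨
  (F ℤ.* + (r ^ e) ℤ.* + X) / 1
    ≡⟨ /-* (F ℤ.* + (r ^ e)) (+ X) 1 1 ⟨
  ((F ℤ.* + (r ^ e)) / 1) ℚ.* ((+ X) / 1)
    ≡⟨ cong (ℚ._* ((+ X) / 1)) (/-* F (+ (r ^ e)) 1 1) ⟨
  (F / 1) ℚ.* ((+ (r ^ e)) / 1) ℚ.* ((+ X) / 1)
    ≡⟨ cong (λ y → (F / 1) ℚ.* y ℚ.* ((+ X) / 1)) power ⟨
  (F / 1) ℚ.* ((+ (r * v)) / v) ^ℚ e ℚ.* ((+ X) / 1) ∎
  where
  open ≡-Reasoning
  power : ((+ (r * v)) / v) ^ℚ e ≡ (+ (r ^ e)) / 1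
  power = trans (cong (_^ℚ e) (/-≡ (+ (r * v)) (+ r) v 1 (trans (ℤ.*-identityʳ _) (ℤ.pos-* r v))))
    (trans (/-^ r 1 e) (/-cong {+ (r ^ e)} {1 ^ e} {+ (r ^ e)} {1} {{m^n≢0 1 e}} refl (ℕ.^-zeroˡ e)))

-- `eq` is the formula with the factor `F` removed and the denominators cleared; `F` is kept apart
-- as an integer because it can be negative.
second-formula : ∀ N F Q G e u a b .{{_ : NonZero a}} .{{_ : NonZero b}} → + N ≡ F ℤ.* + Q →
  Q * (b * a ^ e) ≡ G * u ^ e → (+ N) / 1 ≡ ((+ G) ℤ.* F) / b ℚ.* ((+ u) / a) ^ℚ e
second-formula N F Q G e u a b N≡ eq = begin
  (+ N) / 1
    ≡⟨ /-≡ (+ N) (+ G ℤ.* F ℤ.* + (u ^ e)) 1 (b * a ^ e) cross ⟩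
  (+ G ℤ.* F ℤ.* + (u ^ e)) / (b * a ^ e)
    ≡⟨ /-* (+ G ℤ.* F) (+ (u ^ e)) b (a ^ e) ⟨
  ((+ G ℤ.* F) / b) ℚ.* ((+ (u ^ e)) / (a ^ e))
    ≡⟨ cong (((+ G) ℤ.* F) / b ℚ.*_) (/-^ u a e) ⟨
  ((+ G) ℤ.* F) / b ℚ.* ((+ u) / a) ^ℚ e ∎
  where
  open ≡-Reasoning
  instance
    a^e≢0 : NonZero (a ^ e)
    a^e≢0 = m^n≢0 a e
    b*a^e≢0 : NonZero (b * a ^ e)
    b*a^e≢0 = m*n≢0 b (a ^ e)
  cross : + N ℤ.* + (b * a ^ e) ≡ + G ℤ.* F ℤ.* + (u ^ e) ℤ.* + 1
  cross = begin
    + N ℤ.* + (b * a ^ e)                 ≡⟨ cong (ℤ._* + (b * a ^ e)) N≡ ⟩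
    F ℤ.* + Q ℤ.* + (b * a ^ e)           ≡⟨ ℤ.*-assoc F (+ Q) (+ (b * a ^ e)) ⟩
    F ℤ.* (+ Q ℤ.* + (b * a ^ e))         ≡⟨ cong (F ℤ.*_) (ℤ.pos-* Q (b * a ^ e)) ⟨
    F ℤ.* + (Q * (b * a ^ e))             ≡⟨ cong (λ y → F ℤ.* + y) eq ⟩
    F ℤ.* + (G * u ^ e)                   ≡⟨ cong (F ℤ.*_) (ℤ.pos-* G (u ^ e)) ⟩
    F ℤ.* (+ G ℤ.* + (u ^ e))             ≡⟨ ℤ.*-assoc F (+ G) (+ (u ^ e)) ⟨
    F ℤ.* + G ℤ.* + (u ^ e)               ≡⟨ cong (ℤ._* + (u ^ e)) (ℤ.*-comm F (+ G)) ⟩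
    + G ℤ.* F ℤ.* + (u ^ e)               ≡⟨ ℤ.*-identityʳ _ ⟨
    + G ℤ.* F ℤ.* + (u ^ e) ℤ.* + 1       ∎

^-distrib-* : ∀ a b e → (a * b) ^ e ≡ a ^ e * b ^ e
^-distrib-* a b zero    = refl
^-distrib-* a b (suc e) = trans (cong (a * b *_) (^-distrib-* a b e)) (ℕ*.interchange a b (a ^ e) (b ^ e))
  where import Algebra.Properties.CommutativeSemigroup ℕ.*-commutativeSemigroup as ℕ*

-- r = |R_H|, a = |Aut H|, d = k - m
count-identity : ∀ d e r a l m! → 1 ≤ d → r * a ≡ l * (m! * d !) →
  ∏ {e} (λ i → (d * (e ∸ toℕ i) ∸ 1) C (d ∸ 1)) * r ^ e * (e ! * a ^ e) ≡ (e * d) ! * (m! * l) ^ e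
count-identity (suc d) e r a l m! _ ra≡ = begin
  X * r ^ e * (e ! * a ^ e)                       ≡⟨ gather X (r ^ e) (e !) (a ^ e) ⟩
  e ! * X * (r ^ e * a ^ e)                       ≡⟨ cong (e ! * X *_) (^-distrib-* r a e) ⟨
  e ! * X * (r * a) ^ e                           ≡⟨ cong (λ y → e ! * X * y ^ e) (trans ra≡ (swap l m! (suc d !))) ⟩
  e ! * X * ((suc d !) * (m! * l)) ^ e            ≡⟨ cong (e ! * X *_) (^-distrib-* (suc d !) (m! * l) e) ⟩
  e ! * X * ((suc d !) ^ e * (m! * l) ^ e)        ≡⟨ ℕ.*-assoc (e ! * X) ((suc d !) ^ e) ((m! * l) ^ e) ⟨
  e ! * X * (suc d !) ^ e * (m! * l) ^ e          ≡⟨ cong (_* (m! * l) ^ e) (partition-count d e) ⟩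
  (e * suc d) ! * (m! * l) ^ e                    ∎
  where
  open ≡-Reasoning
  X = ∏ {e} (λ i → (suc d * (e ∸ toℕ i) ∸ 1) C d)
  gather : ∀ x r f a → x * r * (f * a) ≡ f * x * (r * a)
  gather = solve-∀
  swap : ∀ l m d → l * (m * d) ≡ d * (m * l)
  swap = solve-∀

theorem1 :
    ∀ (k m e : ℕ) (m<k : m < k) → 1 ≤ e → (H : Graph m k) →
    let
      l : ℕ
      l = size H

      n : ℕ
      n = e * (k ∸ m) + m

      f : ℤ
      f = + e ℤ.* (+ l ℤ.- + 1) ℤ.+ + 1

      [m] : Subset n
      [m] = initial m

      Y : Setoid 0ℓ 0ℓ
      Y = RootedBuiltTrees H e [m]

      A : Set
      A = Fin e

      B : Set
      B = Fin e × Fin (l ∸ 1)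

      C′ : Set
      C′ = Σ[ L ∈ Subset n ] L ≡ [m]

      γ : B → A
      γ = proj₁

      -- An index i : Fin e stands for toℕ i + 1, so that e - i + 1 becomes e ∸ toℕ i.
      x : Fin e → ℕ
      x i = ((k ∸ m) * (e ∸ toℕ i) ∸ 1) C (k ∸ m ∸ 1)

      Z : Setoid 0ℓ 0ℓ
      Z = ×-setoid (CycleFreeFunctions A B C′ γ) (Π-setoid λ i → ×-setoid (setoid (Fin (x i))) (CopiesContainingInitial H))
    in
    Bijection Y Z ×
    (Σ[ |Y| ∈ ℕ ] Σ[ |Aut| ∈ ℕ ] HasCardinality Y |Y| × (Σ[ c ∈ HasCardinality (Aut H) |Aut| ]
      let
        instance
          |Aut|≢0 : NonZero |Aut|
          |Aut|≢0 = Aut-nonZero H c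

          binom*|Aut|≢0 : NonZero ((k C m) * |Aut|)
          binom*|Aut|≢0 = m*n≢0 (k C m) |Aut| {{nCk-nonZero (<⇒≤ m<k)}}

          e!≢0 : NonZero (e !)
          e!≢0 = e !≢0

        f^[e-1] : ℤ
        f^[e-1] = f ℤ.^ (e ∸ 1)
      in
      (+ |Y|) / 1 ≡ (f^[e-1] / 1) ℚ.* ((+ (k ! * l)) / ((k C m) * |Aut|)) ^ℚ e ℚ.* ((+ ∏ x) / 1) ×
      (+ |Y|) / 1 ≡ ((+ ((e * (k ∸ m)) !)) ℤ.* f^[e-1]) / (e !) ℚ.* ((+ (m ! * l)) / |Aut|) ^ℚ e))
theorem1 k m e m<k 1≤e H =
  cardY ⨾ Bijection-sym cardZ ,
  N , a , cardY , cardAut ,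
  first-formula N f^ r X e (k ! * l) ((k C m) * a) {{m*n≢0 (k C m) a {{nCk-nonZero (<⇒≤ m<k)}} {{a≢0}}}} N≡ k!l≡ ,
  second-formula N f^ (X * r ^ e) ((e * (k ∸ m)) !) e (m ! * l) a (e !) {{a≢0}} {{e !≢0}} N≡
    (count-identity (k ∸ m) e r a l (m !) (ℕ.m<n⇒0<n∸m m<k) ra≡)
  where
  l = size H
  f^ = (+ e ℤ.* (+ l ℤ.- + 1) ℤ.+ + 1) ℤ.^ (e ∸ 1)
  C′ = Σ[ L ∈ Subset (e * (k ∸ m) + m) ] L ≡ initial m
  F = CycleFreeFunctions (Fin e) (Fin e × Fin (l ∸ 1)) C′ proj₁
  x : Fin e → ℕ
  x i = ((k ∸ m) * (e ∸ toℕ i) ∸ 1) C (k ∸ m ∸ 1)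
  X = ∏ x
  copies = copies-finite H (<⇒≤ m<k)
  r = proj₁ copies
  automorphisms = Aut-cardinality H
  a = proj₁ automorphisms
  cardAut = proj₂ automorphisms
  a≢0 = Aut-nonZero H cardAut
  N = suc (e * (l ∸ 1)) ^ (e ∸ 1) * (X * r ^ e)
  cardY : HasCardinality (RootedBuiltTrees H e (initial {e * (k ∸ m) + m} m)) N
  cardY = RootedBuiltTrees-cardinality e m<k 1≤e H refl (proj₂ copies)
  Xs = λ i → ×-setoid (setoid (Fin (x i))) (CopiesContainingInitial H)
  cardZ : HasCardinality (×-setoid F (Π-setoid Xs)) N
  -- Z pairs X_i with R_H inside one product, so the factors `r` have to be collected into `r ^ e`.
  cardZ = subst (λ y → HasCardinality (×-setoid F (Π-setoid Xs)) (suc (e * (l ∸ 1)) ^ (e ∸ 1) * y)) (∏-*-const x r)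
    (×-cardinality F (Π-setoid Xs)
      (CycleFreeFunctions-cardinality e (l ∸ 1) (initial m , refl) (λ { (_ , refl) → refl }) 1≤e)
      (Π-cardinality e Xs (λ i → x i * r) λ i → ×-cardinality (setoid (Fin (x i))) (CopiesContainingInitial H) (Fin-cardinality (x i)) (proj₂ copies)))

  ra≡ : r * a ≡ l * (m ! * (k ∸ m) !)
  ra≡ = copies*automorphisms H (<⇒≤ m<k) (proj₂ copies) cardAut

  -- Settles the case in which `l ∸ 1` differs from the integer l - 1.
  r≡0 : l ≡ 0 → r ≡ 0
  r≡0 l≡0 = ℕ.m*n≡0⇒m≡0 r a {{a≢0}} (trans ra≡ (cong (_* (m ! * (k ∸ m) !)) l≡0))

  N≡ : + N ≡ f^ ℤ.* + (X * r ^ e)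
  N≡ = count-as-integer l e r X 1≤e r≡0

  -- Splitting k! as C(k, m) m! (k - m)! shows that the fraction in the first formula is `r`.
  k!l≡ : k ! * l ≡ r * ((k C m) * a)
  k!l≡ = trans (cong (_* l) (sym (nCk*k![n∸k]!≡n! (<⇒≤ m<k))))
    (trans (reorder (k C m) _ l) (trans (cong ((k C m) *_) (sym ra≡)) (swap (k C m) r a)))
    where
    reorder : ∀ c d l → c * d * l ≡ c * (l * d)
    reorder = solve-∀
    swap : ∀ c r a → c * (r * a) ≡ r * (c * a)
    swap = solve-∀
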